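{- Let $X$ be a (connected) simply laced Dynkin diagram with vertex set $[n]=\{1,\dots,n\}$ corresponding to the root system $\Phi$. For each assignment $\gamma:[n]\to\mathbb{Z}_{\geq 0}$ define the corresponding dominant weight $\lambda(\gamma):=\sum_{i=1}^n \gamma(i)\omega_i$. Then: (i) An assignment $\gamma':[n]\to\mathbb{Z}_{\ge 0}$ is obtained from $\gamma$ by a UCF move if and only if $W.\lambda(\gamma) \to W.\lambda(\gamma')$ in unlabeled central-firing. (ii) UCF moves always commute. More precisely, let $R_1$ and $R_2$ be two distinct zero connected components of $\gamma$, and let $\gamma'_1$ (resp., $\gamma'_2$) be the assignment obtained from $\gamma$ by a UCF move along $R_1$ (resp., along $R_2$). Then $\gamma'_1$ has a zero connected component $R'_2\supseteq R_2$, $\gamma'_2$ has a zero connected component $R'_1\supseteq R_1$, and applying a UCF move to $\gamma'_1$ along $R'_2$ produces the same result as applying a UCF move to $\gamma'_2$ along $R'_1$.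
   Context: $\Phi$ is an irreducible, reduced, crystallographic, simply laced root system (all roots of the same length) spanning a real inner product space $(V,\langle\cdot,\cdot\rangle)$ of dimension $n$, with simple roots $\alpha_1,\dots,\alpha_n$, positive roots $\Phi^+$, coroots $\alpha^\vee=2\alpha/\langle\alpha,\alpha\rangle$ and Weyl group $W$. Its Dynkin diagram $X$ is the graph on $[n]$ in which $i\ne j$ are joined by a single edge if and only if $\langle\alpha_i,\alpha_j^\vee\rangle=-1$ (otherwise $\langle\alpha_i,\alpha_j^\vee\rangle=0$). The weight lattice is $P=\{u\in V:\langle u,\alpha^\vee\rangle\in\mathbb{Z}\ \forall\alpha\in\Phi\}$, and the fundamental weights $\omega_i$ are defined by $\langle\omega_i,\alpha_j^\vee\rangle=\delta_{i,j}$. Central-firing is the relation on $P$ given by $\lambda\to\lambda+\alpha$ whenever $\alpha\in\Phi^+$ and $\langle\lambda,\alpha^\vee\rangle=0$. Unlabeled central-firing is the induced relation on $P/W$: $W.\lambda\to W.\mu$ iff there are $\lambda'\in W.\lambda$, $\mu'\in W.\mu$ with $\lambda'\to\mu'$. Affine completion. To each connected simply laced Dynkin diagram $R$ one associates its affine Dynkin diagram $\widetilde R$, with vertex set $R\cup\{0\}$ and containing $R$ as the induced subgraph on the vertices of $R$; with Bourbaki's numbering of $R$, the extra vertex $0$ is joined: by two edges to the unique vertex for type $A_1$; by one edge to each of the two end vertices for type $A_m$, $m\geq2$; by one edge to vertex $2$ for type $D_m$, $m\ge4$ (the neighbor of the leaf $1$ of the long arm; the central vertex for $D_4$); by one edge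 to vertex $2$ for $E_6$ (the leaf adjacent to the trivalent vertex); by one edge to vertex $1$ for $E_7$ (the leaf at the end of the arm of length two); by one edge to vertex $8$ for $E_8$ (the leaf at the end of the longest arm). Equivalently, the number of edges between $0$ and $i\in R$ is $\langle\theta_R,\alpha_i^\vee\rangle$, where $\theta_R$ is the highest root of the root system of $R$. UCF moves. Let $\gamma:[n]\to\mathbb{Z}_{\ge0}$. A zero connected component of $\gamma$ is a connected component of the induced subgraph of $X$ on $\{i\in[n]:\gamma(i)=0\}$. An unlabeled central-firing move (UCF move) along $R$ consists of: (1) choosing a zero connected component $R$ of $\gamma$; (2) completing $R$ to its affine Dynkin diagram $\widetilde R$ with vertex set $R\cup\{0\}$; (3) for every edge $\{0,i\}$ of $\widetilde R$ (counted with multiplicity), increasing $\gamma(i)$ by $1$; (4) for every vertex $j\notin R$ that is adjacent in $X$ to a vertex of $R$, decreasing $\gamma(j)$ by $1$. The resulting assignment is said to be obtained from $\gamma$ via a UCF move along $R$. -}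

module Defs where

open import Level using (Level; _⊔_; suc)
open import Algebra.Bundles using (CommutativeRing)
open import Algebra.Module.Bundles using (Module)
open import Data.Fin.Base using (Fin; toℕ)
open import Data.Fin.Subset using (Subset; _∈_; _∉_)
open import Data.Integer.Base as ℤ using (ℤ)
open import Data.List.Base using (List; []; _∷_; foldr; filter; length)
open import Data.List.Relation.Unary.Any using (Any)
open import Data.Nat.Base as ℕ using (ℕ; zero)
import Data.Nat.Properties as ℕₚ
open import Data.Product.Base using (Σ; ∃; ∃-syntax; _×_; _,_; proj₁)
open import Data.Sum.Base using (_⊎_)
open import Function.Base using (_on_)
open import Function.Bundles using (_⇔_)
open import Function.Definitions using (Injective)
open import Relation.Binary.Construct.Closure.ReflexiveTransitive using (Star)
open import Relation.Binary.Construct.Closure.Symmetric using (SymClosure)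
open import Relation.Binary.Core using (Rel)
open import Relation.Binary.PropositionalEquality.Core using (_≡_; _≢_)
open import Relation.Binary.Structures using (IsStrictTotalOrder)
open import Relation.Nullary.Negation.Core using (¬_)
open import Relation.Unary using (Pred; _⊆_; _∪_; Satisfiable)

import Algebra.Definitions.RawMonoid as RawMonoidDefs

-- The standard library has no real numbers.  An arbitrary ordered field
-- takes the place of ℝ; classically, ℝ is an instance.
record OrderedField (c ℓ₁ ℓ₂ : Level) : Set (suc (c ⊔ ℓ₁ ⊔ ℓ₂)) where
  infix 4 _<_
  infix 9 _⁻¹
  field
    commutativeRing : CommutativeRing c ℓ₁
  open CommutativeRing commutativeRing public
  field
    _<_                : Rel Carrier ℓ₂
    isStrictTotalOrder : IsStrictTotalOrder _≈_ _<_
    0<1                : 0# < 1#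
    +-monoʳ-<          : ∀ x {y z} → y < z → x + y < x + z
    *-pos              : ∀ {x y} → 0# < x → 0# < y → 0# < x * y
    -- 0# ⁻¹ is an unspecified junk value.
    _⁻¹                : Carrier → Carrier
    ⁻¹-inverseʳ        : ∀ x → ¬ x ≈ 0# → x * x ⁻¹ ≈ 1#

  open RawMonoidDefs +-rawMonoid public
    using () renaming (_×_ to _·_)

  fromℕ : ℕ → Carrier
  fromℕ k = k · 1#

  fromℤ : ℤ → Carrier
  fromℤ (ℤ.+ k)    = fromℕ k
  fromℤ ℤ.-[1+ k ] = - fromℕ (ℕ.suc k)

  IsInteger : Pred Carrier ℓ₁
  IsInteger x = ∃[ z ] x ≈ fromℤ z

record InnerProductSpace {c ℓ₁ ℓ₂ : Level} (K : OrderedField c ℓ₁ ℓ₂) (m ℓm : Level)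
                         : Set (c ⊔ ℓ₁ ⊔ ℓ₂ ⊔ suc (m ⊔ ℓm)) where
  open OrderedField K
  field
    vectorSpace : Module commutativeRing m ℓm
  open Module vectorSpace public
  field
    ⟨_,_⟩    : Carrierᴹ → Carrierᴹ → Carrier
    ⟨⟩-cong  : ∀ {u u′ v v′} → u ≈ᴹ u′ → v ≈ᴹ v′ → ⟨ u , v ⟩ ≈ ⟨ u′ , v′ ⟩
    ⟨⟩-sym   : ∀ u v → ⟨ u , v ⟩ ≈ ⟨ v , u ⟩
    ⟨⟩-+ˡ    : ∀ u v w → ⟨ u +ᴹ v , w ⟩ ≈ ⟨ u , w ⟩ + ⟨ v , w ⟩
    ⟨⟩-*ˡ    : ∀ a u v → ⟨ a *ₗ u , v ⟩ ≈ a * ⟨ u , v ⟩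
    ⟨⟩-posDef : ∀ v → ¬ v ≈ᴹ 0ᴹ → 0# < ⟨ v , v ⟩

  open RawMonoidDefs +ᴹ-rawMonoid public
    using () renaming (sum to ∑ᴹ; _×_ to _·ᴹ_)

  infix 9 _^∨
  _^∨ : Carrierᴹ → Carrierᴹ
  α ^∨ = ((1# + 1#) * ⟨ α , α ⟩ ⁻¹) *ₗ α

  reflect : Carrierᴹ → Carrierᴹ → Carrierᴹ
  reflect α v = v +ᴹ (-ᴹ (⟨ v , α ^∨ ⟩ *ₗ α))

record SimplyLacedRootSystem {c ℓ₁ ℓ₂ m ℓm : Level} {K : OrderedField c ℓ₁ ℓ₂}
                             (V : InnerProductSpace K m ℓm) (ℓ : Level)
                             : Set (c ⊔ ℓ₁ ⊔ m ⊔ ℓm ⊔ suc ℓ) where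
  open OrderedField K
  open InnerProductSpace V
  field
    Φ           : Pred Carrierᴹ ℓ
    Φ-resp      : ∀ {u v} → u ≈ᴹ v → Φ u → Φ v
    finite      : ∃[ roots ] (∀ {α} → Φ α → Any (α ≈ᴹ_) roots)
    nonzero     : ∀ {α} → Φ α → ¬ α ≈ᴹ 0ᴹ
    spanning    : ∀ v → ∃[ k ] Σ (Fin k → Carrier) λ a → Σ (Fin k → Carrierᴹ) λ β →
                  (∀ i → Φ (β i)) × v ≈ᴹ ∑ᴹ (λ i → a i *ₗ β i)
    reflection  : ∀ {α β} → Φ α → Φ β → Φ (reflect α β)
    crystallographic : ∀ {α β} → Φ α → Φ β → IsInteger ⟨ β , α ^∨ ⟩
    reduced     : ∀ {α} a → Φ α → Φ (a *ₗ α) → a ≈ 1# ⊎ a ≈ - 1#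
    simplyLaced : ∀ {α β} → Φ α → Φ β → ⟨ α , α ⟩ ≈ ⟨ β , β ⟩
    nonempty    : Satisfiable Φ
    irreducible : ¬ (Σ (Pred Carrierᴹ ℓ) λ Φ₁ → Σ (Pred Carrierᴹ ℓ) λ Φ₂ →
                     Φ₁ ⊆ Φ × Φ₂ ⊆ Φ × Φ ⊆ Φ₁ ∪ Φ₂ ×
                     Satisfiable Φ₁ × Satisfiable Φ₂ ×
                     (∀ {α β} → Φ₁ α → Φ₂ β → ⟨ α , β ⟩ ≈ 0#))

  InWeightLattice : Pred Carrierᴹ (ℓ₁ ⊔ m ⊔ ℓ)
  InWeightLattice u = ∀ {α} → Φ α → IsInteger ⟨ u , α ^∨ ⟩

  -- Elements of W are represented by words in the reflections; inverses
  -- are not needed since reflections are involutions.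
  WeylWord : Set (m ⊔ ℓ)
  WeylWord = List (∃ Φ)

  act : WeylWord → Carrierᴹ → Carrierᴹ
  act w v = foldr (λ α u → reflect (proj₁ α) u) v w

  infix 4 _∈W∙_
  _∈W∙_ : Rel Carrierᴹ (m ⊔ ℓm ⊔ ℓ)
  μ ∈W∙ v = ∃[ w ] μ ≈ᴹ act w v

-- A base of Φ with n elements, numbered by Fin n.  Since Φ spans V, the
-- simple roots form a basis of V, so that dim V = n.
record SimpleRoots {c ℓ₁ ℓ₂ m ℓm ℓ : Level} {K : OrderedField c ℓ₁ ℓ₂}
                   {V : InnerProductSpace K m ℓm}
                   (S : SimplyLacedRootSystem V ℓ) (n : ℕ)
                   : Set (c ⊔ ℓ₁ ⊔ m ⊔ ℓm ⊔ ℓ) where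
  open OrderedField K
  open InnerProductSpace V
  open SimplyLacedRootSystem S

  field
    α : Fin n → Carrierᴹ

  IsNonnegCombination : Pred Carrierᴹ ℓm
  IsNonnegCombination v = Σ (Fin n → ℕ) λ a → v ≈ᴹ ∑ᴹ (λ i → a i ·ᴹ α i)

  field
    α∈Φ         : ∀ i → Φ (α i)
    independent : ∀ (a : Fin n → Carrier) → ∑ᴹ (λ i → a i *ₗ α i) ≈ᴹ 0ᴹ →
                  ∀ i → a i ≈ 0#
    signed      : ∀ {β} → Φ β → IsNonnegCombination β ⊎ IsNonnegCombination (-ᴹ β)

  Φ⁺ : Pred Carrierᴹ (ℓm ⊔ ℓ)
  Φ⁺ β = Φ β × IsNonnegCombination β

  DynkinEdge : Rel (Fin n) ℓ₁
  DynkinEdge i j = i ≢ j × ⟨ α i , α j ^∨ ⟩ ≈ - 1#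

  AreFundamentalWeights : Pred (Fin n → Carrierᴹ) ℓ₁
  AreFundamentalWeights ω =
    (∀ i → ⟨ ω i , α i ^∨ ⟩ ≈ 1#) × (∀ i j → i ≢ j → ⟨ ω i , α j ^∨ ⟩ ≈ 0#)

  CentralFiring : Rel Carrierᴹ (ℓ₁ ⊔ m ⊔ ℓm ⊔ ℓ)
  CentralFiring v μ =
    InWeightLattice v × InWeightLattice μ ×
    ∃[ β ] (Φ⁺ β × ⟨ v , β ^∨ ⟩ ≈ 0# × μ ≈ᴹ v +ᴹ β)

  -- The relation on P/W, as a relation on representatives of the orbits.
  UnlabeledCentralFiring : Rel Carrierᴹ (ℓ₁ ⊔ m ⊔ ℓm ⊔ ℓ)
  UnlabeledCentralFiring v μ =
    ∃[ v′ ] ∃[ μ′ ] (v′ ∈W∙ v × μ′ ∈W∙ μ × CentralFiring v′ μ′)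

  weight : (Fin n → Carrierᴹ) → (Fin n → ℕ) → Carrierᴹ
  weight ω γ = ∑ᴹ (λ i → γ i ·ᴹ ω i)

-- Connected simply laced Dynkin diagrams, in Bourbaki's numbering.
-- A₁₊ k and D₄₊ k are the types A with rank 1 + k and D with rank 4 + k.
data DiagramType : Set where
  A₁₊ D₄₊  : ℕ → DiagramType
  E₆ E₇ E₈ : DiagramType

rank : DiagramType → ℕ
rank (A₁₊ k) = 1 ℕ.+ k
rank (D₄₊ k) = 4 ℕ.+ k
rank E₆      = 6
rank E₇      = 7
rank E₈      = 8

data ELink : ℕ → ℕ → Set where
  1—3 : ELink 1 3
  3—4 : ELink 3 4
  2—4 : ELink 2 4
  4—5 : ELink 4 5
  5—6 : ELink 5 6
  6—7 : ELink 6 7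
  7—8 : ELink 7 8

data DLink (rk : ℕ) : ℕ → ℕ → Set where
  arm  : ∀ {a} → ℕ.suc a ℕ.< rk → DLink rk a (ℕ.suc a)
  fork : ∀ {a} → 2 ℕ.+ a ≡ rk → DLink rk a rk

data ALink : ℕ → ℕ → Set where
  next : ∀ {a} → ALink a (ℕ.suc a)

Link : DiagramType → Rel ℕ _
Link (A₁₊ _)       = ALink
Link (D₄₊ k)       = DLink (4 ℕ.+ k)
Link E₆            = ELink
Link E₇            = ELink
Link E₈            = ELink

-- Bourbaki numbers start at 1.
number : ∀ {r} → Fin r → ℕ
number i = ℕ.suc (toℕ i)

DiagramEdge : (T : DiagramType) → Rel (Fin (rank T)) _
DiagramEdge T = SymClosure (Link T) on number

-- The neighbours of the extra vertex 0 in the affine diagram, listed once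
-- for every edge; in particular A₁ has the double edge 1 ∷ 1 ∷ [].
affineNeighbours : DiagramType → List ℕ
affineNeighbours (A₁₊ k) = 1 ∷ 1 ℕ.+ k ∷ []
affineNeighbours (D₄₊ k) = 2 ∷ []
affineNeighbours E₆      = 2 ∷ []
affineNeighbours E₇      = 1 ∷ []
affineNeighbours E₈      = 8 ∷ []

affineMultiplicity : (T : DiagramType) → Fin (rank T) → ℕ
affineMultiplicity T i = length (filter (number i ℕₚ.≟_) (affineNeighbours T))

module UCF {ℓ : Level} {n : ℕ} (Edge : Rel (Fin n) ℓ) where

  ZeroEdge : (Fin n → ℕ) → Rel (Fin n) ℓ
  ZeroEdge γ i j = γ i ≡ 0 × γ j ≡ 0 × Edge i j

  IsZeroComponent : (Fin n → ℕ) → Pred (Subset n) ℓ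
  IsZeroComponent γ R =
    ∃[ i ] (γ i ≡ 0 × (∀ j → j ∈ R ⇔ Star (ZeroEdge γ) i j))

  -- An isomorphism of the diagram of type T with the induced subgraph on R.
  record Numbering (T : DiagramType) (R : Subset n) : Set ℓ where
    field
      vertex    : Fin (rank T) → Fin n
      injective : Injective _≡_ _≡_ vertex
      image     : ∀ j → j ∈ R ⇔ (∃[ k ] vertex k ≡ j)
      edges     : ∀ k l → DiagramEdge T k l ⇔ Edge (vertex k) (vertex l)

  Adjoins : Fin n → Subset n → Set ℓ
  Adjoins j R = ∃[ i ] (i ∈ R × Edge i j)

  -- R determines the type, and the numbering up to a symmetry of the
  -- diagram, which preserves the affine multiplicities.
  record UCFMoveAlong (R : Subset n) (γ γ′ : Fin n → ℕ) : Set ℓ where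
    field
      component : IsZeroComponent γ R
      type      : DiagramType
      numbering : Numbering type R
    open Numbering numbering
    field
      increase  : ∀ k → γ′ (vertex k) ≡ γ (vertex k) ℕ.+ affineMultiplicity type k
      -- Here γ j ≥ 1, as j would otherwise belong to the component R.
      decrease  : ∀ j → j ∉ R → Adjoins j R → γ′ j ℕ.+ 1 ≡ γ j
      unchanged : ∀ j → j ∉ R → ¬ Adjoins j R → γ′ j ≡ γ j

  UCFMove : Rel (Fin n → ℕ) ℓ
  UCFMove γ γ′ = ∃[ R ] UCFMoveAlong R γ γ′

{-# OPTIONS --safe #-}
module Submission where

-- Central-firing at v commutes with the simple reflections of v, so it can be
-- studied on the dominant representative γ of an orbit.  There the firing root
-- β is orthogonal to γ, hence supported on the zeros of γ, and removing simple
-- roots one at a time shows γ + β ~ γ + α_i for a zero i of γ.  All zeros in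
-- the same component R give the same orbit, and so does the highest root θ_R
-- of R; but γ + θ_R is dominant, and it is the result of the UCF move along R,
-- because the pairings of θ_R with the simple roots are the multiplicities of
-- the affine diagram of R.  Orbits contain a single dominant weight, so this
-- proves (i).  For (ii), both orders of firing lead to the dominant weight in
-- the orbit of γ + θ_{R₁} + θ_{R₂}.
--
-- That every component R has a Dynkin diagram of type A, D or E is obtained by
-- adding one vertex u at a time.  As θ_R + α_u has positive norm, u is joined
-- to a single vertex, whose coefficient in θ_R is 1; this leaves few cases.

open import Defs
open import Level using (Level; _⊔_)
open import Data.Fin.Base using (Fin; zero; suc)
import Data.Fin.Properties as Fin
open import Data.Fin.Subset using (Subset; _⊆_)
import Data.Integer.Base as ℤ
open ℤ using (ℤ; +_; -[1+_]; 0ℤ; 1ℤ; -1ℤ)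
import Data.Integer.Properties as ℤ
open import Data.Integer.Tactic.RingSolver using (solve-∀)
open import Data.List.Base using ([]; _∷_)
open import Data.Nat.Base as ℕ using (ℕ; zero; suc)
open import Data.Product.Base using (Σ; _×_; _,_; proj₁; proj₂; ∃-syntax)
open import Data.Sum.Base using (_⊎_; inj₁; inj₂)
open import Function.Base using (_∘_)
open import Function.Bundles using (_⇔_; mk⇔)
import Relation.Binary.PropositionalEquality as ≡
open ≡ using (_≡_; _≢_; _≗_)
open import Relation.Binary.Definitions using (tri<; tri≈; tri>)
open import Relation.Binary.Structures using (IsStrictTotalOrder)
open import Relation.Nullary.Decidable using (Dec; yes; no)
open import Relation.Nullary.Negation.Core using (¬_; contradiction)
open import Algebra.Properties.Semiring.Sum ℤ.+-*-semiring using () renaming (sum to sumℤ)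
import Algebra.Module.Properties.LeftModule
import Algebra.Properties.CommutativeMonoid.Sum
import Algebra.Properties.CommutativeSemigroup
import Algebra.Properties.Ring
import Algebra.Properties.Semiring.Mult
import Algebra.Properties.Semiring.Sum
import Relation.Binary.Reasoning.Setoid

-- The root system enters the combinatorics only through the integer matrix `C` of pairings of
-- simple roots: symmetric, 2 on the diagonal, 0 or -1 elsewhere, positive definite. The work is
-- done over the integers, where equality and sign are decidable and identities go to the ring
-- solver; `Geometry` extracts `C` and carries roots and orbits back and forth. In the simply laced
-- case nothing is lost, because positive roots are the nonnegative lattice vectors of norm 2.
--
-- Two classical facts are proved in a form suited to this setting. Uniqueness of the dominant
-- weight comes from the commutation and braid relations, by exchanging steps of an increasing path
-- of weights. The classification is merged with the search for a component: a diagram is grown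
-- inside the zeros of `γ` until no vertex can be added, which yields type, numbering and membership
-- test at once. The bound that restricts the growth also explains why a neighbour of `R` loses
-- exactly 1.
--
-- In (ii) the second move may involve a larger component with another highest root; `θ_{R₂}` is
-- still supported there, and only the orbit matters.

module RootLattice where

  import Data.Fin.Subset.Properties as Subset
  open import Data.Fin.Base using (fromℕ; inject₁; opposite)
  open import Data.Fin.Patterns
  open import Data.Fin.Subset using (_∈_; _∉_)
  open import Data.Integer.Base using (+≤+; -≤+; -≤-; +<+; _+_; _*_; -_; _-_; _≤_; _<_; ∣_∣)
  import Data.List.Properties as List
  import Data.List.Relation.Unary.Any as Any
  open import Data.List.Base using (List; filter; length)
  open import Data.List.Membership.Propositional using () renaming (_∈_ to _∈ₗ_)
  open import Data.Nat.Base using (z≤n; s≤s)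
  import Data.Nat.Properties as ℕ
  import Data.Product.Properties as ×
  import Data.Vec.Base as Vec
  open Vec using (Vec; lookup; []; _∷_)
  import Data.Vec.Functional as Vector
  import Data.Vec.Properties as Vec
  open import Function.Bundles using (module Equivalence)
  open import Relation.Binary.Construct.Closure.ReflexiveTransitive as Star using (Star; ε; _◅_; _◅◅_)
  open import Relation.Binary.Construct.Closure.Symmetric using (SymClosure; fwd; bwd)
  open import Relation.Binary.Core using (Rel)
  open import Relation.Binary.PropositionalEquality
  open import Relation.Nullary.Decidable using (True; toWitness; from-yes; map′; does; dec-true; ¬?; _×-dec_; _→-dec_; _⊎-dec_)
  open import Algebra.Properties.Semiring.Sum ℤ.+-*-semiring
    using (sum; sum-cong-≗; ∑-distrib-+; ∑-comm; *-distribˡ-sum)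

  open Equivalence using (to; from)

  -- Finite sums of integers and the Kronecker delta.

  sum-0 : ∀ {n} {f : Fin n → ℤ} → (∀ i → f i ≡ 0ℤ) → sum f ≡ 0ℤ
  sum-0 {zero}  f≡0 = refl
  sum-0 {suc n} f≡0 = cong₂ _+_ (f≡0 zero) (sum-0 (f≡0 ∘ suc))

  sum-nonneg : ∀ {n} {f : Fin n → ℤ} → (∀ i → 0ℤ ≤ f i) → 0ℤ ≤ sum f
  sum-nonneg {zero}  0≤f = ℤ.≤-refl
  sum-nonneg {suc n} 0≤f = ℤ.+-mono-≤ (0≤f zero) (sum-nonneg (0≤f ∘ suc))

  sum-nonpos : ∀ {n} {f : Fin n → ℤ} → (∀ i → f i ≤ 0ℤ) → sum f ≤ 0ℤ
  sum-nonpos {zero}  f≤0 = ℤ.≤-refl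
  sum-nonpos {suc n} f≤0 = ℤ.+-mono-≤ (f≤0 zero) (sum-nonpos (f≤0 ∘ suc))

  term≤sum : ∀ {n} {f : Fin n → ℤ} → (∀ i → 0ℤ ≤ f i) → ∀ i → f i ≤ sum f
  term≤sum {f = f} 0≤f zero    =
    subst (_≤ sum f) (ℤ.+-identityʳ _) (ℤ.+-monoʳ-≤ (f zero) (sum-nonneg (0≤f ∘ suc)))
  term≤sum {f = f} 0≤f (suc i) =
    subst (_≤ sum f) (ℤ.+-identityˡ _) (ℤ.+-mono-≤ (0≤f zero) (term≤sum (0≤f ∘ suc) i))

  sum≤term : ∀ {n} {f : Fin n → ℤ} → (∀ i → f i ≤ 0ℤ) → ∀ i → sum f ≤ f i
  sum≤term {f = f} f≤0 zero    =
    subst (sum f ≤_) (ℤ.+-identityʳ _) (ℤ.+-monoʳ-≤ (f zero) (sum-nonpos (f≤0 ∘ suc)))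
  sum≤term {f = f} f≤0 (suc i) =
    subst (sum f ≤_) (ℤ.+-identityˡ _) (ℤ.+-mono-≤ (f≤0 zero) (sum≤term (f≤0 ∘ suc) i))

  -- Meant for `joined-column`, where two neighbours of one vertex would each contribute at most -1.
  sum≤term+term : ∀ {n} {f : Fin n → ℤ} → (∀ i → f i ≤ 0ℤ) →
                  ∀ i j → i ≢ j → sum f ≤ f i + f j
  sum≤term+term f≤0 zero    zero    i≢j = contradiction refl i≢j
  sum≤term+term {f = f} f≤0 zero    (suc j) i≢j = ℤ.+-monoʳ-≤ (f zero) (sum≤term (f≤0 ∘ suc) j)
  sum≤term+term {f = f} f≤0 (suc i) zero    i≢j =
    subst (sum f ≤_) (ℤ.+-comm (f zero) _) (ℤ.+-monoʳ-≤ (f zero) (sum≤term (f≤0 ∘ suc) i))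
  sum≤term+term {f = f} f≤0 (suc i) (suc j) i≢j =
    subst (sum f ≤_) (ℤ.+-identityˡ _)
      (ℤ.+-mono-≤ (f≤0 zero) (sum≤term+term (f≤0 ∘ suc) i j (i≢j ∘ cong suc)))

  -- The Kronecker delta, which serves as the coordinate vector of a simple root. Recursion on both
  -- indices, instead of a test for equality, makes it reduce under `suc`, as the recursive Cartan
  -- matrices require.
  e : ∀ {n} → Fin n → Fin n → ℤ
  e zero    zero    = 1ℤ
  e zero    (suc _) = 0ℤ
  e (suc _) zero    = 0ℤ
  e (suc i) (suc j) = e i j

  e-diag : ∀ {n} (i : Fin n) → e i i ≡ 1ℤ
  e-diag zero    = refl
  e-diag (suc i) = e-diag i

  e-off : ∀ {n} {i j : Fin n} → i ≢ j → e i j ≡ 0ℤ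
  e-off {i = zero}  {zero}  i≢j = contradiction refl i≢j
  e-off {i = zero}  {suc j} i≢j = refl
  e-off {i = suc i} {zero}  i≢j = refl
  e-off {i = suc i} {suc j} i≢j = e-off (i≢j ∘ cong suc)

  e-nonneg : ∀ {n} (i j : Fin n) → 0ℤ ≤ e i j
  e-nonneg zero    zero    = +≤+ z≤n
  e-nonneg zero    (suc j) = ℤ.≤-refl
  e-nonneg (suc i) zero    = ℤ.≤-refl
  e-nonneg (suc i) (suc j) = e-nonneg i j

  -- Integer vectors and their pairing.

  infixl 6 _⊕_
  _⊕_ : ∀ {n} → (Fin n → ℤ) → (Fin n → ℤ) → Fin n → ℤ
  (x ⊕ y) i = x i + y i

  infixl 7 _·_
  _·_ : ∀ {n} → ℤ → (Fin n → ℤ) → Fin n → ℤ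
  (k · x) i = k * x i

  opaque

    -- Weights and root lattice vectors are both written as integer vectors, in
    -- the bases of fundamental weights and of simple roots, which are dual to
    -- each other: this is the pairing of a weight with a lattice vector.
    ⟪_,_⟫ : ∀ {n} → (Fin n → ℤ) → (Fin n → ℤ) → ℤ
    ⟪ v , x ⟫ = sum (λ i → v i * x i)

    -- The only way to unfold the pairing outside the opaque block, where it remains an atom for
    -- rewriting and for the ring solver. Evaluation on concrete diagrams uses `sum` directly.
    ⟪⟫-sum : ∀ {n} (v x : Fin n → ℤ) → ⟪ v , x ⟫ ≡ sum (λ i → v i * x i)
    ⟪⟫-sum v x = refl

    ⟪⟫-congˡ : ∀ {n} {v w : Fin n → ℤ} x → v ≗ w → ⟪ v , x ⟫ ≡ ⟪ w , x ⟫
    ⟪⟫-congˡ x v≗w = sum-cong-≗ (λ i → cong (_* x i) (v≗w i))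

    ⟪⟫-congʳ : ∀ {n} (v : Fin n → ℤ) {x y : Fin n → ℤ} → x ≗ y → ⟪ v , x ⟫ ≡ ⟪ v , y ⟫
    ⟪⟫-congʳ v x≗y = sum-cong-≗ (λ i → cong (v i *_) (x≗y i))

    ⟪⟫-comm : ∀ {n} (v x : Fin n → ℤ) → ⟪ v , x ⟫ ≡ ⟪ x , v ⟫
    ⟪⟫-comm v x = sum-cong-≗ (λ i → ℤ.*-comm (v i) (x i))

    ⟪⟫-⊕ʳ : ∀ {n} (v x y : Fin n → ℤ) → ⟪ v , x ⊕ y ⟫ ≡ ⟪ v , x ⟫ + ⟪ v , y ⟫
    ⟪⟫-⊕ʳ v x y = trans (sum-cong-≗ (λ i → ℤ.*-distribˡ-+ (v i) (x i) (y i)))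
                        (∑-distrib-+ (λ i → v i * x i) (λ i → v i * y i))

    ⟪⟫-⊕ˡ : ∀ {n} (v w x : Fin n → ℤ) → ⟪ v ⊕ w , x ⟫ ≡ ⟪ v , x ⟫ + ⟪ w , x ⟫
    ⟪⟫-⊕ˡ v w x = trans (⟪⟫-comm (v ⊕ w) x)
      (trans (⟪⟫-⊕ʳ x v w) (cong₂ _+_ (⟪⟫-comm x v) (⟪⟫-comm x w)))

    ⟪⟫-·ʳ : ∀ {n} (v : Fin n → ℤ) k x → ⟪ v , k · x ⟫ ≡ k * ⟪ v , x ⟫
    ⟪⟫-·ʳ v k x = trans (sum-cong-≗ (λ i → swap (v i) k (x i)))
                        (sym (*-distribˡ-sum k (λ i → v i * x i)))
      where
      swap : ∀ a b c → a * (b * c) ≡ b * (a * c)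
      swap = solve-∀

    ⟪⟫-·ˡ : ∀ {n} k (v x : Fin n → ℤ) → ⟪ k · v , x ⟫ ≡ k * ⟪ v , x ⟫
    ⟪⟫-·ˡ k v x = trans (⟪⟫-comm (k · v) x)
                        (trans (⟪⟫-·ʳ x k v) (cong (k *_) (⟪⟫-comm x v)))

    ⟪⟫-e : ∀ {n} (v : Fin n → ℤ) i → ⟪ v , e i ⟫ ≡ v i
    ⟪⟫-e v zero    = trans (cong₂ _+_ (ℤ.*-identityʳ (v zero)) (sum-0 (λ i → ℤ.*-zeroʳ (v (suc i)))))
                           (ℤ.+-identityʳ (v zero))
    ⟪⟫-e v (suc i) = trans (cong₂ _+_ (ℤ.*-zeroʳ (v zero)) (⟪⟫-e (v ∘ suc) i)) (ℤ.+-identityˡ _)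

  -- Coefficients on the vertices of a diagram, pushed forward to the root lattice along a placement
  -- `h` of the vertices.
  comb : ∀ {r n} → (Fin r → Fin n) → (Fin r → ℤ) → Fin n → ℤ
  comb h t i = sum (λ a → t a * e (h a) i)

  ⟪⟫-comb : ∀ {r n} (v : Fin n → ℤ) (h : Fin r → Fin n) t →
            ⟪ v , comb h t ⟫ ≡ sum (λ a → t a * v (h a))
  ⟪⟫-comb v h t = begin
    ⟪ v , comb h t ⟫
      ≡⟨ ⟪⟫-sum v (comb h t) ⟩
    sum (λ i → v i * sum (λ a → t a * e (h a) i))
      ≡⟨ sum-cong-≗ (λ i → *-distribˡ-sum (v i) (λ a → t a * e (h a) i)) ⟩
    sum (λ i → sum (λ a → v i * (t a * e (h a) i)))
      ≡⟨ ∑-comm (λ i a → v i * (t a * e (h a) i)) ⟩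
    sum (λ a → sum (λ i → v i * (t a * e (h a) i)))
      ≡⟨ sum-cong-≗ (λ a → trans (sym (⟪⟫-sum v (t a · e (h a))))
           (trans (⟪⟫-·ʳ v (t a) (e (h a))) (cong (t a *_) (⟪⟫-e v (h a))))) ⟩
    sum (λ a → t a * v (h a)) ∎
    where open ≡-Reasoning

  -- The symmetric form of a Cartan matrix.

  module SymmetricForm {n : ℕ} (C : Fin n → Fin n → ℤ)
    (C-diag : ∀ i → C i i ≡ + 2)
    (C-sym  : ∀ i j → C i j ≡ C j i)
    where

    -- The change of coordinates from simple roots to fundamental weights: `A x` lists the pairings
    -- of the lattice vector `x` with the simple coroots. Accordingly `Q` is the squared norm,
    -- scaled so that roots have norm 2.
    A : (Fin n → ℤ) → Fin n → ℤ
    A x j = ⟪ C j , x ⟫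

    Q : (Fin n → ℤ) → ℤ
    Q x = ⟪ A x , x ⟫

    A-cong : ∀ {x y} → x ≗ y → A x ≗ A y
    A-cong x≗y j = ⟪⟫-congʳ (C j) x≗y

    A-⊕ : ∀ x y → A (x ⊕ y) ≗ A x ⊕ A y
    A-⊕ x y j = ⟪⟫-⊕ʳ (C j) x y

    A-e : ∀ i j → A (e i) j ≡ C j i
    A-e i j = ⟪⟫-e (C j) i

    A-sym : ∀ x y → ⟪ A x , y ⟫ ≡ ⟪ A y , x ⟫
    A-sym x y = begin
      ⟪ A x , y ⟫
        ≡⟨ ⟪⟫-sum (A x) y ⟩
      sum (λ j → A x j * y j)
        ≡⟨ sum-cong-≗ (λ j → trans (cong (_* y j) (⟪⟫-sum (C j) x))
             (trans (ℤ.*-comm _ (y j)) (*-distribˡ-sum (y j) (λ i → C j i * x i)))) ⟩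
      sum (λ j → sum (λ i → y j * (C j i * x i)))
        ≡⟨ ∑-comm (λ j i → y j * (C j i * x i)) ⟩
      sum (λ i → sum (λ j → y j * (C j i * x i)))
        ≡⟨ sum-cong-≗ (λ i → trans
             (sum-cong-≗ (λ j → trans (cong (λ c → y j * (c * x i)) (C-sym j i))
                                      (rearrange (y j) (C i j) (x i))))
             (sym (*-distribˡ-sum (x i) (λ j → C i j * y j)))) ⟩
      sum (λ i → x i * sum (λ j → C i j * y j))
        ≡⟨ sum-cong-≗ (λ i → trans (ℤ.*-comm (x i) _) (cong (_* x i) (sym (⟪⟫-sum (C i) y)))) ⟩
      sum (λ i → A y i * x i)
        ≡⟨ ⟪⟫-sum (A y) x ⟨
      ⟪ A y , x ⟫ ∎
      where
      open ≡-Reasoning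
      rearrange : ∀ a b c → a * (b * c) ≡ c * (b * a)
      rearrange = solve-∀

    A-· : ∀ k x → A (k · x) ≗ k · A x
    A-· k x j = ⟪⟫-·ʳ (C j) k x

    A·e : ∀ k i j → A (k · e i) j ≡ k * C j i
    A·e k i j = trans (A-· k (e i) j) (cong (k *_) (A-e i j))

    Q-⊕ : ∀ x y → Q (x ⊕ y) ≡ Q x + + 2 * ⟪ A x , y ⟫ + Q y
    Q-⊕ x y = begin
      ⟪ A (x ⊕ y) , x ⊕ y ⟫
        ≡⟨ ⟪⟫-congˡ (x ⊕ y) (A-⊕ x y) ⟩
      ⟪ A x ⊕ A y , x ⊕ y ⟫
        ≡⟨ ⟪⟫-⊕ˡ (A x) (A y) (x ⊕ y) ⟩
      ⟪ A x , x ⊕ y ⟫ + ⟪ A y , x ⊕ y ⟫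
        ≡⟨ cong₂ _+_ (⟪⟫-⊕ʳ (A x) x y) (⟪⟫-⊕ʳ (A y) x y) ⟩
      (Q x + ⟪ A x , y ⟫) + (⟪ A y , x ⟫ + Q y)
        ≡⟨ cong (λ p → (Q x + ⟪ A x , y ⟫) + (p + Q y)) (A-sym y x) ⟩
      (Q x + ⟪ A x , y ⟫) + (⟪ A x , y ⟫ + Q y)
        ≡⟨ collect (Q x) ⟪ A x , y ⟫ (Q y) ⟩
      Q x + + 2 * ⟪ A x , y ⟫ + Q y ∎
      where
      open ≡-Reasoning
      collect : ∀ q a r → (q + a) + (a + r) ≡ q + + 2 * a + r
      collect = solve-∀

    Q-e : ∀ i → Q (e i) ≡ + 2
    Q-e i = trans (⟪⟫-e (A (e i)) i) (trans (A-e i i) (C-diag i))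

    Q-⊕e : ∀ x i → Q (x ⊕ e i) ≡ Q x + + 2 * A x i + + 2
    Q-⊕e x i = trans (Q-⊕ x (e i))
      (cong₂ (λ a b → Q x + + 2 * a + b) (⟪⟫-e (A x) i) (Q-e i))

    Q-⊕·e : ∀ x k i → Q (x ⊕ k · e i) ≡ Q x + + 2 * (k * A x i) + k * (k * + 2)
    Q-⊕·e x k i = trans (Q-⊕ x (k · e i)) (cong₂ (λ a b → Q x + + 2 * a + b)
      (trans (⟪⟫-·ʳ (A x) k (e i)) (cong (k *_) (⟪⟫-e (A x) i)))
      (trans (⟪⟫-·ʳ (A (k · e i)) k (e i)) (cong (k *_)
        (trans (⟪⟫-e (A (k · e i)) i) (trans (A·e k i i) (cong (k *_) (C-diag i)))))))

  -- Simple reflections and the dominant weight of an orbit.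

  module CartanMatrix {n : ℕ} (C : Fin n → Fin n → ℤ)
    (C-diag : ∀ i → C i i ≡ + 2)
    (C-sym  : ∀ i j → C i j ≡ C j i)
    (C-off  : ∀ {i j} → i ≢ j → C i j ≡ 0ℤ ⊎ C i j ≡ -1ℤ)
    where

    open SymmetricForm C C-diag C-sym public

    C≤0 : ∀ {i j} → i ≢ j → C i j ≤ 0ℤ
    C≤0 i≢j with C-off i≢j
    ... | inj₁ p = ℤ.≤-reflexive p
    ... | inj₂ p = subst (_≤ 0ℤ) (sym p) -≤+

    -- The simple reflection in weight coordinates; column `i` of `C` holds the coordinates of the
    -- simple root `α_i`.
    s : Fin n → (Fin n → ℤ) → Fin n → ℤ
    s i v j = v j - v i * C j i

    s-cong : ∀ i {v w} → v ≗ w → s i v ≗ s i w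
    s-cong i v≗w j = cong₂ (λ a b → a - b * C j i) (v≗w j) (v≗w i)

    s-self : ∀ i v → s i v i ≡ - v i
    s-self i v rewrite C-diag i = alg (v i)
      where
      alg : ∀ a → a - a * + 2 ≡ - a
      alg = solve-∀

    s-invol : ∀ i v → s i (s i v) ≗ v
    s-invol i v j rewrite C-diag i = alg (v j) (v i) (C j i)
      where
      alg : ∀ a p x → (a - p * x) - (p - p * + 2) * x ≡ a
      alg = solve-∀

    s-fix : ∀ i {v} → v i ≡ 0ℤ → s i v ≗ v
    s-fix i {v} vi≡0 j rewrite vi≡0 = alg (v j) (C j i)
      where
      alg : ∀ a x → a - 0ℤ * x ≡ a
      alg = solve-∀

    s-off : ∀ i j v {c} → C j i ≡ c → s i v j ≡ v j - v i * c
    s-off i j v refl = refl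

    s-comm : ∀ i j v → C i j ≡ 0ℤ → s i (s j v) ≗ s j (s i v)
    s-comm i j v p l rewrite trans (C-sym j i) p | p = alg (v l) (v i) (v j) (C l i) (C l j)
      where
      alg : ∀ a p q x y → (a - q * y) - (p - q * 0ℤ) * x ≡ (a - p * x) - (q - p * 0ℤ) * y
      alg = solve-∀

    s-braid : ∀ i j v → C i j ≡ -1ℤ → s j (s i (s j v)) ≗ s i (s j (s i v))
    s-braid i j v p l rewrite trans (C-sym j i) p | p | C-diag i | C-diag j =
      alg (v l) (v i) (v j) (C l i) (C l j)
      where
      alg : ∀ a p q x y →
        ((a - q * y) - (p - q * -1ℤ) * x) - ((q - q * + 2) - (p - q * -1ℤ) * -1ℤ) * y ≡
        ((a - p * x) - (q - p * -1ℤ) * y) - ((p - p * + 2) - (q - p * -1ℤ) * -1ℤ) * x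
      alg = solve-∀

    Dominant : (Fin n → ℤ) → Set
    Dominant v = ∀ i → 0ℤ ≤ v i

    -- The orbit relation of the group generated by the simple reflections. Ending in `≗` instead of
    -- `≡` stands in for function extensionality.
    infix 4 _~_
    data _~_ (v w : Fin n → ℤ) : Set where
      done : v ≗ w → v ~ w
      step : ∀ i → s i v ~ w → v ~ w

    ~-resp : ∀ {v v′ w} → v ≗ v′ → v′ ~ w → v ~ w
    ~-resp p (done q)   = done (λ i → trans (p i) (q i))
    ~-resp p (step i r) = step i (~-resp (s-cong i p) r)

    ~-refl : ∀ {v} → v ~ v
    ~-refl = done (λ _ → refl)

    ~-trans : ∀ {u v w} → u ~ v → v ~ w → u ~ w
    ~-trans (done p)   q = ~-resp p q
    ~-trans (step i p) q = step i (~-trans p q)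

    ~-s : ∀ i v → s i v ~ v
    ~-s i v = step i (done (s-invol i v))

    ~-sym : ∀ {v w} → v ~ w → w ~ v
    ~-sym         (done p)   = done (λ i → sym (p i))
    ~-sym {v = v} (step i p) = ~-trans (~-sym p) (~-s i v)

    -- Every step adds a positive multiple of a simple root. The length is recorded because, for
    -- dominant `μ`, all ways of climbing from `v` reach `μ` after the same number of steps; this is
    -- the content of `climb-first`.
    data Climb (v μ : Fin n → ℤ) : ℕ → Set where
      top : v ≗ μ → Climb v μ 0
      up  : ∀ {k} i → v i < 0ℤ → Climb (s i v) μ k → Climb v μ (suc k)

    Climb-resp : ∀ {v v′ μ k} → v ≗ v′ → Climb v′ μ k → Climb v μ k
    Climb-resp p (top q)      = top (λ i → trans (p i) (q i))
    Climb-resp p (up i neg c) = up i (subst (_< 0ℤ) (sym (p i)) neg) (Climb-resp (s-cong i p) c)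

    top-not-negative : ∀ {v μ i} → Dominant μ → Climb v μ 0 → ¬ v i < 0ℤ
    top-not-negative {i = i} dom (top v≗μ) neg =
      ℤ.<⇒≱ neg (subst (0ℤ ≤_) (sym (v≗μ i)) (dom i))

    -- Whether the reflections i and j commute or satisfy the braid relation,
    -- the climb starting with j can be rewritten to start with i without
    -- changing its length; the recursion on the length replaces termination.
    climb-first : ∀ k {v μ} → Dominant μ → ∀ i → v i < 0ℤ → Climb v μ (suc k) → Climb (s i v) μ k
    climb-first k {v} {μ} dom i neg (up j neg′ c) with i Fin.≟ j
    ... | yes refl = c
    ... | no i≢j with C-off i≢j
    climb-first zero {v} {μ} dom i neg (up j neg′ c) | no i≢j | inj₁ p =
      contradiction
        (subst (_< 0ℤ) (sym (trans (s-off j i v p) (alg (v i) (v j)))) neg)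
        (top-not-negative {i = i} dom c)
      where
      alg : ∀ a b → a - b * 0ℤ ≡ a
      alg = solve-∀
    climb-first (suc k) {v} {μ} dom i neg (up j neg′ c) | no i≢j | inj₁ p =
      up j (subst (_< 0ℤ) (sym (trans (s-off i j v (trans (C-sym j i) p)) (alg (v j) (v i)))) neg′)
         (Climb-resp (λ l → sym (s-comm i j v p l))
           (climb-first k dom i (subst (_< 0ℤ) (sym (trans (s-off j i v p) (alg (v i) (v j)))) neg) c))
      where
      alg : ∀ a b → a - b * 0ℤ ≡ a
      alg = solve-∀
    climb-first k {v} {μ} dom i neg (up j neg′ c) | no i≢j | inj₂ p = braid k c
      where
      alg : ∀ a b → a - b * -1ℤ ≡ b + a
      alg = solve-∀

      alg₂ : ∀ a b → (a - a * + 2) - (b - a * -1ℤ) * -1ℤ ≡ b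
      alg₂ = solve-∀

      C-ji : C j i ≡ -1ℤ
      C-ji = trans (C-sym j i) p

      sj-neg : s j v i < 0ℤ
      sj-neg = subst (_< 0ℤ) (sym (trans (s-off j i v p) (alg (v i) (v j)))) (ℤ.+-mono-< neg′ neg)

      si-neg : s i v j < 0ℤ
      si-neg = subst (_< 0ℤ) (sym (trans (s-off i j v C-ji) (alg (v j) (v i)))) (ℤ.+-mono-< neg neg′)

      sisj-neg : s i (s j v) j < 0ℤ
      sisj-neg = subst (_< 0ℤ) (sym value) neg
        where
        value : s i (s j v) j ≡ v i
        value rewrite C-ji | p | C-diag j = alg₂ (v j) (v i)

      sjsi-neg : s j (s i v) i < 0ℤ
      sjsi-neg = subst (_< 0ℤ) (sym value) neg′
        where
        value : s j (s i v) i ≡ v j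
        value rewrite C-ji | p | C-diag i = alg₂ (v i) (v j)

      braid : ∀ k → Climb (s j v) μ k → Climb (s i v) μ k
      -- A climb this short would end at a weight with a negative coordinate, while `μ` is dominant.
      -- From length 2 on, the start `j`, `i`, `j` is traded for `i`, `j`, `i`.
      braid zero          c = contradiction sj-neg (top-not-negative dom c)
      braid (suc zero)    c =
        contradiction sisj-neg (top-not-negative dom (climb-first zero dom i sj-neg c))
      braid (suc (suc k)) c =
        up j si-neg (up i sjsi-neg (Climb-resp (λ l → sym (s-braid i j v p l))
          (climb-first k dom j sisj-neg (climb-first (suc k) dom i sj-neg c))))

    -- A reflection at a zero coordinate changes nothing, at a positive one it prepends a step to
    -- the climb, and at a negative one `climb-first` lets it be the first step, which is then
    -- dropped.
    climb-along : ∀ {v w μ k} → Dominant μ → v ~ w → Climb v μ k → ∃[ l ] Climb w μ l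
    climb-along dom (done p) c = _ , Climb-resp (λ i → sym (p i)) c
    climb-along {v} dom (step i r) c with ℤ.<-cmp (v i) 0ℤ
    ... | tri≈ _ vi≡0 _ = climb-along dom r (Climb-resp (s-fix i vi≡0) c)
    ... | tri> _ _ vi>0 = climb-along dom r
            (up i (subst (_< 0ℤ) (sym (s-self i v)) (ℤ.neg-mono-< vi>0)) (Climb-resp (s-invol i v) c))
    climb-along {k = zero}  dom (step i r) c | tri< neg _ _ = contradiction neg (top-not-negative dom c)
    climb-along {k = suc k} dom (step i r) c | tri< neg _ _ = climb-along dom r (climb-first k dom i neg c)

    -- The empty climb at `v`, carried along the chain, becomes a climb from `w` to `v`; it has no
    -- step because `w` has no negative coordinate.
    dominant-unique : ∀ {v w} → Dominant v → Dominant w → v ~ w → v ≗ w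
    dominant-unique dom-v dom-w v~w with climb-along dom-v v~w (top (λ _ → refl))
    ... | _ , top p      = λ i → sym (p i)
    ... | _ , up i neg _ = contradiction (dom-w i) (ℤ.<⇒≱ neg)

  -- Positive roots of a positive definite Cartan matrix.

  positive-term : ∀ {n} {f : Fin n → ℤ} → 0ℤ < sum f → ∃[ i ] 0ℤ < f i
  positive-term {zero}      0<0 = contradiction refl (ℤ.<⇒≢ 0<0)
  positive-term {suc n} {f} 0<∑ with 0ℤ ℤ.<? f zero
  ... | yes 0<f₀ = zero , 0<f₀
  ... | no  0≮f₀ =
    let (i , 0<fi) = positive-term (ℤ.<-≤-trans 0<∑ (subst (sum f ≤_) (ℤ.+-identityˡ _)
                       (ℤ.+-monoˡ-≤ (sum (f ∘ suc)) (ℤ.≮⇒≥ 0≮f₀))))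
    in suc i , 0<fi

  *-nonneg : ∀ a b → 0ℤ ≤ a → 0ℤ ≤ b → 0ℤ ≤ a * b
  *-nonneg (+ a) (+ b) _ _ = subst (0ℤ ≤_) (ℤ.pos-* a b) (+≤+ z≤n)

  nonneg*nonpos : ∀ a b → 0ℤ ≤ a → b ≤ 0ℤ → a * b ≤ 0ℤ
  nonneg*nonpos (+ a) b _ b≤0 = subst (+ a * b ≤_) (ℤ.*-zeroʳ (+ a)) (ℤ.*-monoˡ-≤-nonNeg (+ a) b≤0)

  factors-positive : ∀ a b → 0ℤ ≤ a → 0ℤ < a * b → 0ℤ < a × 0ℤ < b
  factors-positive (+ zero)  b _ 0<ab = contradiction refl (ℤ.<⇒≢ 0<ab)
  factors-positive (+ suc a) b 0≤a 0<ab with 0ℤ ℤ.<? b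
  ... | yes 0<b = +<+ (s≤s z≤n) , 0<b
  ... | no 0≮b  = contradiction (nonneg*nonpos (+ suc a) b 0≤a (ℤ.≮⇒≥ 0≮b)) (ℤ.<⇒≱ 0<ab)

  height : ∀ {n} → (Fin n → ℤ) → ℤ
  height x = ⟪ (λ _ → 1ℤ) , x ⟫

  height-nonneg : ∀ {n} {x : Fin n → ℤ} → (∀ i → 0ℤ ≤ x i) → 0ℤ ≤ height x
  height-nonneg {x = x} 0≤x = subst (0ℤ ≤_) (sym (⟪⟫-sum _ x))
    (sum-nonneg (λ j → *-nonneg 1ℤ (x j) (+≤+ z≤n) (0≤x j)))

  coefficient≤height : ∀ {n} {x : Fin n → ℤ} → (∀ i → 0ℤ ≤ x i) → ∀ i → x i ≤ height x
  coefficient≤height {x = x} 0≤x i =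
    subst₂ _≤_ (ℤ.*-identityˡ (x i)) (sym (⟪⟫-sum _ x))
           (term≤sum (λ j → subst (0ℤ ≤_) (sym (ℤ.*-identityˡ (x j))) (0≤x j)) i)

  module PositiveDefinite {n : ℕ} (C : Fin n → Fin n → ℤ)
    (C-diag : ∀ i → C i i ≡ + 2)
    (C-sym  : ∀ i j → C i j ≡ C j i)
    (C-off  : ∀ {i j} → i ≢ j → C i j ≡ 0ℤ ⊎ C i j ≡ -1ℤ)
    (Q-pos  : ∀ x i → x i ≢ 0ℤ → 0ℤ < SymmetricForm.Q C C-diag C-sym x)
    where

    open CartanMatrix C C-diag C-sym C-off public

    Q≤0⇒0 : ∀ x → Q x ≤ 0ℤ → ∀ i → x i ≡ 0ℤ
    Q≤0⇒0 x Q≤0 i with x i ℤ.≟ 0ℤ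
    ... | yes p = p
    ... | no ¬p = contradiction Q≤0 (ℤ.<⇒≱ (Q-pos x i ¬p))

    -- Positive roots recognised by their norm, so that `Φ` does not appear in the combinatorics;
    -- `root⇒Φ` and `root-coordinates` connect the two descriptions.
    Root : (Fin n → ℤ) → Set
    Root β = (∀ i → 0ℤ ≤ β i) × Q β ≡ + 2

    e-root : ∀ i → Root (e i)
    e-root i = e-nonneg i , Q-e i

    -- The norm of `β - α_i` is `4 - 2 * A β i`, which is then not positive, so the difference
    -- vanishes.
    simple-if-A>1 : ∀ {β} → Root β → ∀ i → 1ℤ < A β i → β ≗ e i
    simple-if-A>1 {β} (0≤β , Q≡2) i 1<A j = ℤ.i-j≡0⇒i≡j (β j) (e i j)
      (trans (alg (β j) (e i j)) (Q≤0⇒0 (β ⊕ -1ℤ · e i) Q≤0 j))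
      where
      alg : ∀ a b → a - b ≡ a + -1ℤ * b
      alg = solve-∀
      alg₂ : ∀ a → + 2 + + 2 * (-1ℤ * a) + -1ℤ * (-1ℤ * + 2) ≡ + 2 * (+ 2 - a)
      alg₂ = solve-∀
      Q≤0 : Q (β ⊕ -1ℤ · e i) ≤ 0ℤ
      Q≤0 rewrite Q-⊕·e β -1ℤ i | Q≡2 | alg₂ (A β i) =
        nonneg*nonpos (+ 2) (+ 2 - A β i) (+≤+ z≤n) (ℤ.i≤j⇒i-j≤0 (ℤ.i<j⇒suc[i]≤j 1<A))

    -- The diagonal entry is the only positive one in row `i` of `C`, so a positive pairing can come
    -- only from the coefficient at `i`.
    A>0⇒coefficient>0 : ∀ {β} → Root β → ∀ i → 0ℤ < A β i → 0ℤ < β i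
    A>0⇒coefficient>0 {β} (0≤β , _) i 0<A =
      let (j , 0<Cβ) = positive-term (subst (0ℤ <_) (⟪⟫-sum (C i) β) 0<A)
          (0<βj , 0<C) = factors-positive (β j) (C i j) (0≤β j) (subst (0ℤ <_) (ℤ.*-comm (C i j) (β j)) 0<Cβ)
      in subst (λ k → 0ℤ < β k) (sym (diagonal j 0<C)) 0<βj
      where
      diagonal : ∀ j → 0ℤ < C i j → i ≡ j
      diagonal j 0<C with i Fin.≟ j
      ... | yes i≡j = i≡j
      ... | no  i≢j = contradiction (C≤0 i≢j) (ℤ.<⇒≱ 0<C)

    -- Only the coefficient at `i` changes. It decreases only when the pairing is 1, and then
    -- `A>0⇒coefficient>0` leaves room for it. This is the fact that a simple reflection permutes
    -- the positive roots other than its own.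
    reflect-root : ∀ {β} → Root β → ∀ i → β ≗ e i ⊎ Root (β ⊕ (- A β i) · e i)
    reflect-root {β} root@(0≤β , Q≡2) i = cases
      where
      alg : ∀ a → + 2 + + 2 * (- a * a) + - a * (- a * + 2) ≡ + 2
      alg = solve-∀
      norm : Q (β ⊕ (- A β i) · e i) ≡ + 2
      norm rewrite Q-⊕·e β (- A β i) i | Q≡2 = alg (A β i)
      cases : β ≗ e i ⊎ Root (β ⊕ (- A β i) · e i)
      cases with 1ℤ ℤ.<? A β i
      ... | yes 1<A = inj₁ (simple-if-A>1 root i 1<A)
      ... | no  1≮A with 0ℤ ℤ.<? A β i
      ...   | no  0≮A = inj₂ ((λ j → ℤ.+-mono-≤ (0≤β j)
                (*-nonneg (- A β i) (e i j) (ℤ.neg-mono-≤ (ℤ.≮⇒≥ 0≮A)) (e-nonneg i j))) , norm)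
      ...   | yes 0<A = inj₂ (nonneg , norm)
        where
        A≡1 : A β i ≡ 1ℤ
        A≡1 = ℤ.≤-antisym (ℤ.≮⇒≥ 1≮A) (ℤ.i<j⇒suc[i]≤j 0<A)
        nonneg : ∀ j → 0ℤ ≤ β j + - A β i * e i j
        nonneg j rewrite A≡1 with i Fin.≟ j
        ... | yes refl rewrite e-diag i = ℤ.i≤j⇒0≤j-i (ℤ.i<j⇒suc[i]≤j (A>0⇒coefficient>0 root i 0<A))
        ... | no i≢j rewrite e-off i≢j | ℤ.+-identityʳ (β j) = 0≤β j

    -- The norm 2 is the sum of the products `A β i * β i`, so one of them is positive. Subtracting
    -- `α_i` there gives a smaller root, which drives the induction.
    removable : ∀ {β} → Root β → ∃[ i ] (0ℤ < β i × (β ≗ e i ⊎ A β i ≡ 1ℤ))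
    removable {β} root@(0≤β , Q≡2) =
      let (i , 0<Aβ*β) = positive-term (subst (0ℤ <_) (trans (sym Q≡2) (⟪⟫-sum (A β) β)) (+<+ (s≤s z≤n)))
          (0<βi , 0<A) = factors-positive (β i) (A β i) (0≤β i) (subst (0ℤ <_) (ℤ.*-comm (A β i) (β i)) 0<Aβ*β)
      in i , 0<βi , cases i 0<A
      where
      cases : ∀ i → 0ℤ < A β i → β ≗ e i ⊎ A β i ≡ 1ℤ
      cases i 0<A with 1ℤ ℤ.<? A β i
      ... | yes 1<A = inj₁ (simple-if-A>1 root i 1<A)
      ... | no  1≮A = inj₂ (ℤ.≤-antisym (ℤ.≮⇒≥ 1≮A) (ℤ.i<j⇒suc[i]≤j 0<A))

    -- Induction on the height. In `grow` the pairing -1 says that `β + α_i` is the reflection of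
    -- `β` in `α_i`; this is what each application exploits.
    module RootInduction {p : Level} (P : (Fin n → ℤ) → Set p)
      (resp   : ∀ {x y} → x ≗ y → P x → P y)
      (simple : ∀ i → P (e i))
      (grow   : ∀ β i → Root β → A β i ≡ -1ℤ → P β → P (β ⊕ e i))
      where

      bounded : ∀ h β → Root β → height β ≤ + h → P β
      bounded h β root@(0≤β , Q≡2) β≤h with removable root
      ... | i , 0<βi , inj₁ β≗e = resp (λ j → sym (β≗e j)) (simple i)
      bounded zero β root@(0≤β , _) β≤h | i , 0<βi , inj₂ A≡1 =
        contradiction (ℤ.≤-trans (coefficient≤height 0≤β i) β≤h) (ℤ.<⇒≱ 0<βi)
      bounded (suc h) β root@(0≤β , Q≡2) β≤h | i , 0<βi , inj₂ A≡1 =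
        resp restore (grow β⁻ i β⁻-root A⁻≡-1 (bounded h β⁻ β⁻-root β⁻≤h))
        where
        β⁻ : Fin n → ℤ
        β⁻ = β ⊕ -1ℤ · e i

        restore : β⁻ ⊕ e i ≗ β
        restore j = alg (β j) (e i j)
          where
          alg : ∀ a b → (a + -1ℤ * b) + b ≡ a
          alg = solve-∀

        A⁻≡-1 : A β⁻ i ≡ -1ℤ
        A⁻≡-1 rewrite A-⊕ β (-1ℤ · e i) i | A·e -1ℤ i i | C-diag i | A≡1 = refl

        β⁻-root : Root β⁻
        β⁻-root with reflect-root root i
        ... | inj₂ root′ = subst (λ a → Root (β ⊕ - a · e i)) A≡1 root′
        ... | inj₁ β≗e = contradiction
                (trans (sym A≡1) (trans (A-cong β≗e i) (trans (A-e i i) (C-diag i)))) λ ()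

        β⁻≤h : height β⁻ ≤ + h
        β⁻≤h rewrite ⟪⟫-⊕ʳ (λ _ → 1ℤ) β (-1ℤ · e i) | ⟪⟫-·ʳ (λ _ → 1ℤ) -1ℤ (e i)
                   | ⟪⟫-e (λ _ → 1ℤ) i = ℤ.+-monoˡ-≤ -1ℤ β≤h

      root-induction : ∀ β → Root β → P β
      root-induction β root@(0≤β , _) =
        bounded _ β root (ℤ.≤-reflexive (sym (ℤ.0≤i⇒+∣i∣≡i (height-nonneg 0≤β))))

    open RootInduction public using (root-induction)

    reflection : (Fin n → ℤ) → (Fin n → ℤ) → Fin n → ℤ
    reflection β v = v ⊕ (- ⟪ v , β ⟫) · A β

    s-reflection : ∀ i v → s i v ≗ v ⊕ (- v i) · A (e i)
    s-reflection i v j rewrite A-e i j = alg (v j) (v i) (C j i)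
      where
      alg : ∀ a b c → a - b * c ≡ a + - b * c
      alg = solve-∀

    ⟪s⟫ : ∀ i v β → ⟪ s i v , β ⟫ ≡ ⟪ v , β ⟫ - v i * A β i
    ⟪s⟫ i v β rewrite ⟪⟫-congˡ β (s-reflection i v) | ⟪⟫-⊕ˡ v ((- v i) · A (e i)) β
      | ⟪⟫-·ˡ (- v i) (A (e i)) β | A-sym (e i) β | ⟪⟫-e (A β) i =
      cong (_+_ ⟪ v , β ⟫) (sym (ℤ.neg-distribˡ-* (v i) (A β i)))

    -- When a root grows from `β` to `s_i β`, its reflection is that of `β` conjugated by `s_i`.
    -- Hence every reflection is a product of simple ones.
    reflection-~ : ∀ β → Root β → ∀ v → reflection β v ~ v
    reflection-~ = root-induction _ (λ {x} {y} → transfer {x} {y}) simple grow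
      where
      transfer : ∀ {β β′} → β ≗ β′ → (∀ v → reflection β v ~ v) → ∀ v → reflection β′ v ~ v
      transfer {β} {β′} p r v = ~-resp (λ j → cong₂ (λ a b → v j + - a * b)
        (sym (⟪⟫-congʳ v p)) (sym (A-cong p j))) (r v)

      simple : ∀ i v → reflection (e i) v ~ v
      simple i v = ~-resp (λ j → trans (cong (λ a → v j + - a * A (e i) j) (⟪⟫-e v i))
                                       (sym (s-reflection i v j))) (~-s i v)

      grow : ∀ β i → Root β → A β i ≡ -1ℤ → (∀ v → reflection β v ~ v) →
             ∀ v → reflection (β ⊕ e i) v ~ v
      grow β i root A≡-1 r v =
        ~-resp conj (~-trans (~-s i _) (~-trans (r (s i v)) (~-s i v)))
        where
        alg : ∀ a p q x b → a + - (q + p) * (b + x) ≡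
              ((a - p * x) + - (q - p * -1ℤ) * b) - ((p - p * + 2) + - (q - p * -1ℤ) * -1ℤ) * x
        alg = solve-∀
        conj : reflection (β ⊕ e i) v ≗ s i (reflection β (s i v))
        conj j rewrite ⟪⟫-⊕ʳ v β (e i) | ⟪⟫-e v i | A-⊕ β (e i) j | A-e i j
          | ⟪s⟫ i v β | A≡-1 | C-diag i = alg (v j) (v i) ⟪ v , β ⟫ (C j i) (A β j)

    s-⊕A : ∀ i v β → s i (v ⊕ A β) ≗ s i v ⊕ A (β ⊕ (- A β i) · e i)
    s-⊕A i v β j rewrite A-⊕ β ((- A β i) · e i) j | A·e (- A β i) i j =
      alg (v j) (v i) (A β j) (A β i) (C j i)
      where
      alg : ∀ a p b q x → (a + b) - (p + q) * x ≡ (a - p * x) + (b + - q * x)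
      alg = solve-∀

    -- The reflection that takes `β ⊕ e i` back to `β` fixes `γ`, because `i` lies in the support of
    -- the larger root, where `γ` vanishes.
    fire-simple : ∀ (γ : Fin n → ℤ) β → Root β → (∀ j → 0ℤ < β j → γ j ≡ 0ℤ) →
                  ∃[ i ] (0ℤ < β i × γ ⊕ A β ~ γ ⊕ A (e i))
    fire-simple γ = root-induction _ (λ {x} {y} → transfer {x} {y}) simple grow
      where
      P : (Fin n → ℤ) → Set
      P β = (∀ j → 0ℤ < β j → γ j ≡ 0ℤ) → ∃[ i ] (0ℤ < β i × γ ⊕ A β ~ γ ⊕ A (e i))

      transfer : ∀ {β β′} → β ≗ β′ → P β → P β′
      transfer p r supp with r (λ j 0<βj → supp j (subst (0ℤ <_) (p j) 0<βj))
      ... | i , 0<βi , eq = i , subst (0ℤ <_) (p i) 0<βi ,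
                            ~-resp (λ j → cong (_+_ (γ j)) (sym (A-cong p j))) eq

      simple : ∀ i → P (e i)
      simple i supp = i , subst (0ℤ <_) (sym (e-diag i)) (+<+ (s≤s z≤n)) , ~-refl

      grow : ∀ β i → Root β → A β i ≡ -1ℤ → P β → P (β ⊕ e i)
      grow β i (0≤β , _) A≡-1 r supp with r (λ j 0<βj → supp j (ℤ.+-mono-<-≤ 0<βj (e-nonneg i j)))
      ... | k , 0<βk , eq = k , ℤ.+-mono-<-≤ 0<βk (e-nonneg i k) , step i (~-resp descend eq)
        where
        γi≡0 : γ i ≡ 0ℤ
        γi≡0 = supp i (ℤ.+-mono-≤-< (0≤β i) (subst (0ℤ <_) (sym (e-diag i)) (+<+ (s≤s z≤n))))
        alg : ∀ g b x → (g + (b + x)) - (0ℤ + (-1ℤ + + 2)) * x ≡ g + b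
        alg = solve-∀
        descend : s i (γ ⊕ A (β ⊕ e i)) ≗ γ ⊕ A β
        descend j rewrite γi≡0 | A-⊕ β (e i) j | A-⊕ β (e i) i | A≡-1 | A-e i j | A-e i i | C-diag i =
          alg (γ j) (A β j) (C j i)

    -- Both sides reflect to `γ + α_i + α_j`: the left one under `s j`, the right one under `s i`.
    fire-edge : ∀ (γ : Fin n → ℤ) i j → γ i ≡ 0ℤ → γ j ≡ 0ℤ → C i j ≡ -1ℤ →
                γ ⊕ A (e i) ~ γ ⊕ A (e j)
    fire-edge γ i j γi≡0 γj≡0 C≡-1 = step j (~-resp meet (~-s i _))
      where
      alg : ∀ g x y → (g + x) - (0ℤ + -1ℤ) * y ≡ (g + y) - (0ℤ + -1ℤ) * x
      alg = solve-∀
      meet : s j (γ ⊕ A (e i)) ≗ s i (γ ⊕ A (e j))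
      meet l rewrite γi≡0 | γj≡0 | A-e i l | A-e j l | A-e i j | A-e j i | C-sym j i | C≡-1 =
        alg (γ l) (C l i) (C l j)

    -- The weight and the root are reflected together. The exception is the root `α_i` itself, which
    -- would become negative; but then `v` is orthogonal to it and therefore fixed, and the root can
    -- stay.
    fire-transport : ∀ {v w} β → v ~ w → Root β → ⟪ v , β ⟫ ≡ 0ℤ →
                     ∃[ β′ ] (Root β′ × ⟪ w , β′ ⟫ ≡ 0ℤ × v ⊕ A β ~ w ⊕ A β′)
    fire-transport β (done p) root ⊥β =
      β , root , trans (⟪⟫-congˡ β (λ i → sym (p i))) ⊥β , done (λ i → cong (_+ A β i) (p i))
    fire-transport {v} β (step i r) root ⊥β with reflect-root root i
    ... | inj₁ β≗e =
      let (β′ , root′ , ⊥β′ , eq) = fire-transport β r root (trans (⟪⟫-congˡ β fixed) ⊥β)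
      in β′ , root′ , ⊥β′ , ~-resp (λ j → cong (_+ A β j) (sym (fixed j))) eq
      where
      fixed : s i v ≗ v
      fixed = s-fix i (trans (sym (⟪⟫-e v i)) (trans (⟪⟫-congʳ v (λ j → sym (β≗e j))) ⊥β))
    ... | inj₂ root₁ =
      let (β′ , root′ , ⊥β′ , eq) = fire-transport (β ⊕ (- A β i) · e i) r root₁ ⊥β₁
      in β′ , root′ , ⊥β′ , step i (~-resp (s-⊕A i v β) eq)
      where
      alg : ∀ p q → (0ℤ - p * q) + - q * (p - p * + 2) ≡ 0ℤ
      alg = solve-∀
      ⊥β₁ : ⟪ s i v , β ⊕ (- A β i) · e i ⟫ ≡ 0ℤ
      ⊥β₁ rewrite ⟪⟫-⊕ʳ (s i v) β ((- A β i) · e i) | ⟪⟫-·ʳ (s i v) (- A β i) (e i)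
        | ⟪⟫-e (s i v) i | ⟪s⟫ i v β | ⊥β | C-diag i = alg (v i) (A β i)

  -- Cartan matrices of types A, D and E.

  Matrix : ℕ → Set
  Matrix r = Fin r → Fin r → ℤ

  -- The new vertex comes first, so that deleting it is a shift of indices by `suc`. Bourbaki's
  -- numbering of the families A and D grows in the same way, at the end of the long arm.
  attach : ∀ {r} → Matrix r → (Fin r → ℤ) → Matrix (suc r)
  attach M c zero    zero    = + 2
  attach M c zero    (suc j) = c j
  attach M c (suc i) zero    = c i
  attach M c (suc i) (suc j) = M i j

  -- The column of a vertex joined to `k` alone.
  at : ∀ {r} → Fin r → Fin r → ℤ
  at k l = - e k l

  cartanA : ∀ k → Matrix (1 ℕ.+ k)
  cartanA zero    _ _ = + 2
  cartanA (suc k) = attach (cartanA k) (at 0F)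

  -- The innermost matrix of D₄ is two isolated vertices, the ends of the fork; the branch vertex
  -- and then the long arm are put in front.
  cartanD : ∀ k → Matrix (4 ℕ.+ k)
  cartanD zero    = attach (attach (λ i j → + 2 * e i j) (λ _ → -1ℤ)) (at 0F)
  cartanD (suc k) = attach (cartanD k) (at 0F)

  -- The path is 3, 4, 5, ... in Bourbaki's numbering. Vertex 2 is joined to 4 and then vertex 1 to
  -- 3; both neighbours have index 1 at the time of attachment.
  cartanE : ∀ k → Matrix (6 ℕ.+ k)
  cartanE k = attach (attach (cartanA (3 ℕ.+ k)) (at 1F)) (at 1F)

  cartan : ∀ T → Matrix (rank T)
  cartan (A₁₊ k) = cartanA k
  cartan (D₄₊ k) = cartanD k
  cartan E₆      = cartanE 0
  cartan E₇      = cartanE 1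
  cartan E₈      = cartanE 2

  ZeroOrMinusOne : ℤ → Set
  ZeroOrMinusOne z = z ≡ 0ℤ ⊎ z ≡ -1ℤ

  IsCartan : ∀ {r} → Matrix r → Set
  IsCartan M = (∀ i → M i i ≡ + 2) × (∀ i j → i ≢ j → ZeroOrMinusOne (M i j))

  at-values : ∀ {r} (k l : Fin r) → ZeroOrMinusOne (at k l)
  at-values zero    zero    = inj₂ refl
  at-values zero    (suc l) = inj₁ refl
  at-values (suc k) zero    = inj₁ refl
  at-values (suc k) (suc l) = at-values k l

  attach-isCartan : ∀ {r} {M : Matrix r} {c} → IsCartan M → (∀ i → ZeroOrMinusOne (c i)) →
                    IsCartan (attach M c)
  attach-isCartan {M = M} {c} (diag , off) col = diag′ , off′
    where
    diag′ : ∀ i → attach M c i i ≡ + 2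
    diag′ zero    = refl
    diag′ (suc i) = diag i
    off′ : ∀ i j → i ≢ j → ZeroOrMinusOne (attach M c i j)
    off′ zero    zero    i≢j = contradiction refl i≢j
    off′ zero    (suc j) i≢j = col j
    off′ (suc i) zero    i≢j = col i
    off′ (suc i) (suc j) i≢j = off i j (i≢j ∘ cong suc)

  cartanA-isCartan : ∀ k → IsCartan (cartanA k)
  cartanA-isCartan zero    = (λ _ → refl) , λ { zero zero i≢j → contradiction refl i≢j }
  cartanA-isCartan (suc k) = attach-isCartan (cartanA-isCartan k) (at-values 0F)

  cartanD-isCartan : ∀ k → IsCartan (cartanD k)
  cartanD-isCartan zero    = attach-isCartan
    (attach-isCartan
      ( (λ i → cong (+ 2 *_) (e-diag i)) , (λ i j i≢j → inj₁ (cong (+ 2 *_) (e-off i≢j))))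
      (λ _ → inj₂ refl))
    (at-values 0F)
  cartanD-isCartan (suc k) = attach-isCartan (cartanD-isCartan k) (at-values 0F)

  cartanE-isCartan : ∀ k → IsCartan (cartanE k)
  cartanE-isCartan k = attach-isCartan
    (attach-isCartan (cartanA-isCartan (3 ℕ.+ k)) (at-values 1F)) (at-values 1F)

  cartan-isCartan : ∀ T → IsCartan (cartan T)
  cartan-isCartan (A₁₊ k) = cartanA-isCartan k
  cartan-isCartan (D₄₊ k) = cartanD-isCartan k
  cartan-isCartan E₆      = cartanE-isCartan 0
  cartan-isCartan E₇      = cartanE-isCartan 1
  cartan-isCartan E₈      = cartanE-isCartan 2

  ELink? : ∀ a b → Dec (ELink a b)
  ELink? a b = map′ intro elim (Any.any? (λ l → ×.≡-dec ℕ._≟_ ℕ._≟_ (a , b) l) links)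
    where
    links : List (ℕ × ℕ)
    links = (1 , 3) ∷ (3 , 4) ∷ (2 , 4) ∷ (4 , 5) ∷ (5 , 6) ∷ (6 , 7) ∷ (7 , 8) ∷ []
    intro : (a , b) ∈ₗ links → ELink a b
    intro (Any.here refl) = 1—3
    intro (Any.there (Any.here refl)) = 3—4
    intro (Any.there (Any.there (Any.here refl))) = 2—4
    intro (Any.there (Any.there (Any.there (Any.here refl)))) = 4—5
    intro (Any.there (Any.there (Any.there (Any.there (Any.here refl))))) = 5—6
    intro (Any.there (Any.there (Any.there (Any.there (Any.there (Any.here refl)))))) = 6—7
    intro (Any.there (Any.there (Any.there (Any.there (Any.there (Any.there (Any.here refl))))))) = 7—8
    elim : ELink a b → (a , b) ∈ₗ links
    elim 1—3 = Any.here refl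
    elim 3—4 = Any.there (Any.here refl)
    elim 2—4 = Any.there (Any.there (Any.here refl))
    elim 4—5 = Any.there (Any.there (Any.there (Any.here refl)))
    elim 5—6 = Any.there (Any.there (Any.there (Any.there (Any.here refl))))
    elim 6—7 = Any.there (Any.there (Any.there (Any.there (Any.there (Any.here refl)))))
    elim 7—8 = Any.there (Any.there (Any.there (Any.there (Any.there (Any.there (Any.here refl))))))

  DLink? : ∀ r a b → Dec (DLink r a b)
  DLink? r a b = map′ intro elim
    ((suc a ℕ.≟ b ×-dec b ℕ.<? r) ⊎-dec (2 ℕ.+ a ℕ.≟ r ×-dec b ℕ.≟ r))
    where
    intro : (suc a ≡ b × b ℕ.< r) ⊎ (2 ℕ.+ a ≡ r × b ≡ r) → DLink r a b
    intro (inj₁ (refl , b<r)) = arm b<r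
    intro (inj₂ (p , refl))   = fork p
    elim : DLink r a b → (suc a ≡ b × b ℕ.< r) ⊎ (2 ℕ.+ a ≡ r × b ≡ r)
    elim (arm b<r) = inj₁ (refl , b<r)
    elim (fork p)  = inj₂ (p , refl)

  SymClosure? : ∀ {L : ℕ → ℕ → Set} → (∀ a b → Dec (L a b)) → ∀ a b → Dec (SymClosure L a b)
  SymClosure? {L} L? a b = map′ intro elim (L? a b ⊎-dec L? b a)
    where
    intro : L a b ⊎ L b a → SymClosure L a b
    intro (inj₁ l) = fwd l
    intro (inj₂ l) = bwd l
    elim : SymClosure L a b → L a b ⊎ L b a
    elim (fwd l) = inj₁ l
    elim (bwd l) = inj₂ l

  EdgesOf : ∀ {r} → (Fin r → Fin r → Set) → Matrix r → Fin r → Fin r → Set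
  EdgesOf E M i j = (E i j → M i j ≡ -1ℤ) × (M i j ≡ -1ℤ → E i j)

  -- D₄ and the exceptional types are settled by evaluating this decision; the infinite families
  -- recurse through `attach`.
  edgesOf? : ∀ {r} {E : Fin r → Fin r → Set} → (∀ i j → Dec (E i j)) → (M : Matrix r) →
             Dec (∀ i j → EdgesOf E M i j)
  edgesOf? E? M = Fin.all? λ i → Fin.all? λ j →
    (E? i j →-dec (M i j ℤ.≟ -1ℤ)) ×-dec ((M i j ℤ.≟ -1ℤ) →-dec E? i j)

  cartanA-edges : ∀ k i j → EdgesOf (DiagramEdge (A₁₊ k)) (cartanA k) i j
  cartanA-edges zero    0F            0F            = (λ { (fwd ()) ; (bwd ()) }) , λ ()
  cartanA-edges (suc k) 0F            0F            = (λ { (fwd ()) ; (bwd ()) }) , λ ()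
  cartanA-edges (suc k) 0F            1F            = (λ _ → refl) , λ _ → fwd next
  cartanA-edges (suc k) 0F            (suc (suc j)) = (λ { (fwd ()) ; (bwd ()) }) , λ ()
  cartanA-edges (suc k) 1F            0F            = (λ _ → refl) , λ _ → bwd next
  cartanA-edges (suc k) (suc (suc i)) 0F            = (λ { (fwd ()) ; (bwd ()) }) , λ ()
  cartanA-edges (suc k) (suc i)       (suc j)       =
    proj₁ (cartanA-edges k i j) ∘ lower , raise ∘ proj₂ (cartanA-edges k i j)
    where
    lower : ∀ {a b} → SymClosure ALink (suc a) (suc b) → SymClosure ALink a b
    lower (fwd next) = fwd next
    lower (bwd next) = bwd next
    raise : ∀ {a b} → SymClosure ALink a b → SymClosure ALink (suc a) (suc b)
    raise (fwd next) = fwd next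
    raise (bwd next) = bwd next

  cartanD-edges : ∀ k i j → EdgesOf (DiagramEdge (D₄₊ k)) (cartanD k) i j
  cartanD-edges zero = from-yes (edgesOf? (λ i j → SymClosure? (DLink? 4) (number i) (number j)) (cartanD 0))
  cartanD-edges (suc k) 0F 0F = (λ { (fwd ()) ; (bwd ()) }) , λ ()
  cartanD-edges (suc k) 0F 1F = (λ _ → refl) , λ _ → fwd (arm (s≤s (s≤s (s≤s z≤n))))
  cartanD-edges (suc k) 1F 0F = (λ _ → refl) , λ _ → bwd (arm (s≤s (s≤s (s≤s z≤n))))
  cartanD-edges (suc k) 0F (suc (suc j)) = (λ { (fwd l) → contradiction l far ; (bwd ()) }) , λ ()
    where
    far : ∀ {r b} → ¬ DLink (5 ℕ.+ r) 1 (3 ℕ.+ b)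
    far (fork ())
  cartanD-edges (suc k) (suc (suc i)) 0F = (λ { (fwd ()) ; (bwd l) → contradiction l far }) , λ ()
    where
    far : ∀ {r b} → ¬ DLink (5 ℕ.+ r) 1 (3 ℕ.+ b)
    far (fork ())
  cartanD-edges (suc k) (suc i) (suc j) =
    proj₁ (cartanD-edges k i j) ∘ lower , raise ∘ proj₂ (cartanD-edges k i j)
    where
    lowerD : ∀ {r a b} → DLink (suc r) (suc a) (suc b) → DLink r a b
    lowerD (arm (s≤s p)) = arm p
    lowerD (fork p)      = fork (ℕ.suc-injective p)
    raiseD : ∀ {r a b} → DLink r a b → DLink (suc r) (suc a) (suc b)
    raiseD (arm p)  = arm (s≤s p)
    raiseD (fork p) = fork (cong suc p)
    lower : ∀ {r a b} → SymClosure (DLink (suc r)) (suc a) (suc b) → SymClosure (DLink r) a b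
    lower (fwd l) = fwd (lowerD l)
    lower (bwd l) = bwd (lowerD l)
    raise : ∀ {r a b} → SymClosure (DLink r) a b → SymClosure (DLink (suc r)) (suc a) (suc b)
    raise (fwd l) = fwd (raiseD l)
    raise (bwd l) = bwd (raiseD l)

  cartan-edges : ∀ T i j → EdgesOf (DiagramEdge T) (cartan T) i j
  cartan-edges (A₁₊ k) = cartanA-edges k
  cartan-edges (D₄₊ k) = cartanD-edges k
  cartan-edges E₆      = from-yes (edgesOf? (λ i j → SymClosure? ELink? (number i) (number j)) (cartanE 0))
  cartan-edges E₇      = from-yes (edgesOf? (λ i j → SymClosure? ELink? (number i) (number j)) (cartanE 1))
  cartan-edges E₈      = from-yes (edgesOf? (λ i j → SymClosure? ELink? (number i) (number j)) (cartanE 2))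

  -- The coefficients of the highest root of type D, plus one at the vertex 0:
  -- with this correction, removing the vertex 0 of D₅₊ₖ leaves the vector of D₄₊ₖ.
  tailD : ∀ k → Fin (4 ℕ.+ k) → ℤ
  tailD zero            = lookup (+ 2 ∷ + 2 ∷ 1ℤ ∷ 1ℤ ∷ [])
  tailD (suc k) zero    = + 2
  tailD (suc k) (suc i) = tailD k i

  -- The coefficients of the highest root `θ` in the simple roots, in Bourbaki's numbering.
  mark : ∀ T → Fin (rank T) → ℤ
  mark (A₁₊ k) _ = 1ℤ
  mark (D₄₊ k) i = tailD k i - e 0F i
  mark E₆        = lookup (1ℤ ∷ + 2 ∷ + 2 ∷ + 3 ∷ + 2 ∷ 1ℤ ∷ [])
  mark E₇        = lookup (+ 2 ∷ + 2 ∷ + 3 ∷ + 4 ∷ + 3 ∷ + 2 ∷ 1ℤ ∷ [])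
  mark E₈        = lookup (+ 2 ∷ + 3 ∷ + 4 ∷ + 6 ∷ + 5 ∷ + 4 ∷ + 3 ∷ + 2 ∷ [])

  tailD-0 : ∀ k → tailD k 0F ≡ + 2
  tailD-0 zero    = refl
  tailD-0 (suc k) = refl

  1≤tailD : ∀ k i → 1ℤ ≤ tailD k i
  1≤tailD zero            = from-yes (Fin.all? λ i → 1ℤ ℤ.≤? tailD 0 i)
  1≤tailD (suc k) zero    = +≤+ (s≤s z≤n)
  1≤tailD (suc k) (suc i) = 1≤tailD k i

  1≤mark : ∀ T k → 1ℤ ≤ mark T k
  1≤mark (A₁₊ k) i       = ℤ.≤-refl
  1≤mark (D₄₊ k) zero    rewrite tailD-0 k = ℤ.≤-refl
  1≤mark (D₄₊ k) (suc i) rewrite ℤ.+-identityʳ (tailD k (suc i)) = 1≤tailD k (suc i)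
  1≤mark E₆ = from-yes (Fin.all? λ i → 1ℤ ℤ.≤? mark E₆ i)
  1≤mark E₇ = from-yes (Fin.all? λ i → 1ℤ ℤ.≤? mark E₇ i)
  1≤mark E₈ = from-yes (Fin.all? λ i → 1ℤ ℤ.≤? mark E₈ i)

  -- Pairings of the highest root with the simple roots.

  sum-e : ∀ {r} (t : Fin r → ℤ) k → sum (λ i → t i * e k i) ≡ t k
  sum-e t k = trans (sym (⟪⟫-sum t (e k))) (⟪⟫-e t k)

  sum-at : ∀ {r} (t : Fin r → ℤ) k → sum (λ i → t i * at k i) ≡ - t k
  sum-at t k = trans (trans (sum-cong-≗ (λ i → alg (t i) (e k i)))
                            (sym (*-distribˡ-sum -1ℤ (λ i → t i * e k i))))
                     (trans (cong (-1ℤ *_) (sum-e t k)) (ℤ.-1*i≡-i (t k)))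
    where
    alg : ∀ a b → a * - b ≡ -1ℤ * (a * b)
    alg = solve-∀

  rowA : ∀ k i → sum (λ j → 1ℤ * cartanA k i j) ≡ e 0F i + e (fromℕ k) i
  rowA zero    0F      = refl
  rowA (suc k) 0F      = cong (_+_ (+ 2)) (sum-at (λ _ → 1ℤ) (zero {k}))
  rowA (suc k) (suc i) = trans (cong (_+_ (1ℤ * - e 0F i)) (rowA k i)) (alg (e 0F i) (e (fromℕ k) i))
    where
    alg : ∀ a b → 1ℤ * - a + (a + b) ≡ 0ℤ + b
    alg = solve-∀

  -- `tailD` is twice the first fundamental weight written in simple roots. Subtracting `α_1` gives
  -- the second fundamental weight, which is the highest root; hence the single affine neighbour 2.
  row-tailD : ∀ k i → sum (λ j → tailD k j * cartanD k i j) ≡ + 2 * e 0F i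
  row-tailD zero = from-yes (Fin.all? λ i → sum (λ j → tailD 0 j * cartanD 0 i j) ℤ.≟ + 2 * e 0F i)
  row-tailD (suc k) zero    = trans (cong (_+_ (+ 4)) (sum-at (tailD k) 0F)) (cong (λ a → + 4 - a) (tailD-0 k))
  row-tailD (suc k) (suc i) = trans (cong (_+_ (+ 2 * - e 0F i)) (row-tailD k i)) (alg (e 0F i))
    where
    alg : ∀ a → + 2 * - a + + 2 * a ≡ 0ℤ
    alg = solve-∀

  column₀D : ∀ k i → + 2 * e 0F i - cartanD k i 0F ≡ e 1F i
  column₀D zero = from-yes (Fin.all? λ i → + 2 * e 0F i - cartanD 0 i 0F ℤ.≟ e 1F i)
  column₀D (suc k) zero    = refl
  column₀D (suc k) (suc i) = alg (e 0F i)
    where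
    alg : ∀ a → 0ℤ - - a ≡ a
    alg = solve-∀

  rowD : ∀ k i → sum (λ j → mark (D₄₊ k) j * cartanD k i j) ≡ e 1F i
  rowD k i = begin
    sum (λ j → (tailD k j - e 0F j) * M j)
      ≡⟨ sum-cong-≗ (λ j → alg (tailD k j) (e 0F j) (M j)) ⟩
    sum (λ j → tailD k j * M j + M j * at 0F j)
      ≡⟨ ∑-distrib-+ (λ j → tailD k j * M j) (λ j → M j * at 0F j) ⟩
    sum (λ j → tailD k j * M j) + sum (λ j → M j * at 0F j)
      ≡⟨ cong₂ _+_ (row-tailD k i) (sum-at M 0F) ⟩
    + 2 * e 0F i - M 0F
      ≡⟨ column₀D k i ⟩
    e 1F i ∎
    where
    open ≡-Reasoning
    M = cartanD k i
    alg : ∀ a b c → (a - b) * c ≡ a * c + c * - b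
    alg = solve-∀

  occurrences : ∀ {r} → Fin r → List ℕ → ℤ
  occurrences i xs = + length (filter (number i ℕ.≟_) xs)

  occurrences-∷ : ∀ {r} (i j : Fin r) xs → occurrences i (number j ∷ xs) ≡ e j i + occurrences i xs
  occurrences-∷ i j xs with i Fin.≟ j
  ... | yes refl rewrite List.filter-accept (number i ℕ.≟_) {xs = xs} (refl {x = number i}) | e-diag i = refl
  ... | no i≢j
    rewrite List.filter-reject (number i ℕ.≟_) {xs = xs} (i≢j ∘ Fin.toℕ-injective ∘ ℕ.suc-injective)
          | e-off (i≢j ∘ sym) = sym (ℤ.+-identityˡ _)

  multiplicityA : ∀ k i → + affineMultiplicity (A₁₊ k) i ≡ e 0F i + e (fromℕ k) i
  multiplicityA k i = begin
    occurrences i (1 ∷ suc k ∷ [])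
      ≡⟨ cong (λ m → occurrences i (1 ∷ suc m ∷ [])) (sym (Fin.toℕ-fromℕ k)) ⟩
    occurrences i (number (zero {k}) ∷ number (fromℕ k) ∷ [])
      ≡⟨ occurrences-∷ i 0F _ ⟩
    e 0F i + occurrences i (number (fromℕ k) ∷ [])
      ≡⟨ cong (_+_ (e 0F i)) (trans (occurrences-∷ i (fromℕ k) []) (ℤ.+-identityʳ _)) ⟩
    e 0F i + e (fromℕ k) i ∎
    where open ≡-Reasoning

  multiplicityD : ∀ k i → + affineMultiplicity (D₄₊ k) i ≡ e 1F i
  multiplicityD k i = trans (occurrences-∷ i 1F []) (ℤ.+-identityʳ _)

  highest-root-pairing : ∀ T i → sum (λ j → mark T j * cartan T i j) ≡ + affineMultiplicity T i
  highest-root-pairing (A₁₊ k) i = trans (rowA k i) (sym (multiplicityA k i))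
  highest-root-pairing (D₄₊ k) i = trans (rowD k i) (sym (multiplicityD k i))
  highest-root-pairing E₆ = from-yes (Fin.all? λ i →
    sum (λ j → mark E₆ j * cartan E₆ i j) ℤ.≟ + affineMultiplicity E₆ i)
  highest-root-pairing E₇ = from-yes (Fin.all? λ i →
    sum (λ j → mark E₇ j * cartan E₇ i j) ℤ.≟ + affineMultiplicity E₇ i)
  highest-root-pairing E₈ = from-yes (Fin.all? λ i →
    sum (λ j → mark E₈ j * cartan E₈ i j) ℤ.≟ + affineMultiplicity E₈ i)

  -- By `highest-root-pairing` the sum is the norm of `θ`. It adds up the marks of the affine
  -- neighbours: 1 + 1 for type A and a single mark 2 for the others.
  highest-root-norm : ∀ T → sum (λ i → mark T i * + affineMultiplicity T i) ≡ + 2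
  highest-root-norm (A₁₊ k) = begin
    sum (λ i → 1ℤ * + affineMultiplicity (A₁₊ k) i)
      ≡⟨ sum-cong-≗ (λ i → trans (cong (1ℤ *_) (multiplicityA k i)) (alg (e (zero {k}) i) (e (fromℕ k) i))) ⟩
    sum (λ i → 1ℤ * e (zero {k}) i + 1ℤ * e (fromℕ k) i)
      ≡⟨ ∑-distrib-+ {suc k} (λ i → 1ℤ * e (zero {k}) i) (λ i → 1ℤ * e (fromℕ k) i) ⟩
    sum (λ i → 1ℤ * e (zero {k}) i) + sum (λ i → 1ℤ * e (fromℕ k) i)
      ≡⟨ cong₂ _+_ (sum-e (λ _ → 1ℤ) (zero {k})) (sum-e (λ _ → 1ℤ) (fromℕ k)) ⟩
    + 2 ∎
    where
    open ≡-Reasoning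
    alg : ∀ a b → 1ℤ * (a + b) ≡ 1ℤ * a + 1ℤ * b
    alg = solve-∀
  highest-root-norm (D₄₊ k) =
    trans (sum-cong-≗ (λ i → cong (mark (D₄₊ k) i *_) (multiplicityD k i)))
          (trans (sum-e (mark (D₄₊ k)) 1F) (value k))
    where
    value : ∀ k → mark (D₄₊ k) 1F ≡ + 2
    value zero    = refl
    value (suc k) rewrite tailD-0 k = refl
  highest-root-norm E₆ = refl
  highest-root-norm E₇ = refl
  highest-root-norm E₈ = refl

  -- Reversal of the diagram of type A.

  cartanA-inject₁ : ∀ k i j → cartanA (suc k) (inject₁ i) (inject₁ j) ≡ cartanA k i j
  cartanA-inject₁ zero    0F      0F            = refl
  cartanA-inject₁ (suc k) 0F      0F            = refl
  cartanA-inject₁ (suc k) 0F      1F            = refl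
  cartanA-inject₁ (suc k) 0F      (suc (suc j)) = refl
  cartanA-inject₁ (suc k) 1F            0F      = refl
  cartanA-inject₁ (suc k) (suc (suc i)) 0F      = refl
  cartanA-inject₁ (suc k) (suc i) (suc j)       = cartanA-inject₁ k i j

  cartanA-last : ∀ k j → cartanA (suc k) (fromℕ (suc k)) (inject₁ j) ≡ at (fromℕ k) j
                       × cartanA (suc k) (inject₁ j) (fromℕ (suc k)) ≡ at (fromℕ k) j
  cartanA-last zero    0F      = refl , refl
  cartanA-last (suc k) 0F      = refl , refl
  cartanA-last (suc k) (suc j) = cartanA-last k j

  at-opposite : ∀ k j → at (fromℕ k) (opposite j) ≡ at 0F j
  at-opposite k       0F      = cong -_ (e-diag (fromℕ k))
  at-opposite (suc k) (suc j) = off k (opposite j)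
    where
    off : ∀ k (j : Fin (suc k)) → at (fromℕ (suc k)) (inject₁ j) ≡ 0ℤ
    off k       0F      = refl
    off (suc k) (suc j) = off k j

  -- Reversing a path turns growth at its last vertex into growth at its first, the only kind built
  -- into `cartanA`.
  cartanA-opposite : ∀ k i j → cartanA k (opposite i) (opposite j) ≡ cartanA k i j
  cartanA-opposite zero    i       j       = refl
  cartanA-opposite (suc k) 0F      0F      = proj₁ (cartanA-isCartan (suc k)) (fromℕ (suc k))
  cartanA-opposite (suc k) 0F      (suc j) = trans (proj₁ (cartanA-last k (opposite j))) (at-opposite k j)
  cartanA-opposite (suc k) (suc i) 0F      = trans (proj₂ (cartanA-last k (opposite i))) (at-opposite k i)
  cartanA-opposite (suc k) (suc i) (suc j) =
    trans (cartanA-inject₁ k (opposite i) (opposite j)) (cartanA-opposite k i j)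

  -- Classification of connected diagrams by adding vertices.

  data Branched : DiagramType → Set where
    typeD  : ∀ {k} → Branched (D₄₊ k)
    typeE₆ : Branched E₆
    typeE₇ : Branched E₇
    typeE₈ : Branched E₈

  Relabels : ∀ {r s} → Matrix r → Vec (Fin r) s → Matrix s → Set
  Relabels M σ N = ∀ a b → M (lookup σ a) (lookup σ b) ≡ N a b

  relabels? : ∀ {r s} (M : Matrix r) (σ : Vec (Fin r) s) (N : Matrix s) → Dec (Relabels M σ N)
  relabels? M σ N = Fin.all? λ a → Fin.all? λ b → M (lookup σ a) (lookup σ b) ℤ.≟ N a b

  form : ∀ {r} → Matrix r → (Fin r → ℤ) → ℤ
  form M t = sum (λ a → t a * sum (λ b → t b * M a b))

  nonneg? : ∀ {r} (t : Fin r → ℤ) → Dec (∀ a → 0ℤ ≤ t a)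
  nonneg? t = Fin.all? λ a → 0ℤ ℤ.≤? t a

  module Classification {n : ℕ} (C : Fin n → Fin n → ℤ)
    (C-diag : ∀ i → C i i ≡ + 2)
    (C-sym  : ∀ i j → C i j ≡ C j i)
    (C-off  : ∀ {i j} → i ≢ j → C i j ≡ 0ℤ ⊎ C i j ≡ -1ℤ)
    (Q-pos  : ∀ x i → x i ≢ 0ℤ → 0ℤ < SymmetricForm.Q C C-diag C-sym x)
    where

    open PositiveDefinite C C-diag C-sym C-off Q-pos public

    Realizes : ∀ {r} → Matrix r → (Fin r → Fin n) → Set
    Realizes M f = ∀ a b → C (f a) (f b) ≡ M a b

    realizes-attach : ∀ {r} {M : Matrix r} {f c u} → Realizes M f → (∀ a → C u (f a) ≡ c a) →
                      Realizes (attach M c) (u Vector.∷ f)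
    realizes-attach {u = u} real col zero    zero    = C-diag u
    realizes-attach real col zero    (suc b) = col b
    realizes-attach {f = f} {u = u} real col (suc a) zero    = trans (C-sym (f a) u) (col a)
    realizes-attach real col (suc a) (suc b) = real a b

    -- Two vertices with the same image would force the entry 2 off the diagonal of `M`.
    realizes-injective : ∀ {r} {M : Matrix r} {f} → IsCartan M → Realizes M f →
                         ∀ {a b} → f a ≡ f b → a ≡ b
    realizes-injective {f = f} (diag , off) real {a} {b} fa≡fb with a Fin.≟ b
    ... | yes a≡b = a≡b
    ... | no  a≢b = contradiction (off a b a≢b)
      (λ { (inj₁ p) → contradiction (trans (sym two) p) λ ()
         ; (inj₂ p) → contradiction (trans (sym two) p) λ () })
      where
      two = trans (sym (real a b)) (trans (cong (C (f a)) (sym fa≡fb)) (C-diag (f a)))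

    A-comb : ∀ {r} (f : Fin r → Fin n) t j → A (comb f t) j ≡ sum (λ a → t a * C j (f a))
    A-comb f t j = ⟪⟫-comb (C j) f t

    Q-comb : ∀ {r} {M : Matrix r} {f} → Realizes M f → ∀ t → Q (comb f t) ≡ form M t
    Q-comb {f = f} real t = trans (⟪⟫-comb (A (comb f t)) f t)
      (sum-cong-≗ (λ a → cong (t a *_) (trans (A-comb f t (f a))
        (sum-cong-≗ (λ b → cong (t b *_) (real a b))))))

    comb-nonneg : ∀ {r} (f : Fin r → Fin n) {t} → (∀ a → 0ℤ ≤ t a) → ∀ i → 0ℤ ≤ comb f t i
    comb-nonneg f {t} 0≤t i = sum-nonneg (λ a → *-nonneg (t a) (e (f a) i) (0≤t a) (e-nonneg (f a) i))

    coefficient≤comb : ∀ {r} (f : Fin r → Fin n) {t} → (∀ a → 0ℤ ≤ t a) → ∀ a → t a ≤ comb f t (f a)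
    coefficient≤comb f {t} 0≤t a =
      subst (_≤ comb f t (f a)) (trans (cong (t a *_) (e-diag (f a))) (ℤ.*-identityʳ (t a)))
        (term≤sum (λ b → *-nonneg (t b) (e (f b) (f a)) (0≤t b) (e-nonneg (f b) (f a))) a)

    comb-outside : ∀ {r} (f : Fin r → Fin n) t {u} → (∀ a → f a ≢ u) → comb f t u ≡ 0ℤ
    comb-outside f t u∉f = sum-0 (λ a → trans (cong (t a *_) (e-off (u∉f a))) (ℤ.*-zeroʳ (t a)))

    -- Nonnegative coefficients cannot cancel when pushed forward along `f`, so the vector stays
    -- nonzero and its norm is positive. Affine diagrams are excluded in this way.
    form-positive : ∀ {r} {M : Matrix r} {f} → Realizes M f → ∀ t → (∀ a → 0ℤ ≤ t a) →
                    ∀ a → 0ℤ < t a → ¬ form M t ≤ 0ℤ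
    form-positive {f = f} real t 0≤t a 0<ta form≤0 = contradiction
      (subst (_≤ 0ℤ) (sym (Q-comb real t)) form≤0)
      (ℤ.<⇒≱ (Q-pos (comb f t) (f a)
        (λ ≡0 → ℤ.<⇒≢ (ℤ.<-≤-trans 0<ta (coefficient≤comb f 0≤t a)) (sym ≡0))))

    highestRoot : ∀ T → (Fin (rank T) → Fin n) → Fin n → ℤ
    highestRoot T f = comb f (mark T)

    0≤mark : ∀ T a → 0ℤ ≤ mark T a
    0≤mark T a = ℤ.≤-trans (+≤+ z≤n) (1≤mark T a)

    highestRoot-pairing : ∀ T {f} → Realizes (cartan T) f →
                          ∀ a → A (highestRoot T f) (f a) ≡ + affineMultiplicity T a
    highestRoot-pairing T {f} real a = trans (A-comb f (mark T) (f a))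
      (trans (sum-cong-≗ (λ b → cong (mark T b *_) (real a b))) (highest-root-pairing T a))

    highestRoot-root : ∀ T {f} → Realizes (cartan T) f → Root (highestRoot T f)
    highestRoot-root T {f} real = comb-nonneg f (0≤mark T) ,
      trans (⟪⟫-comb (A (highestRoot T f)) f (mark T))
        (trans (sum-cong-≗ (λ a → cong (mark T a *_) (highestRoot-pairing T real a)))
               (highest-root-norm T))

    -- For a vertex u outside the diagram, θ + α_u is a nonzero lattice vector
    -- of norm 4 + 2 ⟨θ , α_u⟩.
    -1≤A-highestRoot : ∀ T {f} → Realizes (cartan T) f → ∀ {u} → (∀ a → f a ≢ u) →
                       -1ℤ ≤ A (highestRoot T f) u
    -1≤A-highestRoot T {f} real {u} u∉f with -1ℤ ℤ.≤? A (highestRoot T f) u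
    ... | yes p = p
    ... | no ¬p = contradiction
      (subst (_≤ 0ℤ) (sym (trans (Q-⊕e θ u) (trans (cong (λ q → q + + 2 * A θ u + + 2)
          (proj₂ (highestRoot-root T real))) (alg (A θ u)))))
        (nonneg*nonpos (+ 2) (A θ u + + 2) (+≤+ z≤n)
          (ℤ.+-monoˡ-≤ (+ 2) (ℤ.i<j⇒i≤pred[j] (ℤ.≰⇒> ¬p)))))
      (ℤ.<⇒≱ (Q-pos (θ ⊕ e u) u
        (λ ≡0 → contradiction (trans (sym (cong₂ _+_ (comb-outside f (mark T) u∉f) (e-diag u))) ≡0) λ ())))
      where
      θ = highestRoot T f
      alg : ∀ a → + 2 + + 2 * a + + 2 ≡ + 2 * (a + + 2)
      alg = solve-∀

    module _ T {f : Fin (rank T) → Fin n} (real : Realizes (cartan T) f) {u} (u∉f : ∀ a → f a ≢ u)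
             {a₀} (joined : C u (f a₀) ≡ -1ℤ) where

      private
        term : Fin (rank T) → ℤ
        term a = mark T a * C u (f a)

        term≤0 : ∀ a → term a ≤ 0ℤ
        term≤0 a = nonneg*nonpos (mark T a) (C u (f a)) (0≤mark T a) (C≤0 (u∉f a ∘ sym))

        -1≤sum : -1ℤ ≤ sum term
        -1≤sum = subst (-1ℤ ≤_) (A-comb f (mark T) u) (-1≤A-highestRoot T real u∉f)

        term≤-1 : ∀ {a} → C u (f a) ≡ -1ℤ → term a ≤ -1ℤ
        term≤-1 {a} p = subst (_≤ -1ℤ)
          (trans (trans (sym (ℤ.-1*i≡-i (mark T a))) (ℤ.*-comm -1ℤ (mark T a))) (cong (mark T a *_) (sym p)))
          (ℤ.neg-mono-≤ (1≤mark T a))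

      -- All marks are at least 1, so a second neighbour would push the pairing of `u` with the
      -- highest root down to -2.
      joined-column : ∀ a → C u (f a) ≡ at a₀ a
      joined-column a with a₀ Fin.≟ a
      ... | yes refl = trans joined (cong -_ (sym (e-diag a)))
      ... | no a₀≢a with C-off (u∉f a ∘ sym)
      ...   | inj₁ p = trans p (cong -_ (sym (e-off a₀≢a)))
      ...   | inj₂ p = contradiction
              (ℤ.≤-trans -1≤sum (ℤ.≤-trans (sum≤term+term term≤0 a₀ a a₀≢a)
                (ℤ.+-mono-≤ (term≤-1 joined) (term≤-1 p))))
              λ { (-≤- ()) }

      joined-mark : mark T a₀ ≡ 1ℤ
      joined-mark = ℤ.≤-antisym
        (ℤ.neg-cancel-≤ (subst (-1ℤ ≤_) (trans (cong (mark T a₀ *_) joined)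
            (trans (ℤ.*-comm (mark T a₀) -1ℤ) (ℤ.-1*i≡-i (mark T a₀))))
          (ℤ.≤-trans -1≤sum (sum≤term term≤0 a₀))))
        (1≤mark T a₀)

    -- Here `Z` stands for being a zero of `γ` and `P` for being reachable from a fixed zero. Only
    -- `Z` comes with a decision; reachability is propagated to each added vertex by `P-step`.
    module Growth {z p : Level} {Z : Fin n → Set z} (Z? : ∀ u → Dec (Z u)) (P : Fin n → Set p)
      (P-step : ∀ {u v} → P v → Z u → C u v ≡ -1ℤ → P u) where

      Diagram : DiagramType → Set p
      Diagram T = ∃[ f ] (Realizes (cartan T) f × ∀ a → P (f a))

      relabel : ∀ {r} T {M : Matrix r} {f} → Realizes M f → (∀ a → P (f a)) →
                (σ : Vec (Fin r) (rank T)) → Relabels M σ (cartan T) → Diagram T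
      relabel T {f = f} real all-P σ rel =
        f ∘ lookup σ , (λ a b → trans (real (lookup σ a) (lookup σ b)) (rel a b)) , λ a → all-P (lookup σ a)

      all-∷ : ∀ {r} {f : Fin r → Fin n} {u} → P u → (∀ a → P (f a)) → ∀ a → P ((u Vector.∷ f) a)
      all-∷ Pu Pf zero    = Pu
      all-∷ Pu Pf (suc a) = Pf a

      -- D₈ with a vertex joined to the end of a short arm is affine E₈, whose
      -- Cartan matrix is degenerate.
      no-long-fork : ∀ j {f : Fin (8 ℕ.+ j) → Fin n} {u a₀} → Realizes (cartanD (4 ℕ.+ j)) f →
                     (∀ a → C u (f a) ≡ at (suc a₀) a) → ¬ mark (D₄₊ (4 ℕ.+ j)) (suc a₀) ≡ 1ℤ
      no-long-fork zero {a₀ = 0F} real col ()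
      no-long-fork zero {a₀ = 1F} real col ()
      no-long-fork zero {a₀ = 2F} real col ()
      no-long-fork zero {a₀ = 3F} real col ()
      no-long-fork zero {a₀ = 4F} real col ()
      no-long-fork zero {a₀ = 5F} real col _ =
        form-positive (realizes-attach {c = at 6F} real col) t (from-yes (nonneg? t)) 0F (+<+ (s≤s z≤n))
          (from-yes (form (attach (cartanD 4) (at 6F)) t ℤ.≤? 0ℤ))
        where
        -- The marks of affine E₈: 2 at the new vertex, 1 to 6 along the long arm up to the branch
        -- vertex, then 4 and 3 at the fork.
        t = lookup (+ 2 ∷ + 1 ∷ + 2 ∷ + 3 ∷ + 4 ∷ + 5 ∷ + 6 ∷ + 4 ∷ + 3 ∷ [])
      no-long-fork zero {a₀ = 6F} real col _ =
        form-positive (realizes-attach {c = at 7F} real col) t (from-yes (nonneg? t)) 0F (+<+ (s≤s z≤n))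
          (from-yes (form (attach (cartanD 4) (at 7F)) t ℤ.≤? 0ℤ))
        where
        t = lookup (+ 2 ∷ + 1 ∷ + 2 ∷ + 3 ∷ + 4 ∷ + 5 ∷ + 6 ∷ + 3 ∷ + 4 ∷ [])
      no-long-fork (suc j) {a₀ = 0F}     real col ()
      -- Without the front of its long arm the diagram is again of type D, and the two mark vectors
      -- agree at the attachment vertex.
      no-long-fork (suc j) {a₀ = suc a₀} real col m =
        no-long-fork j (λ a b → real (suc a) (suc b)) (col ∘ suc) m

      Extension : DiagramType → Set p
      Extension T = ∃[ T′ ] (Branched T′ × rank T′ ≡ suc (rank T) × Diagram T′)

      -- The entries of `σ` follow Bourbaki's numbering of `T′`: an entry 0F is the new vertex, the
      -- others are old vertices shifted by one. Correctness of `σ` is found by evaluation.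
      relabelled : ∀ T a₀ T′ {f u} → Branched T′ → (p : rank T′ ≡ suc (rank T)) →
                   Realizes (cartan T) f → (∀ a → P (f a)) → P u → (∀ a → C u (f a) ≡ at a₀ a) →
                   (σ : Vec (Fin (suc (rank T))) (rank T′)) →
                   {True (relabels? (attach (cartan T) (at a₀)) σ (cartan T′))} → Extension T
      relabelled T a₀ T′ b p real Pf Pu col σ {rel} =
        T′ , b , p , relabel T′ (realizes-attach real col) (all-∷ Pu Pf) σ (toWitness rel)

      -- Marks equal to 1 occur only at the three leaves for type D, at two leaves for E₆, at one
      -- for E₇ and nowhere for E₈. The long arm of type D just grows; lengthening a short arm turns
      -- D₄, D₅, D₆, D₇ into D₅, E₆, E₇, E₈ and is impossible from D₈ on.
      extend : ∀ {T f u} → Branched T → ∀ a₀ → Realizes (cartan T) f → (∀ a → P (f a)) → P u →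
               (∀ a → C u (f a) ≡ at a₀ a) → mark T a₀ ≡ 1ℤ → Extension T
      extend {D₄₊ k} {f} {u} typeD 0F real Pf Pu col _ =
        D₄₊ (suc k) , typeD , refl , u Vector.∷ f , realizes-attach real col , all-∷ Pu Pf
      extend {D₄₊ 0} typeD 2F real Pf Pu col _ =
        relabelled (D₄₊ 0) 2F (D₄₊ 1) typeD refl real Pf Pu col (0F ∷ 3F ∷ 2F ∷ 1F ∷ 4F ∷ [])
      extend {D₄₊ 0} typeD 3F real Pf Pu col _ =
        relabelled (D₄₊ 0) 3F (D₄₊ 1) typeD refl real Pf Pu col (0F ∷ 4F ∷ 2F ∷ 1F ∷ 3F ∷ [])
      extend {D₄₊ 1} typeD 3F real Pf Pu col _ =
        relabelled (D₄₊ 1) 3F E₆ typeE₆ refl real Pf Pu col (0F ∷ 5F ∷ 4F ∷ 3F ∷ 2F ∷ 1F ∷ [])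
      extend {D₄₊ 1} typeD 4F real Pf Pu col _ =
        relabelled (D₄₊ 1) 4F E₆ typeE₆ refl real Pf Pu col (0F ∷ 4F ∷ 5F ∷ 3F ∷ 2F ∷ 1F ∷ [])
      extend {D₄₊ 2} typeD 4F real Pf Pu col _ =
        relabelled (D₄₊ 2) 4F E₇ typeE₇ refl real Pf Pu col (0F ∷ 6F ∷ 5F ∷ 4F ∷ 3F ∷ 2F ∷ 1F ∷ [])
      extend {D₄₊ 2} typeD 5F real Pf Pu col _ =
        relabelled (D₄₊ 2) 5F E₇ typeE₇ refl real Pf Pu col (0F ∷ 5F ∷ 6F ∷ 4F ∷ 3F ∷ 2F ∷ 1F ∷ [])
      extend {D₄₊ 3} typeD 5F real Pf Pu col _ =
        relabelled (D₄₊ 3) 5F E₈ typeE₈ refl real Pf Pu col (0F ∷ 7F ∷ 6F ∷ 5F ∷ 4F ∷ 3F ∷ 2F ∷ 1F ∷ [])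
      extend {D₄₊ 3} typeD 6F real Pf Pu col _ =
        relabelled (D₄₊ 3) 6F E₈ typeE₈ refl real Pf Pu col (0F ∷ 6F ∷ 7F ∷ 5F ∷ 4F ∷ 3F ∷ 2F ∷ 1F ∷ [])
      extend {D₄₊ (suc (suc (suc (suc j))))} typeD (suc a₀) real Pf Pu col m =
        contradiction m (no-long-fork j real col)
      extend typeE₆ 0F real Pf Pu col _ =
        relabelled E₆ 0F E₇ typeE₇ refl real Pf Pu col (6F ∷ 2F ∷ 5F ∷ 4F ∷ 3F ∷ 1F ∷ 0F ∷ [])
      extend typeE₆ 5F real Pf Pu col _ =
        relabelled E₆ 5F E₇ typeE₇ refl real Pf Pu col (1F ∷ 2F ∷ 3F ∷ 4F ∷ 5F ∷ 6F ∷ 0F ∷ [])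
      extend typeE₇ 6F real Pf Pu col _ =
        relabelled E₇ 6F E₈ typeE₈ refl real Pf Pu col (1F ∷ 2F ∷ 3F ∷ 4F ∷ 5F ∷ 6F ∷ 7F ∷ 0F ∷ [])
      extend {D₄₊ 0} typeD 1F real Pf Pu col ()
      extend {D₄₊ 1} typeD 1F real Pf Pu col ()
      extend {D₄₊ 1} typeD 2F real Pf Pu col ()
      extend {D₄₊ 2} typeD 1F real Pf Pu col ()
      extend {D₄₊ 2} typeD 2F real Pf Pu col ()
      extend {D₄₊ 2} typeD 3F real Pf Pu col ()
      extend {D₄₊ 3} typeD 1F real Pf Pu col ()
      extend {D₄₊ 3} typeD 2F real Pf Pu col ()
      extend {D₄₊ 3} typeD 3F real Pf Pu col ()
      extend {D₄₊ 3} typeD 4F real Pf Pu col ()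
      extend typeE₆ 1F real Pf Pu col ()
      extend typeE₆ 2F real Pf Pu col ()
      extend typeE₆ 3F real Pf Pu col ()
      extend typeE₆ 4F real Pf Pu col ()
      extend typeE₇ 0F real Pf Pu col ()
      extend typeE₇ 1F real Pf Pu col ()
      extend typeE₇ 2F real Pf Pu col ()
      extend typeE₇ 3F real Pf Pu col ()
      extend typeE₇ 4F real Pf Pu col ()
      extend typeE₇ 5F real Pf Pu col ()
      extend typeE₈ 0F real Pf Pu col ()
      extend typeE₈ 1F real Pf Pu col ()
      extend typeE₈ 2F real Pf Pu col ()
      extend typeE₈ 3F real Pf Pu col ()
      extend typeE₈ 4F real Pf Pu col ()
      extend typeE₈ 5F real Pf Pu col ()
      extend typeE₈ 6F real Pf Pu col ()
      extend typeE₈ 7F real Pf Pu col ()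

      -- Of the path only the attachment vertex and its two neighbours are kept; with the new vertex
      -- they form D₄. The discarded vertices are found again by `complete-branched`, so no diagram
      -- with three arms of arbitrary length has to be treated.
      D₄-inside : ∀ k {f : Fin (1 ℕ.+ k) → Fin n} {u a₀} → Realizes (cartanA k) f → (∀ a → P (f a)) → P u →
                  (∀ a → C u (f a) ≡ at a₀ a) → a₀ ≢ 0F → a₀ ≢ fromℕ k → Diagram (D₄₊ 0)
      D₄-inside k             {a₀ = 0F} real Pf Pu col ≢0 _ = contradiction refl ≢0
      D₄-inside (suc zero)    {a₀ = 1F} real Pf Pu col _ ≢last = contradiction refl ≢last
      D₄-inside (suc (suc k)) {f} {u} {1F} real Pf Pu col _ _ =
        relabel (D₄₊ 0) (realizes-attach {c = at 1F} real₃ col₃) (all-∷ Pu (Pf ∘ first)) (1F ∷ 2F ∷ 3F ∷ 0F ∷ [])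
          (from-yes (relabels? (attach (cartanA 2) (at 1F)) (1F ∷ 2F ∷ 3F ∷ 0F ∷ []) (cartanD 0)))
        where
        first : Fin 3 → Fin (3 ℕ.+ k)
        first = lookup (0F ∷ 1F ∷ 2F ∷ [])
        real₃ : Realizes (cartanA 2) (f ∘ first)
        real₃ 0F 0F = C-diag _
        real₃ 0F 1F = real 0F 1F
        real₃ 0F 2F = real 0F 2F
        real₃ 1F 0F = real 1F 0F
        real₃ 1F 1F = C-diag _
        real₃ 1F 2F = real 1F 2F
        real₃ 2F 0F = real 2F 0F
        real₃ 2F 1F = real 2F 1F
        real₃ 2F 2F = C-diag _
        col₃ : ∀ a → C u (f (first a)) ≡ at 1F a
        col₃ 0F = col 0F
        col₃ 1F = col 1F
        col₃ 2F = col 2F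
      D₄-inside (suc k) {f} {u} {suc (suc a₀)} real Pf Pu col _ ≢last =
        D₄-inside k (λ a b → real (suc a) (suc b)) (Pf ∘ suc) Pu (col ∘ suc) (λ ()) (≢last ∘ cong suc)

      Frontier : ∀ {r} → (Fin r → Fin n) → Set z
      Frontier f = ∃[ u ] (Z u × (∀ a → f a ≢ u) × ∃[ a ] C u (f a) ≡ -1ℤ)

      frontier? : ∀ {r} (f : Fin r → Fin n) → Dec (Frontier f)
      frontier? f = Fin.any? λ u → Z? u ×-dec Fin.all? (λ a → ¬? (f a Fin.≟ u))
                                        ×-dec Fin.any? (λ a → C u (f a) ℤ.≟ -1ℤ)

      Complete : Set (z ⊔ p)
      Complete = ∃[ T ] ∃[ f ] (Realizes (cartan T) f × (∀ a → P (f a)) × ¬ Frontier f)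

      rank≤n : ∀ T {f} → Realizes (cartan T) f → rank T ℕ.≤ n
      rank≤n T real = Fin.injective⇒≤ (realizes-injective (cartan-isCartan T) real)

      -- The number `m` is fuel: an embedded diagram has at most `n` vertices, and each round adds
      -- one.
      complete-branched : ∀ m {T} → Branched T → Diagram T → n ℕ.< rank T ℕ.+ m → Complete
      complete-branched zero {T} b (f , real , _) n<r = contradiction (rank≤n T real)
        (ℕ.<⇒≱ (subst (n ℕ.<_) (ℕ.+-identityʳ (rank T)) n<r))
      complete-branched (suc m) {T} b (f , real , Pf) n<r with frontier? f
      ... | no closed = T , f , real , Pf , closed
      ... | yes (u , Zu , u∉f , a₀ , joined)
        with extend b a₀ real Pf (P-step (Pf a₀) Zu joined) (joined-column T real u∉f joined) (joined-mark T real u∉f joined)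
      ... | T′ , b′ , rank≡ , d = complete-branched m b′ d
              (subst (n ℕ.<_) (trans (ℕ.+-suc (rank T) m) (cong (ℕ._+ m) (sym rank≡))) n<r)

      complete-path : ∀ m k → Diagram (A₁₊ k) → n ℕ.< suc k ℕ.+ m → Complete
      complete-path zero k (f , real , _) n<r = contradiction (rank≤n (A₁₊ k) real)
        (ℕ.<⇒≱ (subst (n ℕ.<_) (ℕ.+-identityʳ (suc k)) n<r))
      complete-path (suc m) k (f , real , Pf) n<r with frontier? f
      ... | no closed = A₁₊ k , f , real , Pf , closed
      ... | yes (u , Zu , u∉f , a₀ , joined) = cases
        where
        n<r′ : n ℕ.< suc (suc k) ℕ.+ m
        n<r′ = subst (n ℕ.<_) (ℕ.+-suc (suc k) m) n<r
        Pu : P u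
        Pu = P-step (Pf a₀) Zu joined
        prepend : ∀ {f} → Realizes (cartanA k) f → (∀ a → P (f a)) → (∀ a → f a ≢ u) →
                  C u (f 0F) ≡ -1ℤ → Complete
        prepend {f} real Pf u∉f joined = complete-path m (suc k)
          (u Vector.∷ f , realizes-attach real (joined-column (A₁₊ k) real u∉f joined) , all-∷ Pu Pf) n<r′
        cases : Complete
        cases with a₀ Fin.≟ 0F | a₀ Fin.≟ fromℕ k
        ... | yes refl | _ = prepend real Pf u∉f joined
        ... | no _ | yes refl = prepend
                (λ a b → trans (real (opposite a) (opposite b)) (cartanA-opposite k a b))
                (Pf ∘ opposite) (u∉f ∘ opposite) joined
        -- Passing to D₄ may shrink the diagram, so the fuel restarts at `n`; from here on the
        -- diagram only grows.
        ... | no ≢0 | no ≢last = complete-branched n typeD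
                (D₄-inside k real Pf Pu (joined-column (A₁₊ k) real u∉f joined) ≢0 ≢last)
                (ℕ.m<n+m n (s≤s z≤n))

      complete : ∀ {i} → P i → Complete
      complete {i} Pi = complete-path n 0 ((λ _ → i) , (λ _ _ → C-diag i) , λ _ → Pi) (ℕ.n<1+n n)

  -- Zero components and UCF moves.

  subsetOf : ∀ {n p} {P : Fin n → Set p} → (∀ j → Dec (P j)) → Subset n
  subsetOf P? = Vec.tabulate (does ∘ P?)

  ∈-subsetOf : ∀ {n p} {P : Fin n → Set p} (P? : ∀ j → Dec (P j)) j → j ∈ subsetOf P? ⇔ P j
  ∈-subsetOf {P = P} P? j = mk⇔ member⇒ member⇐
    where
    lookup≡ : Vec.lookup (subsetOf P?) j ≡ does (P? j)
    lookup≡ = Vec.lookup∘tabulate (does ∘ P?) j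
    member⇒ : j ∈ subsetOf P? → P j
    member⇒ j∈ with P? j | trans (sym (Vec.[]=⇒lookup j∈)) lookup≡
    ... | yes p | _ = p
    member⇐ : P j → j ∈ subsetOf P?
    member⇐ p = Vec.lookup⇒[]= j (subsetOf P?) (trans lookup≡ (dec-true (P? j) p))

  sum-zero-term : ∀ {n} {f : Fin n → ℤ} → (∀ i → 0ℤ ≤ f i) → sum f ≡ 0ℤ → ∀ i → f i ≡ 0ℤ
  sum-zero-term {f = f} 0≤f ∑≡0 i = ℤ.≤-antisym (subst (f i ≤_) ∑≡0 (term≤sum 0≤f i)) (0≤f i)

  diagramVertex : ∀ T → Fin (rank T)
  diagramVertex (A₁₊ k) = 0F
  diagramVertex (D₄₊ k) = 0F
  diagramVertex E₆      = 0F
  diagramVertex E₇      = 0F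
  diagramVertex E₈      = 0F

  module Moves {n : ℕ} (C : Fin n → Fin n → ℤ)
    (C-diag : ∀ i → C i i ≡ + 2)
    (C-sym  : ∀ i j → C i j ≡ C j i)
    (C-off  : ∀ {i j} → i ≢ j → C i j ≡ 0ℤ ⊎ C i j ≡ -1ℤ)
    (Q-pos  : ∀ x i → x i ≢ 0ℤ → 0ℤ < SymmetricForm.Q C C-diag C-sym x)
    {ℓ : Level} (Edge : Rel (Fin n) ℓ) (edge⇔ : ∀ i j → Edge i j ⇔ C i j ≡ -1ℤ)
    where

    open Classification C C-diag C-sym C-off Q-pos public
    open UCF Edge

    Edge? : ∀ i j → Dec (Edge i j)
    Edge? i j = map′ (from (edge⇔ i j)) (to (edge⇔ i j)) (C i j ℤ.≟ -1ℤ)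

    Edge-sym : ∀ {i j} → Edge i j → Edge j i
    Edge-sym {i} {j} edge = from (edge⇔ j i) (trans (C-sym j i) (to (edge⇔ i j) edge))

    ZeroEdge-sym : ∀ {γ i j} → ZeroEdge γ i j → ZeroEdge γ j i
    ZeroEdge-sym (γi≡0 , γj≡0 , edge) = γj≡0 , γi≡0 , Edge-sym edge

    zero-along : ∀ {γ i j} → γ i ≡ 0 → Star (ZeroEdge γ) i j → γ j ≡ 0
    zero-along γi≡0 ε                         = γi≡0
    zero-along γi≡0 ((_ , γk≡0 , _) ◅ path) = zero-along γk≡0 path

    IsComponentOf : (Fin n → ℕ) → Fin n → Subset n → Set ℓ
    IsComponentOf γ i R = ∀ j → j ∈ R ⇔ Star (ZeroEdge γ) i j

    -- The grown diagram has only reachable vertices and no frontier, so its image is exactly what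
    -- can be reached from `i`. Membership is decided as membership in this image, without a
    -- separate graph search.
    component-of : ∀ γ i → γ i ≡ 0 → ∃[ R ] (IsComponentOf γ i R × ∃[ T ] Numbering T R)
    component-of γ i γi≡0 = numbered complete′
      where
      P-step : ∀ {u v} → Star (ZeroEdge γ) i v → γ u ≡ 0 → C u v ≡ -1ℤ → Star (ZeroEdge γ) i u
      P-step {u} {v} path γu≡0 C≡-1 =
        path ◅◅ (zero-along γi≡0 path , γu≡0 , Edge-sym (from (edge⇔ u v) C≡-1)) ◅ ε

      open Growth (λ u → γ u ℕ.≟ 0) (Star (ZeroEdge γ) i) P-step

      complete′ : Complete
      complete′ = complete ε

      numbered : Complete → ∃[ R ] (IsComponentOf γ i R × ∃[ T ] Numbering T R)
      numbered (T , f , real , reached , closed) = R , component , T , numbering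
        where
        inImage? : ∀ j → Dec (∃[ a ] f a ≡ j)
        inImage? j = Fin.any? λ a → f a Fin.≟ j

        R : Subset n
        R = subsetOf inImage?

        closed-along : ∀ {u v} → ∃[ a ] f a ≡ u → Star (ZeroEdge γ) u v → ∃[ a ] f a ≡ v
        closed-along in-u ε = in-u
        closed-along {u} (a , refl) (_◅_ {j = w} (_ , γw≡0 , edge) path) with inImage? w
        ... | yes in-w = closed-along in-w path
        ... | no ¬in-w = contradiction
                (w , γw≡0 , (λ b fb≡w → ¬in-w (b , fb≡w)) , a , to (edge⇔ w (f a)) (Edge-sym edge))
                closed

        component : IsComponentOf γ i R
        component j = mk⇔
          (λ j∈R → let (a , fa≡j) = to (∈-subsetOf inImage? j) j∈R in subst (Star (ZeroEdge γ) i) fa≡j (reached a))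
          (λ path → from (∈-subsetOf inImage? j)
            (closed-along (a₀ , refl) (Star.reverse ZeroEdge-sym (reached a₀) ◅◅ path)))
          where a₀ = diagramVertex T

        numbering : Numbering T R
        numbering = record
          { vertex    = f
          ; injective = realizes-injective (cartan-isCartan T) real
          ; image     = ∈-subsetOf inImage?
          ; edges     = λ k l → mk⇔
              (λ d → from (edge⇔ (f k) (f l)) (trans (real k l) (proj₁ (cartan-edges T k l) d)))
              (λ edge → proj₂ (cartan-edges T k l) (trans (sym (real k l)) (to (edge⇔ (f k) (f l)) edge)))
          }

    Adjoins? : ∀ j R → Dec (Adjoins j R)
    Adjoins? j R = Fin.any? λ i → i Subset.∈? R ×-dec Edge? i j

    weightOf : (Fin n → ℕ) → Fin n → ℤ
    weightOf γ i = + γ i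

    weightOf-dominant : ∀ γ → Dominant (weightOf γ)
    weightOf-dominant γ i = +≤+ z≤n

    component-zero : ∀ {γ R} → IsZeroComponent γ R → ∀ {j} → j ∈ R → γ j ≡ 0
    component-zero (i , γi≡0 , comp) {j} j∈R = zero-along γi≡0 (to (comp j) j∈R)

    component-closed : ∀ {γ R} → IsZeroComponent γ R → ∀ {j k} → j ∈ R → Edge j k → γ k ≡ 0 → k ∈ R
    component-closed c@(i , γi≡0 , comp) {j} {k} j∈R edge γk≡0 =
      from (comp k) (to (comp j) j∈R ◅◅ (component-zero c j∈R , γk≡0 , edge) ◅ ε)

    component-connected : ∀ {γ R} → IsZeroComponent γ R → ∀ {j k} → j ∈ R → k ∈ R → Star (ZeroEdge γ) j k
    component-connected (i , γi≡0 , comp) {j} {k} j∈R k∈R =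
      Star.reverse ZeroEdge-sym (to (comp j) j∈R) ◅◅ to (comp k) k∈R

    SupportedIn : Subset n → (Fin n → ℤ) → Set
    SupportedIn R β = ∀ j → 0ℤ < β j → j ∈ R

    star-fire : ∀ {γ i j} → Star (ZeroEdge γ) i j →
                weightOf γ ⊕ A (e i) ~ weightOf γ ⊕ A (e j)
    star-fire ε = ~-refl
    star-fire {γ} {i} (_◅_ {j = k} (γi≡0 , γk≡0 , edge) path) =
      ~-trans (fire-edge (weightOf γ) i k (cong +_ γi≡0) (cong +_ γk≡0) (to (edge⇔ i k) edge))
              (star-fire path)

    -- All roots supported in R are conjugate under reflections fixing γ.
    component-fire : ∀ {γ R} → IsZeroComponent γ R → ∀ {β β′} → Root β → SupportedIn R β →
                     Root β′ → SupportedIn R β′ → weightOf γ ⊕ A β ~ weightOf γ ⊕ A β′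
    component-fire {γ} comp {β} {β′} root supp root′ supp′ =
      let (i , 0<βi  , eq)  = fire-simple (weightOf γ) β root (λ j 0<βj → cong +_ (component-zero comp (supp j 0<βj)))
          (j , 0<β′j , eq′) = fire-simple (weightOf γ) β′ root′ (λ j 0<βj → cong +_ (component-zero comp (supp′ j 0<βj)))
      in ~-trans eq (~-trans (star-fire (component-connected comp (supp i 0<βi) (supp′ j 0<β′j))) (~-sym eq′))

    module NumberedComponent {γ R} (comp : IsZeroComponent γ R) (T : DiagramType) (numbering : Numbering T R) where

      open Numbering numbering

      -- Off the diagonal both matrices have only the entries 0 and -1, so agreement on the edges is
      -- agreement of the entries.
      realizes : Realizes (cartan T) vertex
      realizes k l with k Fin.≟ l
      ... | yes refl = trans (C-diag (vertex k)) (sym (proj₁ (cartan-isCartan T) k))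
      ... | no k≢l with C-off {vertex k} {vertex l} (k≢l ∘ injective) | proj₂ (cartan-isCartan T) k l k≢l
      ...   | inj₁ p | inj₁ q = trans p (sym q)
      ...   | inj₂ p | inj₂ q = trans p (sym q)
      ...   | inj₁ p | inj₂ q = contradiction
              (trans (sym p) (to (edge⇔ _ _) (to (edges k l) (proj₂ (cartan-edges T k l) q)))) λ ()
      ...   | inj₂ p | inj₁ q = contradiction
              (trans (sym q) (proj₁ (cartan-edges T k l) (from (edges k l) (from (edge⇔ _ _) p)))) λ ()

      θ : Fin n → ℤ
      θ = highestRoot T vertex

      θ-root : Root θ
      θ-root = highestRoot-root T realizes

      outside-image : ∀ {j} → j ∉ R → ∀ k → vertex k ≢ j
      outside-image {j} j∉R k vk≡j = j∉R (from (image j) (k , vk≡j))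

      θ-supported : SupportedIn R θ
      θ-supported j 0<θj with j Subset.∈? R
      ... | yes j∈R = j∈R
      ... | no  j∉R = contradiction (sym (comb-outside vertex (mark T) (outside-image j∉R))) (ℤ.<⇒≢ 0<θj)

      Aθ-inside : ∀ k → A θ (vertex k) ≡ + affineMultiplicity T k
      Aθ-inside = highestRoot-pairing T realizes

      -- A UCF move decreases by exactly 1 because the outside vertex has a single neighbour in `R`,
      -- of mark 1.
      Aθ-adjoining : ∀ {j} → j ∉ R → Adjoins j R → A θ j ≡ -1ℤ
      Aθ-adjoining {j} j∉R (i , i∈R , edge) with to (image i) i∈R
      ... | a₀ , refl = begin
        A θ j
          ≡⟨ A-comb vertex (mark T) j ⟩
        sum (λ a → mark T a * C j (vertex a))
          ≡⟨ sum-cong-≗ (λ a → cong (mark T a *_) (joined-column T realizes (outside-image j∉R) joined a)) ⟩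
        sum (λ a → mark T a * at a₀ a)
          ≡⟨ sum-at (mark T) a₀ ⟩
        - mark T a₀
          ≡⟨ cong -_ (joined-mark T realizes (outside-image j∉R) joined) ⟩
        -1ℤ ∎
        where
        open ≡-Reasoning
        joined : C j (vertex a₀) ≡ -1ℤ
        joined = trans (C-sym j (vertex a₀)) (to (edge⇔ (vertex a₀) j) edge)

      Aθ-apart : ∀ {j} → j ∉ R → ¬ Adjoins j R → A θ j ≡ 0ℤ
      Aθ-apart {j} j∉R ¬adj = trans (A-comb vertex (mark T) j)
        (sum-0 (λ a → trans (cong (mark T a *_) (not-joined a)) (ℤ.*-zeroʳ (mark T a))))
        where
        not-joined : ∀ a → C j (vertex a) ≡ 0ℤ
        not-joined a with C-off {j} {vertex a} (outside-image j∉R a ∘ sym)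
        ... | inj₁ p = p
        ... | inj₂ p = contradiction
                (vertex a , from (image _) (a , refl) , Edge-sym (from (edge⇔ j (vertex a)) p)) ¬adj

      fired : Fin n → ℤ
      fired = weightOf γ ⊕ A θ

      γ-adjoining : ∀ {j} → j ∉ R → Adjoins j R → γ j ≢ 0
      γ-adjoining j∉R (i , i∈R , edge) γj≡0 = j∉R (component-closed comp i∈R edge γj≡0)

      -- The pairing with `θ` is negative only at adjoining vertices, where it is -1; there `γ` is
      -- at least 1, since otherwise the vertex would belong to `R`.
      fired-dominant : Dominant fired
      fired-dominant j with j Subset.∈? R | Adjoins? j R
      ... | yes j∈R | _ with to (image j) j∈R
      ...   | k , refl rewrite Aθ-inside k = +≤+ z≤n
      fired-dominant j | no j∉R | no ¬adj rewrite Aθ-apart j∉R ¬adj = +≤+ z≤n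
      fired-dominant j | no j∉R | yes adj rewrite Aθ-adjoining j∉R adj with γ j | γ-adjoining j∉R adj
      ... | zero  | γj≢0 = contradiction refl γj≢0
      ... | suc m | _    = +≤+ z≤n

      ⟪γ,θ⟫≡0 : ⟪ weightOf γ , θ ⟫ ≡ 0ℤ
      ⟪γ,θ⟫≡0 = trans (⟪⟫-comb (weightOf γ) vertex (mark T))
        (sum-0 (λ a → trans (cong (λ m → mark T a * + m) (component-zero comp (from (image _) (a , refl))))
                            (ℤ.*-zeroʳ (mark T a))))

      move : ∀ {γ′} → weightOf γ′ ≗ fired → UCFMoveAlong R γ γ′
      move {γ′} p = record
        { component = comp
        ; type      = T
        ; numbering = numbering
        ; increase  = λ k → ℤ.+-injective
            (trans (p (vertex k)) (cong (_+_ (+ γ (vertex k))) (Aθ-inside k)))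
        ; decrease  = λ j j∉R adj → ℤ.+-injective
            (trans (cong (_+ 1ℤ) (trans (p j) (cong (_+_ (+ γ j)) (Aθ-adjoining j∉R adj)))) (alg (+ γ j)))
        ; unchanged = λ j j∉R ¬adj → ℤ.+-injective
            (trans (p j) (trans (cong (_+_ (+ γ j)) (Aθ-apart j∉R ¬adj)) (ℤ.+-identityʳ _)))
        }
        where
        alg : ∀ a → (a + -1ℤ) + 1ℤ ≡ a
        alg = solve-∀

    module Move {R γ γ′} (m : UCFMoveAlong R γ γ′) where

      open UCFMoveAlong m
      open NumberedComponent component type numbering public
      open Numbering numbering

      moved : weightOf γ′ ≗ fired
      moved j with j Subset.∈? R | Adjoins? j R
      ... | yes j∈R | _ with to (image j) j∈R
      ...   | k , refl rewrite Aθ-inside k = cong +_ (increase k)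
      moved j | no j∉R | no ¬adj rewrite Aθ-apart j∉R ¬adj =
        trans (cong +_ (unchanged j j∉R ¬adj)) (sym (ℤ.+-identityʳ _))
      moved j | no j∉R | yes adj rewrite Aθ-adjoining j∉R adj | sym (decrease j j∉R adj) =
        alg (+ γ′ j)
        where
        alg : ∀ a → a ≡ (a + 1ℤ) + -1ℤ
        alg = solve-∀

    move⇒fire : ∀ {γ γ′} → UCFMove γ γ′ →
                ∃[ β ] (Root β × ⟪ weightOf γ , β ⟫ ≡ 0ℤ × weightOf γ′ ≗ weightOf γ ⊕ A β)
    move⇒fire (R , m) = θ , θ-root , ⟪γ,θ⟫≡0 , moved
      where open Move m

    -- The pairing of a dominant weight with a positive root has only nonnegative terms, so all of
    -- them vanish.
    orthogonal-support : ∀ γ {β} → Root β → ⟪ weightOf γ , β ⟫ ≡ 0ℤ → ∀ j → 0ℤ < β j → weightOf γ j ≡ 0ℤ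
    orthogonal-support γ {β} (0≤β , _) ⊥β j 0<βj with ℤ.i*j≡0⇒i≡0∨j≡0 (weightOf γ j) (sum-zero-term
      (λ i → *-nonneg (weightOf γ i) (β i) (+≤+ z≤n) (0≤β i))
      (trans (sym (⟪⟫-sum (weightOf γ) β)) ⊥β) j)
    ... | inj₁ p = p
    ... | inj₂ p = contradiction (sym p) (ℤ.<⇒≢ 0<βj)

    fire⇒move : ∀ γ γ′ {v w β} → v ~ weightOf γ → w ~ weightOf γ′ → Root β → ⟪ v , β ⟫ ≡ 0ℤ →
                w ≗ v ⊕ A β → UCFMove γ γ′
    fire⇒move γ γ′ {β = β} v~γ w~γ′ root ⊥β w≗ with fire-transport β v~γ root ⊥β
    ... | β′ , root′ , ⊥β′ , v⊕~γ⊕ with fire-simple (weightOf γ) β′ root′ (orthogonal-support γ root′ ⊥β′)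
    ... | i , 0<βi , γ⊕~γ⊕e with component-of γ i (ℤ.+-injective (orthogonal-support γ root′ ⊥β′ i 0<βi))
    ... | R , comp , T , numbering = R , move
      (dominant-unique (weightOf-dominant γ′) fired-dominant
        -- The chain of orbits runs through `v + β`, `γ + β′`, `γ + α_i` and `γ + θ_R`.
        (~-trans (~-sym w~γ′) (~-resp w≗ (~-trans v⊕~γ⊕ (~-trans γ⊕~γ⊕e
          (component-fire zc (e-root i) e-supp θ-root θ-supported))))))
      where
      zc : IsZeroComponent γ R
      zc = i , ℤ.+-injective (orthogonal-support γ root′ ⊥β′ i 0<βi) , comp
      open NumberedComponent zc T numbering
      e-supp : SupportedIn R (e i)
      e-supp j 0<ej with i Fin.≟ j
      ... | yes refl = from (comp i) ε
      ... | no i≢j   = contradiction (sym (e-off i≢j)) (ℤ.<⇒≢ 0<ej)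

    components-meet : ∀ {γ R R′} → IsZeroComponent γ R → IsZeroComponent γ R′ →
                      ∀ {i} → i ∈ R → i ∈ R′ → R ≡ R′
    components-meet c@(i₁ , _ , comp) c′@(i₂ , _ , comp′) {i} i∈R i∈R′ = Subset.⊆-antisym
      (λ {j} j∈R → from (comp′ j) (to (comp′ i) i∈R′ ◅◅ component-connected c i∈R j∈R))
      (λ {j} j∈R′ → from (comp j) (to (comp i) i∈R ◅◅ component-connected c′ i∈R′ j∈R′))

    module _ {γ R₁ R₂ γ₁} (R₁≢R₂ : R₁ ≢ R₂) (m₁ : UCFMoveAlong R₁ γ γ₁)
             (c₂ : IsZeroComponent γ R₂) where

      private
        c₁ = UCFMoveAlong.component m₁
        i₂ = proj₁ c₂

        i₂∈R₂ : i₂ ∈ R₂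
        i₂∈R₂ = from (proj₂ (proj₂ c₂) i₂) ε

      -- A zero of `γ` next to `R₁` belongs to `R₁`; so no vertex of the other component adjoins
      -- `R₁`, and the move leaves it unchanged.
      still-zero : ∀ {j} → j ∈ R₂ → γ₁ j ≡ 0
      still-zero {j} j∈R₂ = trans (UCFMoveAlong.unchanged m₁ j j∉R₁ ¬adj) γj≡0
        where
        γj≡0 = component-zero c₂ j∈R₂
        j∉R₁ : j ∉ R₁
        j∉R₁ j∈R₁ = R₁≢R₂ (components-meet c₁ c₂ j∈R₁ j∈R₂)
        ¬adj : ¬ Adjoins j R₁
        ¬adj (i , i∈R₁ , edge) = j∉R₁ (component-closed c₁ i∈R₁ edge γj≡0)

      still-connected : ∀ {i j} → i ∈ R₂ → Star (ZeroEdge γ) i j → Star (ZeroEdge γ₁) i j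
      still-connected i∈R₂ ε = ε
      still-connected i∈R₂ ((_ , γk≡0 , edge) ◅ path) =
        (still-zero i∈R₂ , still-zero k∈R₂ , edge) ◅ still-connected k∈R₂ path
        where k∈R₂ = component-closed c₂ i∈R₂ edge γk≡0

      larger-component : ∃[ R₂′ ] (IsZeroComponent γ₁ R₂′ × R₂ ⊆ R₂′ × ∃[ T ] Numbering T R₂′)
      larger-component with component-of γ₁ i₂ (still-zero i₂∈R₂)
      ... | R₂′ , comp , numbered =
        R₂′ , (i₂ , still-zero i₂∈R₂ , comp) ,
        (λ {j} j∈R₂ → from (comp j) (still-connected i₂∈R₂ (to (proj₂ (proj₂ c₂) j) j∈R₂))) ,
        numbered

    module _ {γ R₁ R₂ R₂′ γ₁ γ₂} (m₁ : UCFMoveAlong R₁ γ γ₁) (m₂ : UCFMoveAlong R₂ γ γ₂)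
             (R₂⊆R₂′ : R₂ ⊆ R₂′) where

      private
        module M₁ = Move m₁
        module M₂ = Move m₂

      -- The highest root of `R₂′` may differ from that of `R₂`, but both are supported in `R₂′`,
      -- and `component-fire` gives them the same orbit. The resulting weight is symmetric in the
      -- two components, whence commutation.
      second-move : (c : IsZeroComponent γ₁ R₂′) (T : DiagramType) (numbering : Numbering T R₂′) →
                    NumberedComponent.fired c T numbering ~ weightOf γ ⊕ A M₁.θ ⊕ A M₂.θ
      second-move c T numbering = ~-trans
        (component-fire c N.θ-root N.θ-supported M₂.θ-root (λ j 0<θj → R₂⊆R₂′ (M₂.θ-supported j 0<θj)))
        (done (λ j → cong (_+ A M₂.θ j) (M₁.moved j)))
        where module N = NumberedComponent c T numbering

    moves-commute : ∀ (γ : Fin n → ℕ) (R₁ R₂ : Subset n) → R₁ ≢ R₂ →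
      ∀ (γ₁ γ₂ : Fin n → ℕ) → UCFMoveAlong R₁ γ γ₁ → UCFMoveAlong R₂ γ γ₂ →
      ∃[ R₂′ ] ∃[ R₁′ ]
        ( IsZeroComponent γ₁ R₂′ × R₂ ⊆ R₂′
        × IsZeroComponent γ₂ R₁′ × R₁ ⊆ R₁′
        × (∃[ δ ] (UCFMoveAlong R₂′ γ₁ δ × UCFMoveAlong R₁′ γ₂ δ))
        × (∀ δ₁ δ₂ → UCFMoveAlong R₂′ γ₁ δ₁ → UCFMoveAlong R₁′ γ₂ δ₂ → δ₁ ≗ δ₂))
    moves-commute γ R₁ R₂ R₁≢R₂ γ₁ γ₂ m₁ m₂
      with larger-component R₁≢R₂ m₁ (UCFMoveAlong.component m₂)
         | larger-component (R₁≢R₂ ∘ sym) m₂ (UCFMoveAlong.component m₁)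
    ... | R₂′ , c₂′ , R₂⊆R₂′ , T₂ , N₂ | R₁′ , c₁′ , R₁⊆R₁′ , T₁ , N₁ =
      R₂′ , R₁′ , c₂′ , R₂⊆R₂′ , c₁′ , R₁⊆R₁′ ,
      (δ , L.move δ≗ , R.move (λ j → trans (δ≗ j)
        (dominant-unique L.fired-dominant R.fired-dominant (same c₂′ T₂ N₂ c₁′ T₁ N₁) j))) ,
      λ δ₁ δ₂ n₁ n₂ j → ℤ.+-injective (trans (Move.moved n₁ j) (trans
        (dominant-unique (Move.fired-dominant n₁) (Move.fired-dominant n₂)
          (same (component n₁) (type n₁) (numbering n₁) (component n₂) (type n₂) (numbering n₂)) j)
        (sym (Move.moved n₂ j))))
      where
      open UCFMoveAlong
      module L = NumberedComponent c₂′ T₂ N₂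
      module R = NumberedComponent c₁′ T₁ N₁
      module M₁ = Move m₁
      module M₂ = Move m₂
      δ : Fin n → ℕ
      -- The fired weight is dominant, so the absolute value only changes the type.
      δ j = ∣ L.fired j ∣
      δ≗ : weightOf δ ≗ L.fired
      δ≗ j = ℤ.0≤i⇒+∣i∣≡i (L.fired-dominant j)
      swap : ∀ a b c → (a + b) + c ≡ (a + c) + b
      swap = solve-∀
      same : ∀ c T N c′ T′ N′ → NumberedComponent.fired {γ₁} {R₂′} c T N ~ NumberedComponent.fired {γ₂} {R₁′} c′ T′ N′
      same c T N c′ T′ N′ = ~-trans (second-move m₁ m₂ R₂⊆R₂′ c T N)
        (~-resp (λ j → swap (+ γ j) (A M₁.θ j) (A M₂.θ j)) (~-sym (second-move m₂ m₁ R₁⊆R₁′ c′ T′ N′)))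

open RootLattice

-- The integers inside an ordered field.

module IntegersInField {c ℓ₁ ℓ₂} (K : OrderedField c ℓ₁ ℓ₂) where

  open OrderedField K hiding (zero)
  open IsStrictTotalOrder isStrictTotalOrder public
    using (compare; <-resp-≈) renaming (irrefl to <-irrefl; trans to <-trans; _≟_ to _≈?_)
  open Algebra.Properties.Ring ring public
    using (-‿distribˡ-*; -‿distribʳ-*; -0#≈0#; -‿involutive; -‿+-comm; -1*x≈-x)
  open Algebra.Properties.Semiring.Mult semiring using (×-homo-+; ×1-homo-*)
  open Algebra.Properties.Semiring.Sum semiring public
    using () renaming (sum to ∑; sum-cong-≋ to ∑-cong)
  open Algebra.Properties.CommutativeSemigroup +-commutativeSemigroup public
    using () renaming (interchange to +-interchange)
  open Algebra.Properties.CommutativeSemigroup *-commutativeSemigroup public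
    using () renaming (x∙yz≈y∙xz to x*yz≈y*xz)
  open Relation.Binary.Reasoning.Setoid setoid

  <-respʳ : ∀ {x y z} → y ≈ z → x < y → x < z
  <-respʳ = proj₁ <-resp-≈

  <-respˡ : ∀ {x y z} → y ≈ z → y < x → z < x
  <-respˡ = proj₂ <-resp-≈

  0<x⇒-x<0 : ∀ {x} → 0# < x → - x < 0#
  0<x⇒-x<0 {x} 0<x = <-respʳ (-‿inverseˡ x) (<-respˡ (+-identityʳ (- x)) (+-monoʳ-< (- x) 0<x))

  x<0⇒0<-x : ∀ {x} → x < 0# → 0# < - x
  x<0⇒0<-x {x} x<0 = <-respʳ (+-identityʳ (- x)) (<-respˡ (-‿inverseˡ x) (+-monoʳ-< (- x) x<0))

  0<fromℕ : ∀ k → 0# < fromℕ (suc k)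
  0<fromℕ zero    = <-respʳ (sym (+-identityʳ 1#)) 0<1
  0<fromℕ (suc k) = <-trans 0<1 (<-respˡ (+-identityʳ 1#) (+-monoʳ-< 1# (0<fromℕ k)))

  fromℤ-⊖ : ∀ m n → fromℤ (m ℤ.⊖ n) ≈ fromℕ m + - fromℕ n
  fromℤ-⊖ zero    zero    = sym (-‿inverseʳ 0#)
  fromℤ-⊖ zero    (suc n) = sym (+-identityˡ _)
  fromℤ-⊖ (suc m) zero    = sym (trans (+-congˡ -0#≈0#) (+-identityʳ _))
  fromℤ-⊖ (suc m) (suc n) = begin
    fromℤ (suc m ℤ.⊖ suc n)                   ≡⟨ ≡.cong fromℤ (ℤ.[1+m]⊖[1+n]≡m⊖n m n) ⟩
    fromℤ (m ℤ.⊖ n)                           ≈⟨ fromℤ-⊖ m n ⟩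
    fromℕ m + - fromℕ n                       ≈⟨ +-identityˡ _ ⟨
    0# + (fromℕ m + - fromℕ n)                ≈⟨ +-congʳ (-‿inverseʳ 1#) ⟨
    (1# + - 1#) + (fromℕ m + - fromℕ n)       ≈⟨ +-interchange 1# (- 1#) (fromℕ m) (- fromℕ n) ⟩
    (1# + fromℕ m) + (- 1# + - fromℕ n)       ≈⟨ +-congˡ (-‿+-comm 1# (fromℕ n)) ⟩
    (1# + fromℕ m) + - (1# + fromℕ n)         ∎

  fromℤ-neg : ∀ z → fromℤ (ℤ.- z) ≈ - fromℤ z
  fromℤ-neg (+ zero)  = sym -0#≈0#
  fromℤ-neg (+ suc k) = refl
  fromℤ-neg -[1+ k ]  = sym (-‿involutive _)

  fromℤ-+ : ∀ a b → fromℤ (a ℤ.+ b) ≈ fromℤ a + fromℤ b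
  fromℤ-+ (+ a)    (+ b)    = ×-homo-+ 1# a b
  fromℤ-+ (+ a)    -[1+ b ] = fromℤ-⊖ a (suc b)
  fromℤ-+ -[1+ a ] (+ b)    = trans (fromℤ-⊖ b (suc a)) (+-comm _ _)
  fromℤ-+ -[1+ a ] -[1+ b ] = begin
    - fromℕ (suc (suc (a ℕ.+ b)))           ≈⟨ -‿cong (+-assoc 1# 1# _) ⟨
    - ((1# + 1#) + fromℕ (a ℕ.+ b))         ≈⟨ -‿cong (+-congˡ (×-homo-+ 1# a b)) ⟩
    - ((1# + 1#) + (fromℕ a + fromℕ b))     ≈⟨ -‿cong (+-interchange 1# 1# (fromℕ a) (fromℕ b)) ⟩
    - (fromℕ (suc a) + fromℕ (suc b))       ≈⟨ -‿+-comm _ _ ⟨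
    - fromℕ (suc a) + - fromℕ (suc b)       ∎

  fromℤ-*⁺ : ∀ a b → fromℤ (+ a ℤ.* b) ≈ fromℕ a * fromℤ b
  fromℤ-*⁺ a (+ b)    = trans (reflexive (≡.cong fromℤ (≡.sym (ℤ.pos-* a b)))) (×1-homo-* a b)
  fromℤ-*⁺ a -[1+ b ] = begin
    fromℤ (+ a ℤ.* ℤ.- + suc b)     ≡⟨ ≡.cong fromℤ (ℤ.neg-distribʳ-* (+ a) (+ suc b)) ⟨
    fromℤ (ℤ.- (+ a ℤ.* + suc b))   ≈⟨ fromℤ-neg (+ a ℤ.* + suc b) ⟩
    - fromℤ (+ a ℤ.* + suc b)       ≈⟨ -‿cong (fromℤ-*⁺ a (+ suc b)) ⟩
    - (fromℕ a * fromℕ (suc b))     ≈⟨ -‿distribʳ-* _ _ ⟩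
    fromℕ a * - fromℕ (suc b)       ∎

  fromℤ-* : ∀ a b → fromℤ (a ℤ.* b) ≈ fromℤ a * fromℤ b
  fromℤ-* (+ a)    b = fromℤ-*⁺ a b
  fromℤ-* -[1+ a ] b = begin
    fromℤ (ℤ.- + suc a ℤ.* b)     ≡⟨ ≡.cong fromℤ (ℤ.neg-distribˡ-* (+ suc a) b) ⟨
    fromℤ (ℤ.- (+ suc a ℤ.* b))   ≈⟨ fromℤ-neg (+ suc a ℤ.* b) ⟩
    - fromℤ (+ suc a ℤ.* b)       ≈⟨ -‿cong (fromℤ-*⁺ (suc a) b) ⟩
    - (fromℕ (suc a) * fromℤ b)   ≈⟨ -‿distribˡ-* _ _ ⟩
    - fromℕ (suc a) * fromℤ b     ∎

  fromℤ-1 : fromℤ 1ℤ ≈ 1#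
  fromℤ-1 = +-identityʳ 1#

  fromℤ--1 : fromℤ -1ℤ ≈ - 1#
  fromℤ--1 = -‿cong (+-identityʳ 1#)

  fromℤ-2 : fromℤ (+ 2) ≈ 1# + 1#
  fromℤ-2 = +-congˡ (+-identityʳ 1#)

  fromℤ-∑ : ∀ {n} (f : Fin n → ℤ) → fromℤ (sumℤ f) ≈ ∑ (λ i → fromℤ (f i))
  fromℤ-∑ {zero}  f = refl
  fromℤ-∑ {suc n} f = trans (fromℤ-+ (f zero) _) (+-congˡ (fromℤ-∑ (λ i → f (suc i))))

  0<fromℤ⇒0< : ∀ z → 0# < fromℤ z → 0ℤ ℤ.< z
  0<fromℤ⇒0< (+ zero)  0<z = contradiction 0<z (<-irrefl refl)
  0<fromℤ⇒0< (+ suc k) 0<z = ℤ.+<+ (ℕ.s≤s ℕ.z≤n)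
  0<fromℤ⇒0< -[1+ k ]  0<z =
    contradiction (<-trans 0<z (0<x⇒-x<0 (0<fromℕ k))) (<-irrefl refl)

  fromℤ≈0⇒≡0 : ∀ z → fromℤ z ≈ 0# → z ≡ 0ℤ
  fromℤ≈0⇒≡0 (+ zero)  p = ≡.refl
  fromℤ≈0⇒≡0 (+ suc k) p = contradiction (0<fromℕ k) (<-irrefl (sym p))
  fromℤ≈0⇒≡0 -[1+ k ]  p = contradiction (0<x⇒-x<0 (0<fromℕ k)) (<-irrefl p)

  fromℤ-injective : ∀ a b → fromℤ a ≈ fromℤ b → a ≡ b
  fromℤ-injective a b p = ℤ.i-j≡0⇒i≡j a b (fromℤ≈0⇒≡0 (a ℤ.- b) (begin
    fromℤ (a ℤ.+ ℤ.- b)       ≈⟨ fromℤ-+ a (ℤ.- b) ⟩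
    fromℤ a + fromℤ (ℤ.- b)   ≈⟨ +-cong p (fromℤ-neg b) ⟩
    fromℤ b + - fromℤ b       ≈⟨ -‿inverseʳ (fromℤ b) ⟩
    0#                        ∎))

  0<⇒≉0 : ∀ {x} → 0# < x → ¬ x ≈ 0#
  0<⇒≉0 0<x x≈0 = <-irrefl (sym x≈0) 0<x

  -- Only `⁻¹-inverseʳ` is known about `_⁻¹`, so congruence has to come from uniqueness of inverses,
  -- which holds away from 0.
  ⁻¹-cong : ∀ {x y} → ¬ x ≈ 0# → x ≈ y → x ⁻¹ ≈ y ⁻¹
  ⁻¹-cong {x} {y} x≉0 x≈y = begin
    x ⁻¹              ≈⟨ *-identityʳ _ ⟨
    x ⁻¹ * 1#         ≈⟨ *-congˡ (⁻¹-inverseʳ y (λ y≈0 → x≉0 (trans x≈y y≈0))) ⟨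
    x ⁻¹ * (y * y ⁻¹) ≈⟨ *-assoc _ _ _ ⟨
    (x ⁻¹ * y) * y ⁻¹ ≈⟨ *-congʳ (*-congˡ x≈y) ⟨
    (x ⁻¹ * x) * y ⁻¹ ≈⟨ *-congʳ (trans (*-comm _ _) (⁻¹-inverseʳ x x≉0)) ⟩
    1# * y ⁻¹         ≈⟨ *-identityˡ _ ⟩
    y ⁻¹              ∎

  ⁻¹-positive : ∀ {x} → 0# < x → 0# < x ⁻¹
  ⁻¹-positive {x} 0<x with compare 0# (x ⁻¹)
  ... | tri< 0<x⁻¹ _ _ = 0<x⁻¹
  ... | tri≈ _ 0≈x⁻¹ _ = contradiction 0<1 (<-irrefl (begin
    0#         ≈⟨ zeroʳ x ⟨
    x * 0#     ≈⟨ *-congˡ 0≈x⁻¹ ⟩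
    x * x ⁻¹   ≈⟨ ⁻¹-inverseʳ x (0<⇒≉0 0<x) ⟩
    1#         ∎))
  ... | tri> _ _ x⁻¹<0 = contradiction
    (<-trans (<-respʳ (begin
      x * - (x ⁻¹)   ≈⟨ -‿distribʳ-* x (x ⁻¹) ⟨
      - (x * x ⁻¹)   ≈⟨ -‿cong (⁻¹-inverseʳ x (0<⇒≉0 0<x)) ⟩
      - 1#           ∎) (*-pos 0<x (x<0⇒0<-x x⁻¹<0))) (0<x⇒-x<0 0<1))
    (<-irrefl refl)

-- From vectors of the root system to integer coordinates.

module Geometry {c ℓ₁ ℓ₂ m ℓm ℓ : Level} {K : OrderedField c ℓ₁ ℓ₂} {V : InnerProductSpace K m ℓm}
                (S : SimplyLacedRootSystem V ℓ) {n : ℕ} (Δ : SimpleRoots S n) where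

  open OrderedField K hiding (zero; _·_)
  open IntegersInField K
  open InnerProductSpace V
  open SimplyLacedRootSystem S renaming (reflection to reflection-closed)
  open SimpleRoots Δ
  open Algebra.Module.Properties.LeftModule leftModule using (inverseˡ-uniqueᴹ; -ᴹ-involutive)
  open Algebra.Properties.CommutativeMonoid.Sum +ᴹ-commutativeMonoid
    using () renaming (sum-cong-≋ to ∑ᴹ-cong; ∑-distrib-+ to ∑ᴹ-distrib-+)
  module K-Reasoning = Relation.Binary.Reasoning.Setoid setoid
  module V-Reasoning = Relation.Binary.Reasoning.Setoid ≈ᴹ-setoid

  -ᴹ≈-1*ₗ : ∀ v → -ᴹ v ≈ᴹ (- 1#) *ₗ v
  -ᴹ≈-1*ₗ v = ≈ᴹ-sym (inverseˡ-uniqueᴹ ((- 1#) *ₗ v) v (begin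
    (- 1#) *ₗ v +ᴹ v         ≈⟨ +ᴹ-congˡ (*ₗ-identityˡ v) ⟨
    (- 1#) *ₗ v +ᴹ 1# *ₗ v   ≈⟨ *ₗ-distribʳ v (- 1#) 1# ⟨
    (- 1# + 1#) *ₗ v         ≈⟨ *ₗ-congʳ (-‿inverseˡ 1#) ⟩
    0# *ₗ v                  ≈⟨ *ₗ-zeroˡ v ⟩
    0ᴹ                       ∎))
    where open V-Reasoning

  lin : ∀ {k} → (Fin k → Carrier) → (Fin k → Carrierᴹ) → Carrierᴹ
  lin a u = ∑ᴹ (λ i → a i *ₗ u i)

  lin-cong : ∀ {k} {a b : Fin k → Carrier} u → (∀ i → a i ≈ b i) → lin a u ≈ᴹ lin b u
  lin-cong u a≈b = ∑ᴹ-cong (λ i → *ₗ-congʳ (a≈b i))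

  lin-+ : ∀ {k} (a b : Fin k → Carrier) u → lin (λ i → a i + b i) u ≈ᴹ lin a u +ᴹ lin b u
  lin-+ a b u = ≈ᴹ-trans (∑ᴹ-cong (λ i → *ₗ-distribʳ (u i) (a i) (b i)))
                         (∑ᴹ-distrib-+ (λ i → a i *ₗ u i) (λ i → b i *ₗ u i))

  lin-* : ∀ {k} s (a : Fin k → Carrier) u → lin (λ i → s * a i) u ≈ᴹ s *ₗ lin a u
  lin-* {zero}  s a u = ≈ᴹ-sym (*ₗ-zeroʳ s)
  lin-* {suc k} s a u = ≈ᴹ-trans
    (+ᴹ-cong (*ₗ-assoc s (a zero) (u zero)) (lin-* s (a ∘ suc) (u ∘ suc)))
    (≈ᴹ-sym (*ₗ-distribˡ s _ _))

  lin-0 : ∀ {k} {a : Fin k → Carrier} u → (∀ i → a i ≈ 0#) → lin a u ≈ᴹ 0ᴹ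
  lin-0 {zero}  u a≈0 = ≈ᴹ-refl
  lin-0 {suc k} u a≈0 = ≈ᴹ-trans
    (+ᴹ-cong (≈ᴹ-trans (*ₗ-congʳ (a≈0 zero)) (*ₗ-zeroˡ _)) (lin-0 (u ∘ suc) (a≈0 ∘ suc)))
    (+ᴹ-identityʳ 0ᴹ)

  lin-e : ∀ {k} (u : Fin k → Carrierᴹ) i → lin (fromℤ ∘ e i) u ≈ᴹ u i
  lin-e u zero    = ≈ᴹ-trans
    (+ᴹ-cong (≈ᴹ-trans (*ₗ-congʳ fromℤ-1) (*ₗ-identityˡ _)) (lin-0 (u ∘ suc) (λ _ → refl)))
    (+ᴹ-identityʳ _)
  lin-e u (suc i) = ≈ᴹ-trans (+ᴹ-cong (*ₗ-zeroˡ _) (lin-e (u ∘ suc) i)) (+ᴹ-identityˡ _)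

  ·ᴹ≈*ₗ : ∀ k v → k ·ᴹ v ≈ᴹ fromℕ k *ₗ v
  ·ᴹ≈*ₗ zero    v = ≈ᴹ-sym (*ₗ-zeroˡ v)
  ·ᴹ≈*ₗ (suc k) v = ≈ᴹ-trans (+ᴹ-cong (≈ᴹ-sym (*ₗ-identityˡ v)) (·ᴹ≈*ₗ k v))
                             (≈ᴹ-sym (*ₗ-distribʳ v 1# (fromℕ k)))

  ∑·ᴹ≈lin : ∀ {k} (a : Fin k → ℕ) u → ∑ᴹ (λ i → a i ·ᴹ u i) ≈ᴹ lin (λ i → fromℤ (+ a i)) u
  ∑·ᴹ≈lin a u = ∑ᴹ-cong (λ i → ·ᴹ≈*ₗ (a i) (u i))

  N : Carrier
  N = ⟨ proj₁ nonempty , proj₁ nonempty ⟩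

  κ : Carrier
  κ = (1# + 1#) * N ⁻¹

  N>0 : 0# < N
  N>0 = ⟨⟩-posDef _ (nonzero (proj₂ nonempty))

  0<2 : 0# < 1# + 1#
  0<2 = <-trans 0<1 (<-respˡ (+-identityʳ 1#) (+-monoʳ-< 1# 0<1))

  κ>0 : 0# < κ
  κ>0 = *-pos 0<2 (⁻¹-positive N>0)

  -- All roots have the same norm N, so ⟨ v , β^∨ ⟩ is ⟦ v , β ⟧.
  ⟦_,_⟧ : Carrierᴹ → Carrierᴹ → Carrier
  ⟦ u , v ⟧ = κ * ⟨ u , v ⟩

  ⟦⟧-cong : ∀ {u u′ v v′} → u ≈ᴹ u′ → v ≈ᴹ v′ → ⟦ u , v ⟧ ≈ ⟦ u′ , v′ ⟧
  ⟦⟧-cong p q = *-congˡ (⟨⟩-cong p q)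

  ⟦⟧-sym : ∀ u v → ⟦ u , v ⟧ ≈ ⟦ v , u ⟧
  ⟦⟧-sym u v = *-congˡ (⟨⟩-sym u v)

  ⟦⟧-+ˡ : ∀ u v w → ⟦ u +ᴹ v , w ⟧ ≈ ⟦ u , w ⟧ + ⟦ v , w ⟧
  ⟦⟧-+ˡ u v w = trans (*-congˡ (⟨⟩-+ˡ u v w)) (distribˡ κ _ _)

  ⟦⟧-*ˡ : ∀ a u w → ⟦ a *ₗ u , w ⟧ ≈ a * ⟦ u , w ⟧
  ⟦⟧-*ˡ a u w = trans (*-congˡ (⟨⟩-*ˡ a u w)) (x*yz≈y*xz κ a _)

  ⟦⟧-0ˡ : ∀ w → ⟦ 0ᴹ , w ⟧ ≈ 0#
  ⟦⟧-0ˡ w = trans (⟦⟧-cong (≈ᴹ-sym (*ₗ-zeroˡ 0ᴹ)) ≈ᴹ-refl) (trans (⟦⟧-*ˡ 0# 0ᴹ w) (zeroˡ _))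

  ⟦⟧-negˡ : ∀ u w → ⟦ -ᴹ u , w ⟧ ≈ - ⟦ u , w ⟧
  ⟦⟧-negˡ u w = trans (⟦⟧-cong (-ᴹ≈-1*ₗ u) ≈ᴹ-refl) (trans (⟦⟧-*ˡ (- 1#) u w) (-1*x≈-x _))

  ⟦⟧-positive : ∀ {v} → ¬ v ≈ᴹ 0ᴹ → 0# < ⟦ v , v ⟧
  ⟦⟧-positive {v} v≉0 = *-pos κ>0 (⟨⟩-posDef v v≉0)

  lin-⟦⟧ : ∀ {k} (a : Fin k → Carrier) u w → ⟦ lin a u , w ⟧ ≈ ∑ (λ i → a i * ⟦ u i , w ⟧)
  lin-⟦⟧ {zero}  a u w = ⟦⟧-0ˡ w
  lin-⟦⟧ {suc k} a u w = trans (⟦⟧-+ˡ _ _ w)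
    (+-cong (⟦⟧-*ˡ (a zero) (u zero) w) (lin-⟦⟧ (a ∘ suc) (u ∘ suc) w))

  lin-⟪⟫ : ∀ {k} (x y : Fin k → ℤ) u w → (∀ i → ⟦ u i , w ⟧ ≈ fromℤ (y i)) →
           ⟦ lin (fromℤ ∘ x) u , w ⟧ ≈ fromℤ ⟪ y , x ⟫
  lin-⟪⟫ x y u w u⊳y = begin
    ⟦ lin (fromℤ ∘ x) u , w ⟧             ≈⟨ lin-⟦⟧ (fromℤ ∘ x) u w ⟩
    ∑ (λ i → fromℤ (x i) * ⟦ u i , w ⟧)   ≈⟨ ∑-cong (λ i → trans (*-comm _ _) (*-congʳ (u⊳y i))) ⟩
    ∑ (λ i → fromℤ (y i) * fromℤ (x i))   ≈⟨ ∑-cong (λ i → fromℤ-* (y i) (x i)) ⟨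
    ∑ (λ i → fromℤ (y i ℤ.* x i))         ≈⟨ fromℤ-∑ (λ i → y i ℤ.* x i) ⟨
    fromℤ (sumℤ (λ i → y i ℤ.* x i))      ≡⟨ ≡.cong fromℤ (⟪⟫-sum y x) ⟨
    fromℤ ⟪ y , x ⟫                       ∎
    where open K-Reasoning

  coroot : ∀ {β} → Φ β → ∀ v → ⟨ v , β ^∨ ⟩ ≈ ⟦ v , β ⟧
  coroot {β} β∈Φ v = begin
    ⟨ v , β ^∨ ⟩                             ≈⟨ ⟨⟩-sym v _ ⟩
    ⟨ β ^∨ , v ⟩                             ≈⟨ ⟨⟩-*ˡ _ β v ⟩
    ((1# + 1#) * ⟨ β , β ⟩ ⁻¹) * ⟨ β , v ⟩   ≈⟨ *-cong (*-congˡ (⁻¹-cong (0<⇒≉0 (⟨⟩-posDef β (nonzero β∈Φ)))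
                                                  (simplyLaced β∈Φ (proj₂ nonempty)))) (⟨⟩-sym β v) ⟩
    ⟦ v , β ⟧                                ∎
    where open K-Reasoning

  root-norm : ∀ {β} → Φ β → ⟦ β , β ⟧ ≈ fromℤ (+ 2)
  root-norm {β} β∈Φ = begin
    ((1# + 1#) * N ⁻¹) * ⟨ β , β ⟩   ≈⟨ *-congˡ (simplyLaced β∈Φ (proj₂ nonempty)) ⟩
    ((1# + 1#) * N ⁻¹) * N           ≈⟨ *-assoc _ _ _ ⟩
    (1# + 1#) * (N ⁻¹ * N)           ≈⟨ *-congˡ (trans (*-comm _ _) (⁻¹-inverseʳ N (0<⇒≉0 N>0))) ⟩
    (1# + 1#) * 1#                   ≈⟨ *-identityʳ _ ⟩
    1# + 1#                          ≈⟨ fromℤ-2 ⟨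
    fromℤ (+ 2)                      ∎
    where open K-Reasoning

  C : Fin n → Fin n → ℤ
  C i j = proj₁ (crystallographic (α∈Φ j) (α∈Φ i))

  C-value : ∀ i j → ⟦ α i , α j ⟧ ≈ fromℤ (C i j)
  C-value i j = trans (sym (coroot (α∈Φ j) (α i))) (proj₂ (crystallographic (α∈Φ j) (α∈Φ i)))

  C-diag : ∀ i → C i i ≡ + 2
  C-diag i = fromℤ-injective _ _ (trans (sym (C-value i i)) (root-norm (α∈Φ i)))

  C-sym : ∀ i j → C i j ≡ C j i
  C-sym i j = fromℤ-injective _ _ (trans (sym (C-value i j)) (trans (⟦⟧-sym (α i) (α j)) (C-value j i)))

  open SymmetricForm C C-diag C-sym using (A; Q; A-e; A-·; Q-e; Q-⊕e)

  L : (Fin n → ℤ) → Carrierᴹ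
  L x = lin (fromℤ ∘ x) α

  L-cong : ∀ {x y} → x ≗ y → L x ≈ᴹ L y
  L-cong x≗y = lin-cong α (λ i → reflexive (≡.cong fromℤ (x≗y i)))

  L-⊕ : ∀ x y → L (x ⊕ y) ≈ᴹ L x +ᴹ L y
  L-⊕ x y = ≈ᴹ-trans (lin-cong α (λ i → fromℤ-+ (x i) (y i))) (lin-+ (fromℤ ∘ x) (fromℤ ∘ y) α)

  L-· : ∀ k x → L (k · x) ≈ᴹ fromℤ k *ₗ L x
  L-· k x = ≈ᴹ-trans (lin-cong α (λ i → fromℤ-* k (x i))) (lin-* (fromℤ k) (fromℤ ∘ x) α)

  L-neg : ∀ x → L (-1ℤ · x) ≈ᴹ -ᴹ L x
  L-neg x = ≈ᴹ-trans (L-· -1ℤ x) (≈ᴹ-trans (*ₗ-congʳ fromℤ--1) (≈ᴹ-sym (-ᴹ≈-1*ₗ (L x))))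

  lin-injective : ∀ a b → lin a α ≈ᴹ lin b α → ∀ i → a i ≈ b i
  lin-injective a b p i = begin
    a i                         ≈⟨ +-identityʳ _ ⟨
    a i + 0#                    ≈⟨ +-congˡ (-‿inverseˡ (b i)) ⟨
    a i + (- b i + b i)         ≈⟨ +-assoc _ _ _ ⟨
    (a i + - b i) + b i         ≈⟨ +-congʳ (+-congˡ (-1*x≈-x (b i))) ⟨
    (a i + - 1# * b i) + b i    ≈⟨ +-congʳ (independent (λ j → a j + - 1# * b j) difference i) ⟩
    0# + b i                    ≈⟨ +-identityˡ _ ⟩
    b i                         ∎
    where
    open K-Reasoning
    difference : lin (λ j → a j + - 1# * b j) α ≈ᴹ 0ᴹ
    difference = ≈ᴹ-trans (lin-+ a (λ j → - 1# * b j) α) (≈ᴹ-trans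
      (+ᴹ-cong p (≈ᴹ-trans (lin-* (- 1#) b α) (≈ᴹ-sym (-ᴹ≈-1*ₗ _)))) (-ᴹ‿inverseʳ _))

  L-injective : ∀ x y → L x ≈ᴹ L y → x ≗ y
  L-injective x y p i = fromℤ-injective _ _ (lin-injective (fromℤ ∘ x) (fromℤ ∘ y) p i)

  -- The weight coordinates of a vector; a relation, since only vectors with integral pairings have
  -- them. Being a record, it lets `v` and `x` be inferred from a proof.
  infix 4 _⊳_
  record _⊳_ (v : Carrierᴹ) (x : Fin n → ℤ) : Set ℓ₁ where
    constructor has-pairings
    field pairing : ∀ i → ⟦ v , α i ⟧ ≈ fromℤ (x i)
  open _⊳_

  ⊳-L : ∀ {v x} → v ⊳ x → ∀ y → ⟦ v , L y ⟧ ≈ fromℤ ⟪ x , y ⟫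
  ⊳-L {v} {x} v⊳x y = trans (⟦⟧-sym v (L y))
    (lin-⟪⟫ y x α v (λ i → trans (⟦⟧-sym (α i) v) (pairing v⊳x i)))

  L⊳A : ∀ x → L x ⊳ A x
  L⊳A x = has-pairings λ j → trans (⟦⟧-sym (L x) (α j)) (⊳-L (has-pairings (C-value j)) x)

  ⟦L,L⟧ : ∀ x y → ⟦ L x , L y ⟧ ≈ fromℤ ⟪ A x , y ⟫
  ⟦L,L⟧ x y = ⊳-L (L⊳A x) y

  Q-pos : ∀ x i → x i ≢ 0ℤ → 0ℤ ℤ.< Q x
  Q-pos x i xi≢0 = 0<fromℤ⇒0< (Q x) (<-respʳ (⟦L,L⟧ x x)
    (⟦⟧-positive (λ Lx≈0 → xi≢0 (fromℤ≈0⇒≡0 (x i) (independent (fromℤ ∘ x) Lx≈0 i)))))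

  nonneg-coordinates : ∀ {β} → IsNonnegCombination β →
                       Σ (Fin n → ℤ) λ b → (∀ i → 0ℤ ℤ.≤ b i) × β ≈ᴹ L b
  nonneg-coordinates (a , β≈) = (λ i → + a i) , (λ i → ℤ.+≤+ ℕ.z≤n) , ≈ᴹ-trans β≈ (∑·ᴹ≈lin a α)

  signed-coordinates : ∀ {β} → Φ β → Σ (Fin n → ℤ) λ b → (∀ i → 0ℤ ℤ.≤ b i) ×
                       (β ≈ᴹ L b ⊎ β ≈ᴹ L (-1ℤ · b))
  signed-coordinates {β} β∈Φ with signed β∈Φ
  ... | inj₁ pos = let (b , 0≤b , p) = nonneg-coordinates pos in b , 0≤b , inj₁ p
  ... | inj₂ neg = let (b , 0≤b , p) = nonneg-coordinates neg in
    b , 0≤b , inj₂ (≈ᴹ-trans (≈ᴹ-sym (-ᴹ-involutive β)) (≈ᴹ-trans (-ᴹ‿cong p) (≈ᴹ-sym (L-neg b))))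

  reflect≈ : ∀ {β} → Φ β → ∀ v z → ⟦ v , β ⟧ ≈ fromℤ z → reflect β v ≈ᴹ v +ᴹ fromℤ (ℤ.- z) *ₗ β
  reflect≈ {β} β∈Φ v z p = +ᴹ-congˡ (begin
    -ᴹ (⟨ v , β ^∨ ⟩ *ₗ β)        ≈⟨ -ᴹ≈-1*ₗ _ ⟩
    (- 1#) *ₗ ⟨ v , β ^∨ ⟩ *ₗ β   ≈⟨ *ₗ-assoc _ _ β ⟨
    (- 1# * ⟨ v , β ^∨ ⟩) *ₗ β    ≈⟨ *ₗ-congʳ (trans (-1*x≈-x _)
                                      (trans (-‿cong (trans (coroot β∈Φ v) p)) (sym (fromℤ-neg z)))) ⟩
    fromℤ (ℤ.- z) *ₗ β            ∎)
    where open V-Reasoning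

  -- The reflection of α_j in α_i is a root with coefficient 1 at α_j and
  -- - C_ij at α_i, so it is positive.
  C-nonpos : ∀ {i j} → i ≢ j → C i j ℤ.≤ 0ℤ
  C-nonpos {i} {j} i≢j with signed-coordinates (reflection-closed (α∈Φ i) (α∈Φ j))
  ... | b , 0≤b , sign = cases sign
    where
    x : Fin n → ℤ
    x = e j ⊕ (ℤ.- C j i) · e i
    s≈ : reflect (α i) (α j) ≈ᴹ L x
    s≈ = ≈ᴹ-trans (reflect≈ (α∈Φ i) (α j) (C j i) (C-value j i)) (≈ᴹ-sym
      (≈ᴹ-trans (L-⊕ (e j) ((ℤ.- C j i) · e i))
        (+ᴹ-cong (lin-e α j) (≈ᴹ-trans (L-· (ℤ.- C j i) (e i)) (*ₗ-congˡ (lin-e α i))))))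
    at-i : x i ≡ ℤ.- C j i
    at-i rewrite e-off (i≢j ∘ ≡.sym) | e-diag i =
      ≡.trans (ℤ.+-identityˡ _) (ℤ.*-identityʳ _)
    at-j : x j ≡ 1ℤ
    at-j rewrite e-off i≢j | e-diag j = ≡.cong (ℤ._+_ 1ℤ) (ℤ.*-zeroʳ (ℤ.- C j i))
    cases : reflect (α i) (α j) ≈ᴹ L b ⊎ reflect (α i) (α j) ≈ᴹ L (-1ℤ · b) → C i j ℤ.≤ 0ℤ
    cases (inj₁ p) = ≡.subst (ℤ._≤ 0ℤ) (C-sym j i) (ℤ.neg-cancel-≤
      (≡.subst (0ℤ ℤ.≤_) (≡.trans (≡.sym (L-injective x b (≈ᴹ-trans (≈ᴹ-sym s≈) p) i)) at-i) (0≤b i)))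
    cases (inj₂ p) = contradiction
      (≡.subst (ℤ._≤ 0ℤ) (≡.trans (≡.sym (L-injective x (-1ℤ · b) (≈ᴹ-trans (≈ᴹ-sym s≈) p) j)) at-j)
        (≡.subst (ℤ._≤ 0ℤ) (≡.sym (ℤ.-1*i≡-i (b j))) (ℤ.neg-mono-≤ (0≤b j))))
      λ { (ℤ.+≤+ ()) }

  -- The norm `4 + 2 * C i j` of `α_i + α_j` is positive, so the entry is above -2.
  C-off : ∀ {i j} → i ≢ j → C i j ≡ 0ℤ ⊎ C i j ≡ -1ℤ
  C-off {i} {j} i≢j = cases (C i j) (C-nonpos i≢j) (≡.subst (0ℤ ℤ.<_) norm
    (Q-pos (e j ⊕ e i) i λ p → contradiction (≡.trans (≡.sym value) p) λ ()))
    where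
    value : (e j ⊕ e i) i ≡ 1ℤ
    value rewrite e-off (i≢j ∘ ≡.sym) | e-diag i = ≡.refl
    norm : Q (e j ⊕ e i) ≡ + 2 ℤ.+ + 2 ℤ.* C i j ℤ.+ + 2
    norm rewrite Q-⊕e (e j) i | Q-e j | A-e j i = ≡.refl
    cases : ∀ z → z ℤ.≤ 0ℤ → 0ℤ ℤ.< + 2 ℤ.+ + 2 ℤ.* z ℤ.+ + 2 → z ≡ 0ℤ ⊎ z ≡ -1ℤ
    cases (+ zero)        _ _ = inj₁ ≡.refl
    cases (+ suc k)       (ℤ.+≤+ ()) _
    cases -[1+ zero ]     _ _ = inj₂ ≡.refl
    cases -[1+ suc k ]    _ 0<z = contradiction
      (nonneg*nonpos (+ 2) (-[1+ suc k ] ℤ.+ + 2) (ℤ.+≤+ ℕ.z≤n) (ℤ.+-monoˡ-≤ (+ 2) { -[1+ suc k ]} { -[1+ 1 ]} (ℤ.-≤- (ℕ.s≤s ℕ.z≤n))))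
      (ℤ.<⇒≱ (≡.subst (0ℤ ℤ.<_) (alg -[1+ suc k ]) 0<z))
      where
      alg : ∀ a → + 2 ℤ.+ + 2 ℤ.* a ℤ.+ + 2 ≡ + 2 ℤ.* (a ℤ.+ + 2)
      alg = solve-∀

  edge⇔ : ∀ i j → DynkinEdge i j ⇔ C i j ≡ -1ℤ
  edge⇔ i j = mk⇔
    (λ (_ , p) → fromℤ-injective _ _ (trans (sym (C-value i j)) (trans (sym (coroot (α∈Φ j) (α i)))
                   (trans p (sym fromℤ--1)))))
    (λ p → (λ { ≡.refl → contradiction (≡.trans (≡.sym (C-diag i)) p) λ () }) ,
           trans (coroot (α∈Φ j) (α i)) (trans (C-value i j)
             (trans (reflexive (≡.cong fromℤ p)) fromℤ--1)))

  open Moves C C-diag C-sym C-off Q-pos DynkinEdge edge⇔ hiding (A; Q; A-e; A-·; Q-e; Q-⊕e)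
  open UCF DynkinEdge

  -- Roots and orbits in coordinates.

  Q-neg : ∀ b → Q (-1ℤ · b) ≡ Q b
  Q-neg b = ≡.trans (⟪⟫-congˡ (-1ℤ · b) (A-· -1ℤ b)) (≡.trans (⟪⟫-·ˡ -1ℤ (A b) (-1ℤ · b))
    (≡.trans (≡.cong (-1ℤ ℤ.*_) (⟪⟫-·ʳ (A b) -1ℤ b)) (alg (Q b))))
    where
    alg : ∀ a → -1ℤ ℤ.* (-1ℤ ℤ.* a) ≡ a
    alg = solve-∀

  norm-2 : ∀ {β} → Φ β → ∀ x → β ≈ᴹ L x → Q x ≡ + 2
  norm-2 β∈Φ x p = fromℤ-injective _ _
    (trans (sym (⟦L,L⟧ x x)) (trans (⟦⟧-cong (≈ᴹ-sym p) (≈ᴹ-sym p)) (root-norm β∈Φ)))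

  root-coordinates : ∀ {β} → Φ β → ∃[ b ] (Root b × (β ≈ᴹ L b ⊎ β ≈ᴹ L (-1ℤ · b)))
  root-coordinates β∈Φ with signed-coordinates β∈Φ
  ... | b , 0≤b , inj₁ p = b , (0≤b , norm-2 β∈Φ b p) , inj₁ p
  ... | b , 0≤b , inj₂ p = b , (0≤b , ≡.trans (≡.sym (Q-neg b)) (norm-2 β∈Φ (-1ℤ · b) p)) , inj₂ p

  -- At a pairing -1, adding `α_i` is reflecting in `α_i`, and `Φ` is closed under reflections.
  root⇒Φ : ∀ b → Root b → Φ (L b)
  root⇒Φ = root-induction (Φ ∘ L) (λ x≗y → Φ-resp (L-cong x≗y))
    (λ i → Φ-resp (≈ᴹ-sym (lin-e α i)) (α∈Φ i)) grow
    where
    grow : ∀ b i → Root b → A b i ≡ -1ℤ → Φ (L b) → Φ (L (b ⊕ e i))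
    grow b i _ A≡-1 Lb∈Φ = Φ-resp (begin
      reflect (α i) (L b)        ≈⟨ reflect≈ (α∈Φ i) (L b) -1ℤ
                                      (trans (pairing (L⊳A b) i) (reflexive (≡.cong fromℤ A≡-1))) ⟩
      L b +ᴹ fromℤ 1ℤ *ₗ α i     ≈⟨ +ᴹ-congˡ (≈ᴹ-trans (*ₗ-congʳ fromℤ-1) (*ₗ-identityˡ (α i))) ⟩
      L b +ᴹ α i                 ≈⟨ +ᴹ-congˡ (lin-e α i) ⟨
      L b +ᴹ L (e i)             ≈⟨ L-⊕ b (e i) ⟨
      L (b ⊕ e i)                ∎) (reflection-closed (α∈Φ i) Lb∈Φ)
      where open V-Reasoning

  ⊳-respˡ : ∀ {u v x} → u ≈ᴹ v → v ⊳ x → u ⊳ x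
  ⊳-respˡ u≈v v⊳x = has-pairings λ i → trans (⟦⟧-cong u≈v ≈ᴹ-refl) (pairing v⊳x i)

  ⊳-respʳ : ∀ {v x y} → x ≗ y → v ⊳ x → v ⊳ y
  ⊳-respʳ x≗y v⊳x = has-pairings λ i → trans (pairing v⊳x i) (reflexive (≡.cong fromℤ (x≗y i)))

  ⊳-functional : ∀ {v x y} → v ⊳ x → v ⊳ y → x ≗ y
  ⊳-functional v⊳x v⊳y i = fromℤ-injective _ _ (trans (sym (pairing v⊳x i)) (pairing v⊳y i))

  ⊳-+ : ∀ {u v x y} → u ⊳ x → v ⊳ y → u +ᴹ v ⊳ x ⊕ y
  ⊳-+ {u} {v} {x} {y} u⊳x v⊳y = has-pairings λ i → trans (⟦⟧-+ˡ u v (α i))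
    (trans (+-cong (pairing u⊳x i) (pairing v⊳y i)) (sym (fromℤ-+ (x i) (y i))))

  ⊳-* : ∀ k {v x} → v ⊳ x → fromℤ k *ₗ v ⊳ k · x
  ⊳-* k {v} {x} v⊳x = has-pairings λ i → trans (⟦⟧-*ˡ (fromℤ k) v (α i))
    (trans (*-congˡ (pairing v⊳x i)) (sym (fromℤ-* k (x i))))

  ⊳-root : ∀ {v x β b} → v ⊳ x → β ≈ᴹ L b → ⟦ v , β ⟧ ≈ fromℤ ⟪ x , b ⟫
  ⊳-root {b = b} v⊳x β≈Lb = trans (⟦⟧-cong ≈ᴹ-refl β≈Lb) (⊳-L v⊳x b)

  -- A root and its negative have the same reflection, so `reflection-~` for nonnegative coordinates
  -- covers both signs.
  reflect-⊳ : ∀ {β v x} → Φ β → v ⊳ x → ∃[ y ] (reflect β v ⊳ y × y ~ x)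
  reflect-⊳ {β} {v} {x} β∈Φ v⊳x = let (b , root , sign) = root-coordinates β∈Φ in cases b root sign
    where
    coordinates : ∀ z → β ≈ᴹ L z → reflect β v ⊳ reflection z x
    coordinates z p = ⊳-respˡ
      (reflect≈ β∈Φ v ⟪ x , z ⟫ (⊳-root {b = z} v⊳x p))
      (⊳-+ v⊳x (⊳-* (ℤ.- ⟪ x , z ⟫) (⊳-respˡ p (L⊳A z))))
    alg : ∀ a p q → a ℤ.+ ℤ.- (-1ℤ ℤ.* p) ℤ.* (-1ℤ ℤ.* q) ≡ a ℤ.+ ℤ.- p ℤ.* q
    alg = solve-∀
    reflection-neg : ∀ b → reflection (-1ℤ · b) x ≗ reflection b x
    reflection-neg b i rewrite ⟪⟫-·ʳ x -1ℤ b | A-· -1ℤ b i = alg (x i) ⟪ x , b ⟫ (A b i)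
    cases : ∀ b → Root b → β ≈ᴹ L b ⊎ β ≈ᴹ L (-1ℤ · b) → ∃[ y ] (reflect β v ⊳ y × y ~ x)
    cases b root (inj₁ p) = reflection b x , coordinates b p , reflection-~ b root x
    cases b root (inj₂ p) = reflection b x ,
      ⊳-respʳ (reflection-neg b) (coordinates (-1ℤ · b) p) , reflection-~ b root x

  orbit-⊳ : ∀ {u v x} → u ∈W∙ v → v ⊳ x → ∃[ y ] (u ⊳ y × y ~ x)
  orbit-⊳ {u} {v} {x} (w , u≈) v⊳x = let (y , wv⊳y , y~x) = act-⊳ w in y , ⊳-respˡ u≈ wv⊳y , y~x
    where
    act-⊳ : ∀ w → ∃[ y ] (act w v ⊳ y × y ~ x)
    act-⊳ []              = x , v⊳x , ~-refl
    act-⊳ ((β , β∈Φ) ∷ w) =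
      let (y , wv⊳y , y~x)  = act-⊳ w
          (z , βwv⊳z , z~y) = reflect-⊳ β∈Φ wv⊳y
      in z , βwv⊳z , ~-trans z~y y~x

  InSpan : Carrierᴹ → Set _
  InSpan v = Σ (Fin n → Carrier) λ a → v ≈ᴹ lin a α

  in-span : ∀ v → InSpan v
  in-span v with spanning v
  ... | k , a , β , β∈Φ , v≈ = let (c , p) = combination k a β β∈Φ in c , ≈ᴹ-trans v≈ p
    where
    root-in-span : ∀ {β} → Φ β → InSpan β
    root-in-span β∈Φ with root-coordinates β∈Φ
    ... | b , _ , inj₁ p = fromℤ ∘ b , p
    ... | b , _ , inj₂ p = fromℤ ∘ (-1ℤ · b) , p
    combination : ∀ k (a : Fin k → Carrier) β → (∀ i → Φ (β i)) → InSpan (lin a β)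
    combination zero    a β β∈Φ = (λ _ → 0#) , ≈ᴹ-sym (lin-0 α (λ _ → refl))
    combination (suc k) a β β∈Φ =
      let (c , p) = root-in-span (β∈Φ zero)
          (d , q) = combination k (a ∘ suc) (β ∘ suc) (β∈Φ ∘ suc)
      in (λ i → a zero * c i + d i) , ≈ᴹ-sym (≈ᴹ-trans (lin-+ (λ i → a zero * c i) d α)
           (+ᴹ-cong (≈ᴹ-trans (lin-* (a zero) c α) (*ₗ-congˡ (≈ᴹ-sym p))) (≈ᴹ-sym q)))

  -- Positive definiteness only refutes v ≉ 0; since equality of scalars is
  -- decidable, v ≈ 0 is recovered from the coordinates of v.
  nondegenerate : ∀ v → (∀ i → ⟦ v , α i ⟧ ≈ 0#) → v ≈ᴹ 0ᴹ
  nondegenerate v ⊥v with in-span v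
  ... | a , v≈ = ≈ᴹ-trans v≈ (lin-0 α a≈0)
    where
    isotropic : ⟦ v , v ⟧ ≈ 0#
    isotropic = trans (⟦⟧-cong v≈ ≈ᴹ-refl) (trans (lin-⟦⟧ a α v) (∑-zero λ i →
      trans (*-congˡ (trans (⟦⟧-sym (α i) v) (⊥v i))) (zeroʳ (a i))))
      where
      ∑-zero : ∀ {k} {f : Fin k → Carrier} → (∀ i → f i ≈ 0#) → ∑ f ≈ 0#
      ∑-zero {zero}  f≈0 = refl
      ∑-zero {suc k} f≈0 = trans (+-cong (f≈0 zero) (∑-zero (f≈0 ∘ suc))) (+-identityʳ 0#)
    a≈0 : ∀ i → a i ≈ 0#
    a≈0 i with a i ≈? 0#
    ... | yes p = p
    ... | no ¬p = contradiction isotropic (0<⇒≉0 (⟦⟧-positive λ v≈0 →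
            ¬p (independent a (≈ᴹ-trans (≈ᴹ-sym v≈) v≈0) i)))

  ⊳-injective : ∀ {u v x} → u ⊳ x → v ⊳ x → u ≈ᴹ v
  ⊳-injective {u} {v} u⊳x v⊳x = begin
    u                    ≈⟨ +ᴹ-identityʳ u ⟨
    u +ᴹ 0ᴹ              ≈⟨ +ᴹ-congˡ (-ᴹ‿inverseˡ v) ⟨
    u +ᴹ (-ᴹ v +ᴹ v)     ≈⟨ +ᴹ-assoc u (-ᴹ v) v ⟨
    (u +ᴹ -ᴹ v) +ᴹ v     ≈⟨ +ᴹ-congʳ (nondegenerate (u +ᴹ -ᴹ v) orthogonal) ⟩
    0ᴹ +ᴹ v              ≈⟨ +ᴹ-identityˡ v ⟩
    v                    ∎
    where
    open V-Reasoning
    orthogonal : ∀ i → ⟦ u +ᴹ -ᴹ v , α i ⟧ ≈ 0#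
    orthogonal i = trans (⟦⟧-+ˡ u (-ᴹ v) (α i)) (trans
      (+-cong (trans (pairing u⊳x i) (sym (pairing v⊳x i))) (⟦⟧-negˡ v (α i))) (-‿inverseʳ _))

  ⊳⇒weight : ∀ {v x} → v ⊳ x → InWeightLattice v
  ⊳⇒weight {v} {x} v⊳x β∈Φ with root-coordinates β∈Φ
  ... | b , _ , inj₁ p = ⟪ x , b ⟫ , trans (coroot β∈Φ v) (⊳-root {b = b} v⊳x p)
  ... | b , _ , inj₂ p = ⟪ x , -1ℤ · b ⟫ , trans (coroot β∈Φ v) (⊳-root {b = -1ℤ · b} v⊳x p)

  -- Central-firing and UCF moves on dominant weights.

  module _ (ω : Fin n → Carrierᴹ) (fundamental : AreFundamentalWeights ω) where

    weight-⊳ : ∀ γ → weight ω γ ⊳ weightOf γ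
    weight-⊳ γ = has-pairings λ j → trans (⟦⟧-cong (∑·ᴹ≈lin γ ω) ≈ᴹ-refl) (trans
      (lin-⟪⟫ (weightOf γ) (e j) ω (α j) (dual j))
      (reflexive (≡.cong fromℤ (≡.trans (⟪⟫-comm (e j) (weightOf γ)) (⟪⟫-e (weightOf γ) j)))))
      where
      dual : ∀ j i → ⟦ ω i , α j ⟧ ≈ fromℤ (e j i)
      dual j i with j Fin.≟ i
      ... | yes ≡.refl = trans (sym (coroot (α∈Φ j) (ω i))) (trans (proj₁ fundamental i)
              (trans (sym fromℤ-1) (reflexive (≡.cong fromℤ (≡.sym (e-diag i))))))
      ... | no j≢i = trans (sym (coroot (α∈Φ j) (ω i))) (trans (proj₂ fundamental i j (j≢i ∘ ≡.sym))
              (reflexive (≡.cong fromℤ (≡.sym (e-off j≢i)))))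

    move⇒firing : ∀ γ γ′ → UCFMove γ γ′ → UnlabeledCentralFiring (weight ω γ) (weight ω γ′)
    move⇒firing γ γ′ move = let (b , root , ⊥b , moved) = move⇒fire move in firing b root ⊥b moved
      where
      nonneg : ∀ b → (∀ i → 0ℤ ℤ.≤ b i) → L b ≈ᴹ ∑ᴹ (λ i → ℤ.∣ b i ∣ ·ᴹ α i)
      nonneg b 0≤b = ≈ᴹ-sym (≈ᴹ-trans (∑·ᴹ≈lin (ℤ.∣_∣ ∘ b) α) (L-cong (λ i → ℤ.0≤i⇒+∣i∣≡i (0≤b i))))

      firing : ∀ b → Root b → ⟪ weightOf γ , b ⟫ ≡ 0ℤ → weightOf γ′ ≗ weightOf γ ⊕ A b →
               UnlabeledCentralFiring (weight ω γ) (weight ω γ′)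
      firing b root ⊥b moved =
        -- The dominant representatives themselves fire, by `θ_R`, so both Weyl words are empty.
        weight ω γ , weight ω γ′ , ([] , ≈ᴹ-refl) , ([] , ≈ᴹ-refl) ,
        ⊳⇒weight (weight-⊳ γ) , ⊳⇒weight (weight-⊳ γ′) ,
        L b , (Lb∈Φ , ℤ.∣_∣ ∘ b , nonneg b (proj₁ root)) ,
        trans (coroot Lb∈Φ _) (trans (⊳-L (weight-⊳ γ) b) (reflexive (≡.cong fromℤ ⊥b))) ,
        ⊳-injective (weight-⊳ γ′)
          (⊳-respʳ (λ i → ≡.sym (moved i)) (⊳-+ (weight-⊳ γ) (L⊳A b)))
        where
        Lb∈Φ : Φ (L b)
        Lb∈Φ = root⇒Φ b root

    -- The coordinates of `μ` are read off twice, from the orbit of `γ′` and from `v + β`. Comparing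
    -- them turns the firing into an equation of integer vectors, to which `fire⇒move` applies.
    firing⇒move : ∀ γ γ′ → UnlabeledCentralFiring (weight ω γ) (weight ω γ′) → UCFMove γ γ′
    firing⇒move γ γ′ (v , μ , v∈ , μ∈ , _ , _ , β , (β∈Φ , nonneg) , ⊥β , μ≈) =
      let (x , v⊳x , x~γ)  = orbit-⊳ v∈ (weight-⊳ γ)
          (y , μ⊳y , y~γ′) = orbit-⊳ μ∈ (weight-⊳ γ′)
          (b , 0≤b , β≈)   = nonneg-coordinates nonneg
      in fire⇒move γ γ′ x~γ y~γ′ (0≤b , norm-2 β∈Φ b β≈)
        (fromℤ≈0⇒≡0 ⟪ x , b ⟫ (trans (sym (⊳-root {b = b} v⊳x β≈)) (trans (sym (coroot β∈Φ v)) ⊥β)))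
        (⊳-functional μ⊳y (⊳-respˡ μ≈ (⊳-+ v⊳x (⊳-respˡ β≈ (L⊳A b)))))

theorem5p7 :
    ∀ {c ℓ₁ ℓ₂ m ℓm ℓ : Level} {K : OrderedField c ℓ₁ ℓ₂}
      {V : InnerProductSpace K m ℓm} (S : SimplyLacedRootSystem V ℓ)
      {n : ℕ} (Δ : SimpleRoots S n) →
    let open InnerProductSpace V using (Carrierᴹ)
        open SimpleRoots Δ
        open UCF DynkinEdge
    in
    (ω : Fin n → Carrierᴹ) → AreFundamentalWeights ω →
    (∀ (γ γ′ : Fin n → ℕ) →
       UCFMove γ γ′ ⇔ UnlabeledCentralFiring (weight ω γ) (weight ω γ′))
    ×
    (∀ (γ : Fin n → ℕ) (R₁ R₂ : Subset n) → R₁ ≢ R₂ →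
       ∀ (γ₁ γ₂ : Fin n → ℕ) → UCFMoveAlong R₁ γ γ₁ → UCFMoveAlong R₂ γ γ₂ →
       ∃[ R₂′ ] ∃[ R₁′ ]
         ( IsZeroComponent γ₁ R₂′ × R₂ ⊆ R₂′
         × IsZeroComponent γ₂ R₁′ × R₁ ⊆ R₁′
         × (∃[ δ ] (UCFMoveAlong R₂′ γ₁ δ × UCFMoveAlong R₁′ γ₂ δ))
         × (∀ δ₁ δ₂ → UCFMoveAlong R₂′ γ₁ δ₁ → UCFMoveAlong R₁′ γ₂ δ₂ → δ₁ ≗ δ₂)))
theorem5p7 S Δ ω fundamental =
  (λ γ γ′ → mk⇔ (move⇒firing ω fundamental γ γ′) (firing⇒move ω fundamental γ γ′)) ,
  Moves.moves-commute C C-diag C-sym C-off Q-pos (SimpleRoots.DynkinEdge Δ) edge⇔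
  where open Geometry S Δ
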